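{- Let $p$ be a prime and $d$ an integer with $d\mid p-1$, $1<d<p-1$ and $d\notin\{2,6\}$. Then there is no set $A\subseteq\mathbb F_p$ such that the pair $(A,-A)$ is $d$-critical, except possibly when $p=41$ and $d=20$.
   Context: $\mu_d$ denotes the set of $d$-th roots of unity in $\mathbb F_p$. A pair $(A,B)$ of subsets of $\mathbb F_p$ with $|A|,|B|>1$ is called $d$-critical if $A+B=\{a+b:a\in A,b\in B\}\subseteq\mu_d\cup\{0\}$ and $|A||B|=d+|(-A)\cap B|$, where $-A=\{ -a:a\in A\}$. -}

module Defs where

open import Data.Nat using (ℕ; _+_; _*_; _∸_; _^_; _<_; _%_; NonZero)
open import Data.Nat.DivMod using (_mod_)
open import Data.Fin using (Fin; toℕ)
open import Data.Fin.Subset using (Subset; _∈_; _∩_; ∣_∣)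
open import Data.Vec using (tabulate; lookup)
open import Data.Sum using (_⊎_)
open import Data.Product using (_×_)
open import Relation.Binary.PropositionalEquality using (_≡_)

-- The prime field F_p is modelled as Fin p (residues 0..p-1) with arithmetic mod p.

addF : (p : ℕ) .{{_ : NonZero p}} → Fin p → Fin p → Fin p
addF p x y = (toℕ x + toℕ y) mod p

negF : (p : ℕ) .{{_ : NonZero p}} → Fin p → Fin p
negF p x = (p ∸ toℕ x) mod p

InMu : (p : ℕ) .{{_ : NonZero p}} → ℕ → Fin p → Set
InMu p d x = (toℕ x ^ d) % p ≡ 1 % p

InMu0 : (p : ℕ) .{{_ : NonZero p}} → ℕ → Fin p → Set
InMu0 p d x = InMu p d x ⊎ toℕ x ≡ 0

-- -A = { -a : a ∈ A }, i.e. x ∈ -A iff -x ∈ A (negation is an involution)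
negSet : (p : ℕ) .{{_ : NonZero p}} → Subset p → Subset p
negSet p A = tabulate (λ x → lookup A (negF p x))

SumsetInMu0 : (p : ℕ) .{{_ : NonZero p}} → ℕ → Subset p → Subset p → Set
SumsetInMu0 p d A B = ∀ a b → a ∈ A → b ∈ B → InMu0 p d (addF p a b)

Critical : (p : ℕ) .{{_ : NonZero p}} → ℕ → Subset p → Subset p → Set
Critical p d A B =
  (1 < ∣ A ∣) × (1 < ∣ B ∣) × SumsetInMu0 p d A B
  × (∣ A ∣ * ∣ B ∣ ≡ d + ∣ negSet p A ∩ B ∣)

{-# OPTIONS --safe #-}
-- Write n = k + 1 = |A|; criticality of (A, −A) says d = n k and (a − b)ᵈ = 1 for distinct a, b in A.
-- Let f = ∏ (x + aᵢ) and let cᵢ be the weights of the divided difference at the aᵢ.  By Stepanov's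
-- method ∑ cᵢ (x + aᵢ)ᵏ⁺ᵈ − 1 has degree d and a zero of order k at each of the n roots of f, so it
-- equals C fᵏ.  Comparing the next terms of the Taylor expansions of both sides at a root of f shows
-- that, up to a constant factor, f = s (1 + α s)ⁿ + O(s⁵) in the local coordinate s there.  This
-- makes the fourth transvectant
--   T = n (n + 1) f f⁗ − 4 n (n − 2) f′ f‴ + 3 (n − 1) (n − 2) f″²
-- vanish doubly at every root of f; as deg T < 2 n, T = 0.  After a translation f = xⁿ + ε xⁿ⁻ᵐ + ⋯
-- with m ≥ 2, and the leading term of T = 0 reads n m (m − 1) (m + 1) ((n + 1) m − 6 (n − 1)) ε = 0.
-- Since p > 2 d, this forces ε = 0, hence f = xⁿ, unless (n, m) is (5, 4) or (11, 5) (f is then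
-- the form of an octahedron or an icosahedron).  In these two cases the coefficient of xᵈ⁻ᵐ in
-- C fᵏ gives ε = 0 as well, except when n = 5 and p = 41.
module Submission where

open import Defs
open import Algebra.Bundles using (CommutativeSemiring)
import Algebra.Solver.Ring.NaturalCoefficients.Default as NaturalCoefficients
open import Data.Bool using (true; false; if_then_else_)
open import Data.Empty using (⊥)
open import Data.Fin using (Fin; toℕ; zero; suc)
open import Data.Fin.Permutation using (Permutation; permutation)
import Data.Fin.Properties as Finₚ
open import Data.Fin.Subset using (Subset) renaming (_∈_ to _∈ˢ_; ∣_∣ to ∣_∣ˢ)
import Data.Fin.Subset.Properties as Subsetₚ
open import Data.Integer using (ℤ; +_; -_; _+_; _-_; _*_; _^_; ∣_∣; 0ℤ; 1ℤ)
open import Data.Integer.Divisibility.Signed using (∣n⇒∣m*n; ∣m∣n⇒∣m+n; ∣⇒∣ᵤ; ∣ᵤ⇒∣) renaming (_∣_ to _∣ᶻ_; divides to dividesᶻ)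
import Data.Integer.Properties as ℤₚ
open import Data.Integer.Tactic.RingSolver using (solve-∀)
open import Data.List using (List; []; _∷_; map; length)
open import Data.List.Membership.Propositional using (_∈_)
open import Data.List.Membership.Propositional.Properties using (∈-map⁻)
import Data.List.Properties as Listₚ
open import Data.List.Relation.Unary.All using (All; []; _∷_)
import Data.List.Relation.Unary.All as All
import Data.List.Relation.Unary.All.Properties as Allₚ
open import Data.List.Relation.Unary.AllPairs using (AllPairs; []; _∷_)
import Data.List.Relation.Unary.AllPairs as AllPairs
import Data.List.Relation.Unary.AllPairs.Properties as AllPairsₚ
open import Data.List.Relation.Unary.Any using (here; there)
open import Data.Nat using (ℕ; _∸_; _<_; NonZero)
open import Data.Nat using (zero; suc; z≤n; s≤s; _!; _%_; _/_; nonTrivial⇒n>1)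
open import Data.Nat using () renaming (_<_ to _<ⁿ_; _≤_ to _≤ⁿ_; _+_ to _+ⁿ_; _*_ to _*ⁿ_; _∸_ to _∸ⁿ_; _^_ to _^ⁿ_)
open import Data.Nat.Divisibility using (_∣_; divides; ∣⇒≤)
open import Data.Nat.DivMod using (m≡m%n+[m/n]*n; m%n<n)
open import Data.Nat.Primality using (Prime; euclidsLemma; prime⇒nonTrivial)
import Data.Nat.Properties as ℕₚ
open import Data.Nat.Tactic.RingSolver using () renaming (solve-∀ to ℕ-solve-∀)
open import Data.Product using (Σ; _×_; _,_; proj₁; proj₂)
open import Data.Sum using (_⊎_; inj₁; inj₂; [_,_]′)
open import Data.Vec using ([]; _∷_; lookup; tabulate; here; there)
open import Data.Vec.Properties using (lookup∘tabulate; tabulate∘lookup; []=⇒lookup; lookup⇒[]=)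
open import Level using (0ℓ)
open import Relation.Binary using (Setoid; tri<; tri≈; tri>)
open import Relation.Binary.PropositionalEquality using (_≡_; _≢_; refl; sym; trans; cong; cong₂; subst; module ≡-Reasoning)
import Relation.Binary.Reasoning.Setoid as SetoidReasoning
open import Relation.Nullary using (¬_; Dec; yes; no; contradiction)
open import Algebra.Properties.CommutativeMonoid.Sum ℕₚ.+-0-commutativeMonoid using (sum; sum-permute)

-- The shape of f comes from computing one Taylor series in two ways. Near a root, in the coordinate
-- s, write f = s φ and F = s^k G, where F is the sum of Stepanov's method. On the one hand G = C
-- φ^k. On the other hand the i-th coefficient of G is a binomial multiple of the weighted sum of
-- the (a - b)^(d - i), and for small i these sums are, up to a constant, the coefficients of 1 /
-- φ(- s). Because d = k (k + 1), the two agree identically in order one, which is why α stays free;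
-- orders two and three then give all that T needs. Classically, besides degenerate forms, the
-- vanishing of the fourth transvectant leaves the tetrahedron, the octahedron and the icosahedron.
-- The tetrahedron has n = 3, which is the excluded d = 6. In the octahedral case the last
-- comparison produces 123000 = 41 · 40 · 15 · 5, whence the prime 41. Division is avoided:
-- polynomials have integer coefficients and are compared mod p, Taylor coefficients carry their
-- factorials, and differences of nodes are inverted by their (d - 1)-st powers.

-- Integers modulo p.

module Congruence (p : ℕ) where
  infix 4 _≈_ _≉_

  -- A record rather than a synonym, so that unification recovers `x` and `y` from the type; the
  -- difference alone does not determine them.
  record _≈_ (x y : ℤ) : Set where
    constructor mod-p
    field divides-difference : + p ∣ᶻ x - y
  open _≈_

  _≉_ : ℤ → ℤ → Set
  x ≉ y = ¬ (x ≈ y)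

  ≡⇒≈ : ∀ {x y} → x ≡ y → x ≈ y
  ≡⇒≈ {x} refl = mod-p (subst (+ p ∣ᶻ_) (sym (ℤₚ.+-inverseʳ x)) (dividesᶻ 0ℤ refl))

  ≈-refl : ∀ {x} → x ≈ x
  ≈-refl = ≡⇒≈ refl

  -- Congruences are derived from certificates: `X - Y` is exhibited as an integer combination of
  -- differences already known to vanish mod p, and the remaining identity between integers is left
  -- to the ring solver.
  combine₁ : ∀ {X Y x y} l → x ≈ y → X - Y ≡ l * (x - y) → X ≈ Y
  combine₁ l (mod-p p∣) eq = mod-p (subst (+ p ∣ᶻ_) (sym eq) (∣n⇒∣m*n l p∣))

  combine₂ : ∀ {X Y x₁ y₁ x₂ y₂} l₁ l₂ → x₁ ≈ y₁ → x₂ ≈ y₂ →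
             X - Y ≡ l₁ * (x₁ - y₁) + l₂ * (x₂ - y₂) → X ≈ Y
  combine₂ l₁ l₂ (mod-p p∣₁) (mod-p p∣₂) eq =
    mod-p (subst (+ p ∣ᶻ_) (sym eq) (∣m∣n⇒∣m+n (∣n⇒∣m*n l₁ p∣₁) (∣n⇒∣m*n l₂ p∣₂)))

  combine₃ : ∀ {X Y x₁ y₁ x₂ y₂ x₃ y₃} l₁ l₂ l₃ → x₁ ≈ y₁ → x₂ ≈ y₂ → x₃ ≈ y₃ →
             X - Y ≡ l₁ * (x₁ - y₁) + l₂ * (x₂ - y₂) + l₃ * (x₃ - y₃) → X ≈ Y
  combine₃ l₁ l₂ l₃ (mod-p p∣₁) (mod-p p∣₂) (mod-p p∣₃) eq =
    mod-p (subst (+ p ∣ᶻ_) (sym eq)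
      (∣m∣n⇒∣m+n (∣m∣n⇒∣m+n (∣n⇒∣m*n l₁ p∣₁) (∣n⇒∣m*n l₂ p∣₂)) (∣n⇒∣m*n l₃ p∣₃)))

  combine₄ : ∀ {X Y x₁ y₁ x₂ y₂ x₃ y₃ x₄ y₄} l₁ l₂ l₃ l₄ → x₁ ≈ y₁ → x₂ ≈ y₂ → x₃ ≈ y₃ → x₄ ≈ y₄ →
             X - Y ≡ l₁ * (x₁ - y₁) + l₂ * (x₂ - y₂) + l₃ * (x₃ - y₃) + l₄ * (x₄ - y₄) → X ≈ Y
  combine₄ l₁ l₂ l₃ l₄ (mod-p p∣₁) (mod-p p∣₂) (mod-p p∣₃) (mod-p p∣₄) eq =
    mod-p (subst (+ p ∣ᶻ_) (sym eq)
      (∣m∣n⇒∣m+n (∣m∣n⇒∣m+n (∣m∣n⇒∣m+n (∣n⇒∣m*n l₁ p∣₁) (∣n⇒∣m*n l₂ p∣₂)) (∣n⇒∣m*n l₃ p∣₃)) (∣n⇒∣m*n l₄ p∣₄)))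

  ≈-sym : ∀ {x y} → x ≈ y → y ≈ x
  ≈-sym {x} {y} e = combine₁ (- 1ℤ) e (lemma x y)
    where
    lemma : ∀ x y → y - x ≡ - 1ℤ * (x - y)
    lemma = solve-∀

  ≈-trans : ∀ {x y z} → x ≈ y → y ≈ z → x ≈ z
  ≈-trans {x} {y} {z} e₁ e₂ = combine₂ 1ℤ 1ℤ e₁ e₂ (lemma x y z)
    where
    lemma : ∀ x y z → x - z ≡ 1ℤ * (x - y) + 1ℤ * (y - z)
    lemma = solve-∀

  ≈-setoid : Setoid 0ℓ 0ℓ
  ≈-setoid = record
    { Carrier = ℤ
    ; _≈_ = _≈_
    ; isEquivalence = record { refl = ≈-refl ; sym = ≈-sym ; trans = ≈-trans }
    }

  +-cong : ∀ {x y u v} → x ≈ y → u ≈ v → x + u ≈ y + v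
  +-cong {x} {y} {u} {v} e₁ e₂ = combine₂ 1ℤ 1ℤ e₁ e₂ (lemma x y u v)
    where
    lemma : ∀ x y u v → x + u - (y + v) ≡ 1ℤ * (x - y) + 1ℤ * (u - v)
    lemma = solve-∀

  *-cong : ∀ {x y u v} → x ≈ y → u ≈ v → x * u ≈ y * v
  *-cong {x} {y} {u} {v} e₁ e₂ = combine₂ u y e₁ e₂ (lemma x y u v)
    where
    lemma : ∀ x y u v → x * u - y * v ≡ u * (x - y) + y * (u - v)
    lemma = solve-∀

  *-congˡ : ∀ {u v} x → u ≈ v → x * u ≈ x * v
  *-congˡ x = *-cong (≈-refl {x})

  -‿cong : ∀ {x y} → x ≈ y → - x ≈ - y
  -‿cong {x} {y} e = combine₁ (- 1ℤ) e (lemma x y)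
    where
    lemma : ∀ x y → - x - - y ≡ - 1ℤ * (x - y)
    lemma = solve-∀

  ^-cong : ∀ {x y} k → x ≈ y → x ^ k ≈ y ^ k
  ^-cong zero    e = ≈-refl
  ^-cong (suc k) e = *-cong e (^-cong k e)

  *-zeroʳ′ : ∀ {y} x → y ≈ 0ℤ → x * y ≈ 0ℤ
  *-zeroʳ′ {y} x e = combine₁ x e (lemma x y)
    where
    lemma : ∀ x y → x * y - 0ℤ ≡ x * (y - 0ℤ)
    lemma = solve-∀

  -≈0⇒≈ : ∀ {x y} → x - y ≈ 0ℤ → x ≈ y
  -≈0⇒≈ {x} {y} e = combine₁ 1ℤ e (lemma x y)
    where
    lemma : ∀ x y → x - y ≡ 1ℤ * (x - y - 0ℤ)
    lemma = solve-∀

  ≈⇒-≈0 : ∀ {x y} → x ≈ y → x - y ≈ 0ℤ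
  ≈⇒-≈0 {x} {y} e = combine₁ 1ℤ e (lemma x y)
    where
    lemma : ∀ x y → x - y - 0ℤ ≡ 1ℤ * (x - y)
    lemma = solve-∀

  ≈0⇒∣ : ∀ {x} → x ≈ 0ℤ → p ∣ ∣ x ∣
  ≈0⇒∣ {x} (mod-p p∣) = subst (λ z → p ∣ ∣ z ∣) (ℤₚ.+-identityʳ x) (∣⇒∣ᵤ p∣)

  ∣⇒≈0 : ∀ {x} → p ∣ ∣ x ∣ → x ≈ 0ℤ
  ∣⇒≈0 {x} p∣ = mod-p (∣ᵤ⇒∣ (subst (λ z → p ∣ ∣ z ∣) (sym (ℤₚ.+-identityʳ x)) p∣))

  0<m<p⇒≉0 : ∀ {m} → 0 <ⁿ m → m <ⁿ p → + m ≉ 0ℤ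
  0<m<p⇒≉0 {suc m} _ m<p e = ℕₚ.<⇒≱ m<p (∣⇒≤ (≈0⇒∣ e))

  module Domain (p-prime : Prime p) where

    *-≈0 : ∀ x {y} → x * y ≈ 0ℤ → x ≈ 0ℤ ⊎ y ≈ 0ℤ
    *-≈0 x {y} e with euclidsLemma ∣ x ∣ ∣ y ∣ p-prime (subst (p ∣_) (ℤₚ.abs-* x y) (≈0⇒∣ e))
    ... | inj₁ p∣x = inj₁ (∣⇒≈0 p∣x)
    ... | inj₂ p∣y = inj₂ (∣⇒≈0 p∣y)

    *-cancel-≈0 : ∀ x {y} → x ≉ 0ℤ → x * y ≈ 0ℤ → y ≈ 0ℤ
    *-cancel-≈0 x x≉0 e with *-≈0 x e
    ... | inj₁ x≈0 = contradiction x≈0 x≉0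
    ... | inj₂ y≈0 = y≈0

    *-≉0 : ∀ {x y} → x ≉ 0ℤ → y ≉ 0ℤ → x * y ≉ 0ℤ
    *-≉0 {x} x≉0 y≉0 e = y≉0 (*-cancel-≈0 x x≉0 e)

    *-cancel : ∀ x {y z} → x ≉ 0ℤ → x * y ≈ x * z → y ≈ z
    *-cancel x {y} {z} x≉0 e = -≈0⇒≈ (*-cancel-≈0 x x≉0 (combine₁ 1ℤ e (lemma x y z)))
      where
      lemma : ∀ x y z → x * (y - z) - 0ℤ ≡ 1ℤ * (x * y - x * z)
      lemma = solve-∀

    1≉0 : 1ℤ ≉ 0ℤ
    1≉0 = 0<m<p⇒≉0 (s≤s z≤n) (nonTrivial⇒n>1 p {{prime⇒nonTrivial p-prime}})

    ^-≉0 : ∀ {x} k → x ≉ 0ℤ → x ^ k ≉ 0ℤ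
    ^-≉0 zero    x≉0 = 1≉0
    ^-≉0 (suc k) x≉0 = *-≉0 x≉0 (^-≉0 k x≉0)

-- Cauchy products of sequences.

shift : (ℕ → ℤ) → ℕ → ℤ
shift f k = f (suc k)

-- The Cauchy product, by recursion on the index. The ring laws are proved for sequences, where
-- unequal lengths and trailing zeros cause no trouble, and reach lists through `coef-⊗`.
conv : (ℕ → ℤ) → (ℕ → ℤ) → ℕ → ℤ
conv f g zero    = f 0 * g 0
conv f g (suc k) = f 0 * g (suc k) + conv (shift f) g k

conv-cong : ∀ {f f′ g g′} → (∀ k → f k ≡ f′ k) → (∀ k → g k ≡ g′ k) → ∀ k → conv f g k ≡ conv f′ g′ k
conv-cong e₁ e₂ zero    = cong₂ _*_ (e₁ 0) (e₂ 0)
conv-cong e₁ e₂ (suc k) =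
  cong₂ _+_ (cong₂ _*_ (e₁ 0) (e₂ (suc k))) (conv-cong (λ i → e₁ (suc i)) e₂ k)

conv-zeroˡ : ∀ g k → conv (λ _ → 0ℤ) g k ≡ 0ℤ
conv-zeroˡ g zero    = refl
conv-zeroˡ g (suc k) = trans (ℤₚ.+-identityˡ _) (conv-zeroˡ g k)

conv-+ˡ : ∀ f f′ g k → conv (λ i → f i + f′ i) g k ≡ conv f g k + conv f′ g k
conv-+ˡ f f′ g zero    = ℤₚ.*-distribʳ-+ (g 0) (f 0) (f′ 0)
conv-+ˡ f f′ g (suc k) = trans
  (cong (λ z → (f 0 + f′ 0) * g (suc k) + z) (conv-+ˡ (shift f) (shift f′) g k))
  (lemma (f 0) (f′ 0) (g (suc k)) _ _)
  where
  lemma : ∀ a b c x y → (a + b) * c + (x + y) ≡ a * c + x + (b * c + y)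
  lemma = solve-∀

conv-*ˡ : ∀ c f g k → conv (λ i → c * f i) g k ≡ c * conv f g k
conv-*ˡ c f g zero    = ℤₚ.*-assoc c (f 0) (g 0)
conv-*ˡ c f g (suc k) = trans
  (cong (λ z → c * f 0 * g (suc k) + z) (conv-*ˡ c (shift f) g k))
  (lemma c (f 0) (g (suc k)) _)
  where
  lemma : ∀ c a b x → c * a * b + c * x ≡ c * (a * b + x)
  lemma = solve-∀

conv-sucʳ : ∀ f g k → conv f g (suc k) ≡ conv f (shift g) k + f (suc k) * g 0
conv-sucʳ f g zero    = refl
conv-sucʳ f g (suc k) = trans
  (cong (λ z → f 0 * g (suc (suc k)) + z) (conv-sucʳ (shift f) g k))
  (sym (ℤₚ.+-assoc (f 0 * g (suc (suc k))) (conv (shift f) (shift g) k) (f (suc (suc k)) * g 0)))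

conv-comm : ∀ f g k → conv f g k ≡ conv g f k
conv-comm f g zero    = ℤₚ.*-comm (f 0) (g 0)
conv-comm f g (suc k) = begin
  f 0 * g (suc k) + conv (shift f) g k   ≡⟨ cong (λ z → f 0 * g (suc k) + z) (conv-comm (shift f) g k) ⟩
  f 0 * g (suc k) + conv g (shift f) k   ≡⟨ lemma (f 0) (g (suc k)) _ ⟩
  conv g (shift f) k + g (suc k) * f 0   ≡⟨ conv-sucʳ g f k ⟨
  conv g f (suc k)                       ∎
  where
  open ≡-Reasoning
  lemma : ∀ a b x → a * b + x ≡ x + b * a
  lemma = solve-∀

conv-assoc : ∀ f g h k → conv (conv f g) h k ≡ conv f (conv g h) k
conv-assoc f g h zero    = ℤₚ.*-assoc (f 0) (g 0) (h 0)
conv-assoc f g h (suc k) = begin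
  f 0 * g 0 * h (suc k) + conv (shift (conv f g)) h k
    ≡⟨ cong (λ z → f 0 * g 0 * h (suc k) + z) step ⟩
  f 0 * g 0 * h (suc k) + (f 0 * conv (shift g) h k + conv (shift f) (conv g h) k)
    ≡⟨ lemma (f 0) (g 0) (h (suc k)) _ _ ⟩
  f 0 * (g 0 * h (suc k) + conv (shift g) h k) + conv (shift f) (conv g h) k ∎
  where
  open ≡-Reasoning
  lemma : ∀ a b c x y → a * b * c + (a * x + y) ≡ a * (b * c + x) + y
  lemma = solve-∀
  step : conv (shift (conv f g)) h k ≡ f 0 * conv (shift g) h k + conv (shift f) (conv g h) k
  step = trans (conv-+ˡ (λ i → f 0 * g (suc i)) (conv (shift f) g) h k)
    (cong₂ _+_ (conv-*ˡ (f 0) (shift g) h k) (conv-assoc (shift f) g h k))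

deriv : (ℕ → ℤ) → ℕ → ℤ
deriv f k = + suc k * f (suc k)

-- Passing to `shift f` lowers every index by one, so the induction hypothesis misses one copy of
-- the product; that copy is what turns `deriv (shift f)` into `shift (deriv f)`.
conv-deriv : ∀ f g k → deriv (conv f g) k ≡ conv (deriv f) g k + conv f (deriv g) k
conv-deriv f g zero    = lemma (f 0) (f 1) (g 0) (g 1)
  where
  lemma : ∀ a b c d → 1ℤ * (a * d + b * c) ≡ 1ℤ * b * c + a * (1ℤ * d)
  lemma = solve-∀
conv-deriv f g (suc k) = begin
  + suc (suc k) * (f 0 * g (suc (suc k)) + conv (shift f) g (suc k))
    ≡⟨ split (+ suc k) (f 0) (g (suc (suc k))) (conv (shift f) g (suc k)) ⟩
  f 0 * deriv g (suc k) + (conv (shift f) g (suc k) + deriv (conv (shift f) g) k)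
    ≡⟨ cong (λ z → f 0 * deriv g (suc k) + (conv (shift f) g (suc k) + z)) (conv-deriv (shift f) g k) ⟩
  f 0 * deriv g (suc k) + (f 1 * g (suc k) + conv (shift (shift f)) g k
    + (conv (deriv (shift f)) g k + conv (shift f) (deriv g) k))
    ≡⟨ regroup (f 0 * deriv g (suc k)) (f 1) (g (suc k)) _ _ _ ⟩
  1ℤ * f 1 * g (suc k) + (conv (shift (shift f)) g k + conv (deriv (shift f)) g k)
    + (f 0 * deriv g (suc k) + conv (shift f) (deriv g) k)
    ≡⟨ cong (λ z → 1ℤ * f 1 * g (suc k) + z + (f 0 * deriv g (suc k) + conv (shift f) (deriv g) k)) merge ⟩
  conv (deriv f) g (suc k) + conv f (deriv g) (suc k) ∎
  where
  open ≡-Reasoning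
  split : ∀ k a b x → (1ℤ + k) * (a * b + x) ≡ a * ((1ℤ + k) * b) + (x + k * x)
  split = solve-∀
  regroup : ∀ z a b x y w → z + (a * b + x + (y + w)) ≡ 1ℤ * a * b + (x + y) + (z + w)
  regroup = solve-∀
  add-one : ∀ k x → x + (1ℤ + k) * x ≡ (1ℤ + (1ℤ + k)) * x
  add-one = solve-∀
  merge : conv (shift (shift f)) g k + conv (deriv (shift f)) g k ≡ conv (shift (deriv f)) g k
  merge = trans (sym (conv-+ˡ (shift (shift f)) (deriv (shift f)) g k))
    (conv-cong (λ i → add-one (+ i) (f (suc (suc i)))) (λ _ → refl) k)

-- Polynomials over the integers.

-- A polynomial is the list of its coefficients, constant term first.
Poly : Set
Poly = List ℤ

infixl 6 _⊕_ _⊖_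
infixl 7 _⊗_
infixr 7 _•_

coef : Poly → ℕ → ℤ
coef []      k       = 0ℤ
coef (a ∷ P) zero    = a
coef (a ∷ P) (suc k) = coef P k

_⊕_ : Poly → Poly → Poly
[]      ⊕ Q       = Q
(a ∷ P) ⊕ []      = a ∷ P
(a ∷ P) ⊕ (b ∷ Q) = (a + b) ∷ (P ⊕ Q)

_•_ : ℤ → Poly → Poly
c • P = map (c *_) P

_⊖_ : Poly → Poly → Poly
P ⊖ Q = P ⊕ (- 1ℤ) • Q

_⊗_ : Poly → Poly → Poly
[]      ⊗ Q = []
(a ∷ P) ⊗ Q = a • Q ⊕ (0ℤ ∷ P ⊗ Q)

const : ℤ → Poly
const a = a ∷ []

D : Poly → Poly
D []      = []
D (a ∷ P) = P ⊕ (0ℤ ∷ D P)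

ev : Poly → ℤ → ℤ
ev []      r = 0ℤ
ev (a ∷ P) r = a + r * ev P r

coef-⊕ : ∀ P Q k → coef (P ⊕ Q) k ≡ coef P k + coef Q k
coef-⊕ []      Q       k       = sym (ℤₚ.+-identityˡ _)
coef-⊕ (a ∷ P) []      k       = sym (ℤₚ.+-identityʳ _)
coef-⊕ (a ∷ P) (b ∷ Q) zero    = refl
coef-⊕ (a ∷ P) (b ∷ Q) (suc k) = coef-⊕ P Q k

coef-• : ∀ c P k → coef (c • P) k ≡ c * coef P k
coef-• c []      k       = sym (ℤₚ.*-zeroʳ c)
coef-• c (a ∷ P) zero    = refl
coef-• c (a ∷ P) (suc k) = coef-• c P k

coef-⊖ : ∀ P Q k → coef (P ⊖ Q) k ≡ coef P k - coef Q k
coef-⊖ P Q k = trans (coef-⊕ P _ k)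
  (cong (λ z → coef P k + z) (trans (coef-• (- 1ℤ) Q k) (ℤₚ.-1*i≡-i (coef Q k))))

coef-⊗ : ∀ P Q k → coef (P ⊗ Q) k ≡ conv (coef P) (coef Q) k
coef-⊗ []      Q k    = sym (conv-zeroˡ (coef Q) k)
coef-⊗ (a ∷ P) Q zero = trans (coef-⊕ (a • Q) _ 0)
  (trans (ℤₚ.+-identityʳ _) (coef-• a Q 0))
coef-⊗ (a ∷ P) Q (suc k) = trans (coef-⊕ (a • Q) _ (suc k))
  (cong₂ _+_ (coef-• a Q (suc k)) (coef-⊗ P Q k))

coef-D : ∀ P k → coef (D P) k ≡ + suc k * coef P (suc k)
coef-D []      k       = sym (ℤₚ.*-zeroʳ (+ suc k))
coef-D (a ∷ P) zero    = trans (coef-⊕ P (0ℤ ∷ D P) 0)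
  (trans (ℤₚ.+-identityʳ _) (sym (ℤₚ.*-identityˡ _)))
coef-D (a ∷ P) (suc k) = trans (coef-⊕ P (0ℤ ∷ D P) (suc k))
  (trans (cong (λ z → coef P (suc k) + z) (coef-D P k)) (lemma (+ suc k) (coef P (suc k))))
  where
  lemma : ∀ k x → x + k * x ≡ (1ℤ + k) * x
  lemma = solve-∀

ev-⊕ : ∀ P Q r → ev (P ⊕ Q) r ≡ ev P r + ev Q r
ev-⊕ []      Q       r = sym (ℤₚ.+-identityˡ _)
ev-⊕ (a ∷ P) []      r = sym (ℤₚ.+-identityʳ _)
ev-⊕ (a ∷ P) (b ∷ Q) r = trans (cong (λ z → a + b + r * z) (ev-⊕ P Q r)) (lemma a b r _ _)
  where
  lemma : ∀ a b r x y → a + b + r * (x + y) ≡ a + r * x + (b + r * y)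
  lemma = solve-∀

ev-• : ∀ c P r → ev (c • P) r ≡ c * ev P r
ev-• c []      r = sym (ℤₚ.*-zeroʳ c)
ev-• c (a ∷ P) r = trans (cong (λ z → c * a + r * z) (ev-• c P r)) (lemma c a r _)
  where
  lemma : ∀ c a r x → c * a + r * (c * x) ≡ c * (a + r * x)
  lemma = solve-∀

ev-⊖ : ∀ P Q r → ev (P ⊖ Q) r ≡ ev P r - ev Q r
ev-⊖ P Q r = trans (ev-⊕ P _ r)
  (cong (λ z → ev P r + z) (trans (ev-• (- 1ℤ) Q r) (ℤₚ.-1*i≡-i (ev Q r))))

ev-⊗ : ∀ P Q r → ev (P ⊗ Q) r ≡ ev P r * ev Q r
ev-⊗ []      Q r = refl
ev-⊗ (a ∷ P) Q r = trans (ev-⊕ (a • Q) _ r)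
  (trans (cong₂ (λ y z → y + (0ℤ + r * z)) (ev-• a Q r) (ev-⊗ P Q r)) (lemma a r _ _))
  where
  lemma : ∀ a r x y → a * y + (0ℤ + r * (x * y)) ≡ (a + r * x) * y
  lemma = solve-∀

infixr 8 _^ᵖ_

_^ᵖ_ : Poly → ℕ → Poly
P ^ᵖ zero  = const 1ℤ
P ^ᵖ suc k = P ⊗ P ^ᵖ k

lin : ℤ → Poly
lin a = a ∷ 1ℤ ∷ []

coef-lin-zero : ∀ a P → coef (lin a ⊗ P) 0 ≡ a * coef P 0
coef-lin-zero a P = coef-⊗ (lin a) P 0

coef-lin-suc : ∀ a P k → coef (lin a ⊗ P) (suc k) ≡ a * coef P (suc k) + coef P k
coef-lin-suc a P zero    = trans (coef-⊗ (lin a) P 1)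
  (cong (λ z → a * coef P 1 + z) (ℤₚ.*-identityˡ _))
coef-lin-suc a P (suc k) = trans (coef-⊗ (lin a) P (suc (suc k)))
  (cong (λ z → a * coef P (suc (suc k)) + z)
    (trans (cong₂ _+_ (ℤₚ.*-identityˡ (coef P (suc k))) (conv-zeroˡ (coef P) k)) (ℤₚ.+-identityʳ (coef P (suc k)))))

ev-lin : ∀ a r → ev (lin a) r ≡ a + r
ev-lin = lemma
  where
  lemma : ∀ a r → a + r * (1ℤ + r * 0ℤ) ≡ a + r
  lemma = solve-∀

-- Synthetic division by lin a.
quo : ℤ → Poly → Poly
quo a []      = []
quo a (c ∷ P) = ev P (- a) ∷ quo a P

-- Exact over the integers, because the divisor is monic. The root of `lin a` is `- a`, which is why
-- evaluations below are at negated nodes.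
division : ∀ a P k → coef P k ≡ coef (const (ev P (- a)) ⊕ lin a ⊗ quo a P) k
division a P k = trans (go P k) (sym (coef-⊕ (const (ev P (- a))) (lin a ⊗ quo a P) k))
  where
  head : ∀ a c e → c ≡ c + - a * e + a * e
  head = solve-∀
  swap : ∀ x y → x + y ≡ 0ℤ + (y + x)
  swap = solve-∀
  nil : ∀ a → 0ℤ ≡ 0ℤ + (a * 0ℤ + 0ℤ)
  nil = solve-∀
  nil₀ : ∀ a → 0ℤ ≡ 0ℤ + a * 0ℤ
  nil₀ = solve-∀
  go : ∀ P k → coef P k ≡ coef (const (ev P (- a))) k + coef (lin a ⊗ quo a P) k
  go []      zero    = trans (nil₀ a) (cong (λ z → 0ℤ + z) (sym (coef-lin-zero a [])))
  go []      (suc k) = trans (nil a) (cong (λ z → 0ℤ + z) (sym (coef-lin-suc a [] k)))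
  go (c ∷ P) zero    = trans (head a c (ev P (- a)))
    (cong (λ z → c + - a * ev P (- a) + z) (sym (coef-lin-zero a (quo a (c ∷ P)))))
  go (c ∷ P) (suc zero) = trans (go P 0)
    (trans (cong (λ z → ev P (- a) + z) (coef-lin-zero a (quo a P)))
      (trans (swap (ev P (- a)) _) (cong (λ z → 0ℤ + z) (sym (coef-lin-suc a (quo a (c ∷ P)) 0)))))
  go (c ∷ P) (suc (suc k)) = trans (go P (suc k))
    (cong (λ z → 0ℤ + z) (trans (coef-lin-suc a (quo a P) k) (sym (coef-lin-suc a (quo a (c ∷ P)) (suc k)))))

coef-beyond : ∀ P {k} → length P ≤ⁿ k → coef P k ≡ 0ℤ
coef-beyond []      _       = refl
coef-beyond (a ∷ P) (s≤s l) = coef-beyond P l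

-- Polynomials modulo p.

module PolynomialCongruence (p : ℕ) where
  open Congruence p

  infix 4 _≋_

  record _≋_ (P Q : Poly) : Set where
    constructor coefwise
    field at : ∀ k → coef P k ≈ coef Q k
  open _≋_ public

  ≡⇒≋ : ∀ {P Q} → (∀ k → coef P k ≡ coef Q k) → P ≋ Q
  ≡⇒≋ e = coefwise λ k → ≡⇒≈ (e k)

  ≋-refl : ∀ {P} → P ≋ P
  ≋-refl = coefwise λ _ → ≈-refl

  ≋-sym : ∀ {P Q} → P ≋ Q → Q ≋ P
  ≋-sym e = coefwise λ k → ≈-sym (at e k)

  ≋-trans : ∀ {P Q R} → P ≋ Q → Q ≋ R → P ≋ R
  ≋-trans e₁ e₂ = coefwise λ k → ≈-trans (at e₁ k) (at e₂ k)

  via : ∀ {x x′ y y′} → x ≡ x′ → y ≡ y′ → x′ ≈ y′ → x ≈ y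
  via e₁ e₂ e = ≈-trans (≡⇒≈ e₁) (≈-trans e (≡⇒≈ (sym e₂)))

  ⊕-cong : ∀ {P P′ Q Q′} → P ≋ P′ → Q ≋ Q′ → P ⊕ Q ≋ P′ ⊕ Q′
  ⊕-cong {P} {P′} {Q} {Q′} e₁ e₂ = coefwise λ k →
    via (coef-⊕ P Q k) (coef-⊕ P′ Q′ k) (+-cong (at e₁ k) (at e₂ k))

  •-cong : ∀ {c c′ P P′} → c ≈ c′ → P ≋ P′ → c • P ≋ c′ • P′
  •-cong {c} {c′} {P} {P′} e₁ e₂ = coefwise λ k →
    via (coef-• c P k) (coef-• c′ P′ k) (*-cong e₁ (at e₂ k))

  •-congˡ : ∀ {P P′} c → P ≋ P′ → c • P ≋ c • P′
  •-congˡ c = •-cong (≈-refl {c})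

  ⊖-cong : ∀ {P P′ Q Q′} → P ≋ P′ → Q ≋ Q′ → P ⊖ Q ≋ P′ ⊖ Q′
  ⊖-cong e₁ e₂ = ⊕-cong e₁ (•-congˡ (- 1ℤ) e₂)

  conv-≈ : ∀ {f f′ g g′} → (∀ k → f k ≈ f′ k) → (∀ k → g k ≈ g′ k) → ∀ k → conv f g k ≈ conv f′ g′ k
  conv-≈ e₁ e₂ zero    = *-cong (e₁ 0) (e₂ 0)
  conv-≈ e₁ e₂ (suc k) = +-cong (*-cong (e₁ 0) (e₂ (suc k))) (conv-≈ (λ i → e₁ (suc i)) e₂ k)

  ⊗-cong : ∀ {P P′ Q Q′} → P ≋ P′ → Q ≋ Q′ → P ⊗ Q ≋ P′ ⊗ Q′
  ⊗-cong {P} {P′} {Q} {Q′} e₁ e₂ = coefwise λ k →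
    via (coef-⊗ P Q k) (coef-⊗ P′ Q′ k) (conv-≈ (at e₁) (at e₂) k)

  ⊗-congˡ : ∀ {Q Q′} P → Q ≋ Q′ → P ⊗ Q ≋ P ⊗ Q′
  ⊗-congˡ P = ⊗-cong (≋-refl {P})

  ^ᵖ-cong : ∀ {P Q} k → P ≋ Q → P ^ᵖ k ≋ Q ^ᵖ k
  ^ᵖ-cong zero    e = ≋-refl
  ^ᵖ-cong (suc k) e = ⊗-cong e (^ᵖ-cong k e)

  D-cong : ∀ {P Q} → P ≋ Q → D P ≋ D Q
  D-cong {P} {Q} e = coefwise λ k →
    via (coef-D P k) (coef-D Q k) (*-congˡ (+ suc k) (at e (suc k)))

  tail-≋ : ∀ {a b P Q} → a ∷ P ≋ b ∷ Q → P ≋ Q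
  tail-≋ e = coefwise λ k → at e (suc k)

  -- The cases with one empty list have content: the other list may consist of multiples of p.
  ev-cong : ∀ {P Q} r → P ≋ Q → ev P r ≈ ev Q r
  ev-cong {[]}    {[]}    r e = ≈-refl
  ev-cong {[]}    {b ∷ Q} r e = ≈-sym (via refl (lemma r) (+-cong (≈-sym (at e 0)) (*-congˡ r (≈-sym (ev-cong {[]} {Q} r (coefwise λ k → at e (suc k)))))))
    where
    lemma : ∀ r → 0ℤ ≡ 0ℤ + r * 0ℤ
    lemma = solve-∀
  ev-cong {a ∷ P} {[]}    r e = via refl (lemma r) (+-cong (at e 0) (*-congˡ r (ev-cong {P} {[]} r (coefwise λ k → at e (suc k)))))
    where
    lemma : ∀ r → 0ℤ ≡ 0ℤ + r * 0ℤ
    lemma = solve-∀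
  ev-cong {a ∷ P} {b ∷ Q} r e = +-cong (at e 0) (*-congˡ r (ev-cong r (tail-≋ e)))

  ⊕-assoc : ∀ P Q R → (P ⊕ Q) ⊕ R ≋ P ⊕ (Q ⊕ R)
  ⊕-assoc P Q R = ≡⇒≋ λ k → begin
    coef ((P ⊕ Q) ⊕ R) k                 ≡⟨ coef-⊕ (P ⊕ Q) R k ⟩
    coef (P ⊕ Q) k + coef R k            ≡⟨ cong (λ z → z + coef R k) (coef-⊕ P Q k) ⟩
    coef P k + coef Q k + coef R k       ≡⟨ ℤₚ.+-assoc (coef P k) (coef Q k) (coef R k) ⟩
    coef P k + (coef Q k + coef R k)     ≡⟨ cong (λ z → coef P k + z) (coef-⊕ Q R k) ⟨
    coef P k + coef (Q ⊕ R) k            ≡⟨ coef-⊕ P (Q ⊕ R) k ⟨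
    coef (P ⊕ (Q ⊕ R)) k                 ∎
    where open ≡-Reasoning

  ⊕-comm : ∀ P Q → P ⊕ Q ≋ Q ⊕ P
  ⊕-comm P Q = ≡⇒≋ λ k →
    trans (coef-⊕ P Q k) (trans (ℤₚ.+-comm (coef P k) (coef Q k)) (sym (coef-⊕ Q P k)))

  ⊗-comm : ∀ P Q → P ⊗ Q ≋ Q ⊗ P
  ⊗-comm P Q = ≡⇒≋ λ k →
    trans (coef-⊗ P Q k) (trans (conv-comm (coef P) (coef Q) k) (sym (coef-⊗ Q P k)))

  ⊗-assoc : ∀ P Q R → (P ⊗ Q) ⊗ R ≋ P ⊗ (Q ⊗ R)
  ⊗-assoc P Q R = ≡⇒≋ λ k → begin
    coef ((P ⊗ Q) ⊗ R) k                        ≡⟨ coef-⊗ (P ⊗ Q) R k ⟩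
    conv (coef (P ⊗ Q)) (coef R) k              ≡⟨ conv-cong (coef-⊗ P Q) (λ _ → refl) k ⟩
    conv (conv (coef P) (coef Q)) (coef R) k    ≡⟨ conv-assoc (coef P) (coef Q) (coef R) k ⟩
    conv (coef P) (conv (coef Q) (coef R)) k    ≡⟨ conv-cong (λ _ → refl) (coef-⊗ Q R) k ⟨
    conv (coef P) (coef (Q ⊗ R)) k              ≡⟨ coef-⊗ P (Q ⊗ R) k ⟨
    coef (P ⊗ (Q ⊗ R)) k                        ∎
    where open ≡-Reasoning

  ⊗-distribʳ : ∀ R P Q → (P ⊕ Q) ⊗ R ≋ P ⊗ R ⊕ Q ⊗ R
  ⊗-distribʳ R P Q = ≡⇒≋ λ k → begin
    coef ((P ⊕ Q) ⊗ R) k                                  ≡⟨ coef-⊗ (P ⊕ Q) R k ⟩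
    conv (coef (P ⊕ Q)) (coef R) k                        ≡⟨ conv-cong (coef-⊕ P Q) (λ _ → refl) k ⟩
    conv (λ i → coef P i + coef Q i) (coef R) k           ≡⟨ conv-+ˡ (coef P) (coef Q) (coef R) k ⟩
    conv (coef P) (coef R) k + conv (coef Q) (coef R) k   ≡⟨ cong₂ _+_ (coef-⊗ P R k) (coef-⊗ Q R k) ⟨
    coef (P ⊗ R) k + coef (Q ⊗ R) k                       ≡⟨ coef-⊕ (P ⊗ R) (Q ⊗ R) k ⟨
    coef (P ⊗ R ⊕ Q ⊗ R) k                                ∎
    where open ≡-Reasoning

  ⊗-distribˡ : ∀ R P Q → R ⊗ (P ⊕ Q) ≋ R ⊗ P ⊕ R ⊗ Q
  ⊗-distribˡ R P Q = ≋-trans (⊗-comm R (P ⊕ Q))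
    (≋-trans (⊗-distribʳ R P Q) (⊕-cong (⊗-comm P R) (⊗-comm Q R)))

  const-⊗ : ∀ c P → const c ⊗ P ≋ c • P
  const-⊗ c P = ≡⇒≋ λ k → trans (coef-⊕ (c • P) (0ℤ ∷ []) k)
    (trans (cong (λ z → coef (c • P) k + z) (zeros k)) (ℤₚ.+-identityʳ _))
    where
    zeros : ∀ k → coef (0ℤ ∷ []) k ≡ 0ℤ
    zeros zero    = refl
    zeros (suc k) = refl

  1•P≋P : ∀ P → 1ℤ • P ≋ P
  1•P≋P P = ≡⇒≋ λ k → trans (coef-• 1ℤ P k) (ℤₚ.*-identityˡ _)

  •-⊗ : ∀ c P Q → (c • P) ⊗ Q ≋ c • (P ⊗ Q)
  •-⊗ c P Q = ≋-trans (⊗-cong (≋-sym (const-⊗ c P)) ≋-refl)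
    (≋-trans (⊗-assoc (const c) P Q) (const-⊗ c (P ⊗ Q)))

  ⊗-• : ∀ c P Q → P ⊗ (c • Q) ≋ c • (P ⊗ Q)
  ⊗-• c P Q = ≋-trans (⊗-comm P (c • Q))
    (≋-trans (•-⊗ c Q P) (•-congˡ c (⊗-comm Q P)))

  ⊗-⊖ : ∀ R P Q → R ⊗ (P ⊖ Q) ≋ R ⊗ P ⊖ R ⊗ Q
  ⊗-⊖ R P Q = ≋-trans (⊗-distribˡ R P _) (⊕-cong ≋-refl (⊗-• (- 1ℤ) R Q))

  ⊗-zeroʳ : ∀ P → P ⊗ [] ≋ []
  ⊗-zeroʳ P = ⊗-comm P []

  ⊕-⊗-commutativeSemiring : CommutativeSemiring 0ℓ 0ℓ
  ⊕-⊗-commutativeSemiring = record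
    { Carrier = Poly
    ; _≈_ = _≋_
    ; _+_ = _⊕_
    ; _*_ = _⊗_
    ; 0# = []
    ; 1# = const 1ℤ
    ; isCommutativeSemiring = record
      { isSemiring = record
        { isSemiringWithoutAnnihilatingZero = record
          { +-isCommutativeMonoid = record
            { isMonoid = record
              { isSemigroup = record
                { isMagma = record
                  { isEquivalence = record { refl = ≋-refl ; sym = ≋-sym ; trans = ≋-trans }
                  ; ∙-cong = ⊕-cong
                  }
                ; assoc = ⊕-assoc
                }
              ; identity = (λ P → ≋-refl) , (λ P → ⊕-comm P [])
              }
            ; comm = ⊕-comm
            }
          ; *-cong = ⊗-cong
          ; *-assoc = ⊗-assoc
          ; *-identity = identityˡ , (λ P → ≋-trans (⊗-comm P (const 1ℤ)) (identityˡ P))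
          ; distrib = ⊗-distribˡ , ⊗-distribʳ
          }
        ; zero = (λ P → ≋-refl) , ⊗-zeroʳ
        }
      ; *-comm = ⊗-comm
      }
    }
    where
    identityˡ : ∀ P → const 1ℤ ⊗ P ≋ P
    identityˡ P = ≋-trans (const-⊗ 1ℤ P) (1•P≋P P)

  module PolySolver = NaturalCoefficients ⊕-⊗-commutativeSemiring
  module ≋-Reasoning = SetoidReasoning (CommutativeSemiring.setoid ⊕-⊗-commutativeSemiring)

  ≋⇒⊖≋[] : ∀ {P Q} → P ≋ Q → P ⊖ Q ≋ []
  ≋⇒⊖≋[] {P} {Q} e = coefwise λ k → ≈-trans (≡⇒≈ (coef-⊖ P Q k)) (≈⇒-≈0 (at e k))

  ⊖≋[]⇒≋ : ∀ {P Q} → P ⊖ Q ≋ [] → P ≋ Q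
  ⊖≋[]⇒≋ {P} {Q} e = coefwise λ k → -≈0⇒≈ (≈-trans (≡⇒≈ (sym (coef-⊖ P Q k))) (at e k))

  D-⊕ : ∀ P Q → D (P ⊕ Q) ≋ D P ⊕ D Q
  D-⊕ P Q = ≡⇒≋ λ k → begin
    coef (D (P ⊕ Q)) k                                        ≡⟨ coef-D (P ⊕ Q) k ⟩
    + suc k * coef (P ⊕ Q) (suc k)                            ≡⟨ cong (λ z → + suc k * z) (coef-⊕ P Q (suc k)) ⟩
    + suc k * (coef P (suc k) + coef Q (suc k))               ≡⟨ ℤₚ.*-distribˡ-+ (+ suc k) (coef P (suc k)) (coef Q (suc k)) ⟩
    + suc k * coef P (suc k) + + suc k * coef Q (suc k)       ≡⟨ cong₂ _+_ (coef-D P k) (coef-D Q k) ⟨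
    coef (D P) k + coef (D Q) k                               ≡⟨ coef-⊕ (D P) (D Q) k ⟨
    coef (D P ⊕ D Q) k                                        ∎
    where open ≡-Reasoning

  D-• : ∀ c P → D (c • P) ≋ c • D P
  D-• c P = ≡⇒≋ λ k → begin
    coef (D (c • P)) k                 ≡⟨ coef-D (c • P) k ⟩
    + suc k * coef (c • P) (suc k)     ≡⟨ cong (λ z → + suc k * z) (coef-• c P (suc k)) ⟩
    + suc k * (c * coef P (suc k))     ≡⟨ lemma (+ suc k) c (coef P (suc k)) ⟩
    c * (+ suc k * coef P (suc k))     ≡⟨ cong (λ z → c * z) (coef-D P k) ⟨
    c * coef (D P) k                   ≡⟨ coef-• c (D P) k ⟨
    coef (c • D P) k                   ∎
    where
    open ≡-Reasoning
    lemma : ∀ k c x → k * (c * x) ≡ c * (k * x)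
    lemma = solve-∀

  D-⊗ : ∀ P Q → D (P ⊗ Q) ≋ D P ⊗ Q ⊕ P ⊗ D Q
  D-⊗ P Q = ≡⇒≋ λ k → begin
    coef (D (P ⊗ Q)) k                                                ≡⟨ coef-D (P ⊗ Q) k ⟩
    + suc k * coef (P ⊗ Q) (suc k)                                    ≡⟨ cong (λ z → + suc k * z) (coef-⊗ P Q (suc k)) ⟩
    deriv (conv (coef P) (coef Q)) k                                  ≡⟨ conv-deriv (coef P) (coef Q) k ⟩
    conv (deriv (coef P)) (coef Q) k + conv (coef P) (deriv (coef Q)) k
      ≡⟨ cong₂ _+_ (conv-cong (coef-D P) (λ _ → refl) k) (conv-cong {f = coef P} (λ _ → refl) (coef-D Q) k) ⟨
    conv (coef (D P)) (coef Q) k + conv (coef P) (coef (D Q)) k       ≡⟨ cong₂ _+_ (coef-⊗ (D P) Q k) (coef-⊗ P (D Q) k) ⟨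
    coef (D P ⊗ Q) k + coef (P ⊗ D Q) k                               ≡⟨ coef-⊕ (D P ⊗ Q) (P ⊗ D Q) k ⟨
    coef (D P ⊗ Q ⊕ P ⊗ D Q) k                                        ∎
    where open ≡-Reasoning

-- Taylor expansions, degree bounds and multiplicities.

quos : ℤ → ℕ → Poly → Poly
quos a zero    P = P
quos a (suc l) P = quos a l (quo a P)

-- The coefficient of (lin a)ˡ in the expansion of P in powers of lin a.
digit : ℤ → ℕ → Poly → ℤ
digit a l P = ev (quos a l P) (- a)

Ds : ℕ → Poly → Poly
Ds zero    P = P
Ds (suc l) P = D (Ds l P)

quos-+ : ∀ a k l P → quos a (k +ⁿ l) P ≡ quos a l (quos a k P)
quos-+ a zero    l P = refl
quos-+ a (suc k) l P = quos-+ a k l (quo a P)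

-- Both sides carry factorials so that the quotient (k + l)! / k! never has to be formed.
coef-Ds : ∀ l P k → + (k !) * coef (Ds l P) k ≡ + ((k +ⁿ l) !) * coef P (k +ⁿ l)
coef-Ds zero    P k rewrite ℕₚ.+-identityʳ k = refl
coef-Ds (suc l) P k = begin
  + (k !) * coef (D (Ds l P)) k                   ≡⟨ cong (λ z → + (k !) * z) (coef-D (Ds l P) k) ⟩
  + (k !) * (+ suc k * coef (Ds l P) (suc k))     ≡⟨ lemma (+ (k !)) (+ suc k) (coef (Ds l P) (suc k)) ⟩
  + suc k * + (k !) * coef (Ds l P) (suc k)       ≡⟨ cong (λ z → z * coef (Ds l P) (suc k)) (ℤₚ.pos-* (suc k) (k !)) ⟨
  + (suc k !) * coef (Ds l P) (suc k)             ≡⟨ coef-Ds l P (suc k) ⟩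
  + ((suc k +ⁿ l) !) * coef P (suc k +ⁿ l)        ≡⟨ cong (λ j → + (j !) * coef P j) (ℕₚ.+-suc k l) ⟨
  + ((k +ⁿ suc l) !) * coef P (k +ⁿ suc l)        ∎
  where
  open ≡-Reasoning
  lemma : ∀ x y z → x * (y * z) ≡ y * x * z
  lemma = solve-∀

coef₀-Ds : ∀ l P → coef (Ds l P) 0 ≡ + (l !) * coef P l
coef₀-Ds l P = trans (sym (ℤₚ.*-identityˡ _)) (coef-Ds l P 0)

module Expansion (p : ℕ) where
  open Congruence p
  open PolynomialCongruence p

  factor-theorem : ∀ a P → ev P (- a) ≈ 0ℤ → P ≋ lin a ⊗ quo a P
  factor-theorem a P e = ≋-trans (≡⇒≋ {P} {const (ev P (- a)) ⊕ lin a ⊗ quo a P} (division a P))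
    (⊕-cong {const (ev P (- a))} {[]} (coefwise c) (≋-refl {lin a ⊗ quo a P}))
    where
    c : ∀ k → coef (const (ev P (- a))) k ≈ 0ℤ
    c zero    = e
    c (suc k) = ≈-refl

  ev-lin-⊗ : ∀ a P → ev (lin a ⊗ P) (- a) ≈ 0ℤ
  ev-lin-⊗ a P = ≡⇒≈ (trans (ev-⊗ (lin a) P (- a))
    (cong (λ z → z * ev P (- a)) (trans (ev-lin a (- a)) (ℤₚ.+-inverseʳ a))))

  Ds-cong : ∀ l {P Q} → P ≋ Q → Ds l P ≋ Ds l Q
  Ds-cong zero    e = e
  Ds-cong (suc l) e = D-cong (Ds-cong l e)

  Ds-⊕ : ∀ l P Q → Ds l (P ⊕ Q) ≋ Ds l P ⊕ Ds l Q
  Ds-⊕ zero    P Q = ≋-refl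
  Ds-⊕ (suc l) P Q = ≋-trans (D-cong (Ds-⊕ l P Q)) (D-⊕ (Ds l P) (Ds l Q))

  Ds-• : ∀ l c P → Ds l (c • P) ≋ c • Ds l P
  Ds-• zero    c P = ≋-refl
  Ds-• (suc l) c P = ≋-trans (D-cong (Ds-• l c P)) (D-• c (Ds l P))

  D-const : ∀ c → D (const c) ≋ []
  D-const c = ≡⇒≋ λ { zero → refl ; (suc k) → refl }

  Ds-const : ∀ l c → Ds (suc l) (const c) ≋ []
  Ds-const zero    c = D-const c
  Ds-const (suc l) c = D-cong (Ds-const l c)

  D-lin : ∀ a → D (lin a) ≋ const 1ℤ
  D-lin a = ≡⇒≋ λ { zero → refl ; (suc zero) → refl ; (suc (suc k)) → refl }

  D-lin-⊗ : ∀ a W → D (lin a ⊗ W) ≋ W ⊕ lin a ⊗ D W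
  D-lin-⊗ a W = ≋-trans (D-⊗ (lin a) W)
    (⊕-cong (≋-trans (⊗-cong (D-lin a) ≋-refl) (≋-trans (const-⊗ 1ℤ W) (1•P≋P W))) ≋-refl)

  suc-• : ∀ l W → W ⊕ + l • W ≋ + suc l • W
  suc-• l W = ≡⇒≋ λ k → begin
    coef (W ⊕ + l • W) k            ≡⟨ coef-⊕ W (+ l • W) k ⟩
    coef W k + coef (+ l • W) k     ≡⟨ cong (λ z → coef W k + z) (coef-• (+ l) W k) ⟩
    coef W k + + l * coef W k       ≡⟨ lemma (+ l) (coef W k) ⟩
    + suc l * coef W k              ≡⟨ coef-• (+ suc l) W k ⟨
    coef (+ suc l • W) k            ∎
    where
    open ≡-Reasoning
    lemma : ∀ l x → x + l * x ≡ (1ℤ + l) * x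
    lemma = solve-∀

  -- The Leibniz rule with a linear factor: its second derivative vanishes, so two terms survive.
  Ds-lin-⊗ : ∀ l a W → Ds (suc l) (lin a ⊗ W) ≋ lin a ⊗ Ds (suc l) W ⊕ + suc l • Ds l W
  Ds-lin-⊗ zero    a W = ≋-trans (D-lin-⊗ a W)
    (≋-trans (⊕-comm W (lin a ⊗ D W)) (⊕-cong {P = lin a ⊗ D W} ≋-refl (≋-sym (1•P≋P W))))
  Ds-lin-⊗ (suc l) a W = begin
    D (Ds (suc l) (lin a ⊗ W))                              ≈⟨ D-cong (Ds-lin-⊗ l a W) ⟩
    D (lin a ⊗ V ⊕ + suc l • Ds l W)                        ≈⟨ D-⊕ (lin a ⊗ V) _ ⟩
    D (lin a ⊗ V) ⊕ D (+ suc l • Ds l W)                    ≈⟨ ⊕-cong (D-lin-⊗ a V) (D-• (+ suc l) (Ds l W)) ⟩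
    (V ⊕ lin a ⊗ D V) ⊕ + suc l • V                         ≈⟨ ⊕-cong (⊕-comm V (lin a ⊗ D V)) (≋-refl {+ suc l • V}) ⟩
    (lin a ⊗ D V ⊕ V) ⊕ + suc l • V                         ≈⟨ ⊕-assoc (lin a ⊗ D V) V _ ⟩
    lin a ⊗ D V ⊕ (V ⊕ + suc l • V)                         ≈⟨ ⊕-cong (≋-refl {lin a ⊗ D V}) (suc-• (suc l) V) ⟩
    lin a ⊗ D V ⊕ + suc (suc l) • V                         ∎
    where
    open ≋-Reasoning
    V = Ds (suc l) W

  -- After one division by `lin a` the constant remainder is killed by differentiation, and at `- a`
  -- the Leibniz rule leaves only `suc l` times the `l`-th derivative of the quotient.
  ev-Ds : ∀ l a P → ev (Ds l P) (- a) ≈ + (l !) * digit a l P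
  ev-Ds zero    a P = ≡⇒≈ (sym (ℤₚ.*-identityˡ _))
  ev-Ds (suc l) a P = begin
    ev (Ds (suc l) P) r                                                    ≈⟨ ev-cong r expand ⟩
    ev (lin a ⊗ Ds (suc l) W ⊕ + suc l • Ds l W) r                         ≡⟨ ev-⊕ (lin a ⊗ Ds (suc l) W) _ r ⟩
    ev (lin a ⊗ Ds (suc l) W) r + ev (+ suc l • Ds l W) r                  ≈⟨ +-cong (ev-lin-⊗ a (Ds (suc l) W)) (≡⇒≈ (ev-• (+ suc l) (Ds l W) r)) ⟩
    0ℤ + + suc l * ev (Ds l W) r                                           ≡⟨ ℤₚ.+-identityˡ (+ suc l * ev (Ds l W) r) ⟩
    + suc l * ev (Ds l W) r                                                ≈⟨ *-congˡ (+ suc l) (ev-Ds l a W) ⟩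
    + suc l * (+ (l !) * digit a l W)                                      ≡⟨ ℤₚ.*-assoc (+ suc l) (+ (l !)) (digit a l W) ⟨
    + suc l * + (l !) * digit a l W                                        ≡⟨ cong (λ z → z * digit a l W) (ℤₚ.pos-* (suc l) (l !)) ⟨
    + (suc l !) * digit a l W                                              ∎
    where
    open SetoidReasoning ≈-setoid
    r = - a
    W = quo a P
    expand : Ds (suc l) P ≋ lin a ⊗ Ds (suc l) W ⊕ + suc l • Ds l W
    expand = ≋-trans (Ds-cong (suc l) (≡⇒≋ {P} (division a P)))
      (≋-trans (Ds-⊕ (suc l) (const (ev P r)) (lin a ⊗ W))
        (⊕-cong (Ds-const l (ev P r)) (Ds-lin-⊗ l a W)))

  digits≈0⇒factor : ∀ a k P → (∀ l → l <ⁿ k → digit a l P ≈ 0ℤ) → P ≋ lin a ^ᵖ k ⊗ quos a k P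
  digits≈0⇒factor a zero    P e = ≋-sym (≋-trans (const-⊗ 1ℤ P) (1•P≋P P))
  digits≈0⇒factor a (suc k) P e = begin
    P                                       ≈⟨ factor-theorem a P (e 0 (s≤s z≤n)) ⟩
    lin a ⊗ W                               ≈⟨ ⊗-congˡ (lin a) (digits≈0⇒factor a k W λ l l<k → e (suc l) (s≤s l<k)) ⟩
    lin a ⊗ (lin a ^ᵖ k ⊗ quos a k W)       ≈⟨ ⊗-assoc (lin a) (lin a ^ᵖ k) (quos a k W) ⟨
    (lin a ⊗ lin a ^ᵖ k) ⊗ quos a k W       ∎
    where
    open ≋-Reasoning
    W = quo a P

  -- Only an upper bound: the list may be longer than the degree mod p, since its last entries may
  -- be multiples of p.
  Deg< : Poly → ℕ → Set
  Deg< P m = ∀ k → m ≤ⁿ k → coef P k ≈ 0ℤ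

  Deg<-resp : ∀ {P Q m} → P ≋ Q → Deg< P m → Deg< Q m
  Deg<-resp e δ k m≤k = ≈-trans (≈-sym (at e k)) (δ k m≤k)

  Deg<-mono : ∀ {P m m′} → m ≤ⁿ m′ → Deg< P m → Deg< P m′
  Deg<-mono m≤m′ δ k m′≤k = δ k (ℕₚ.≤-trans m≤m′ m′≤k)

  Deg<-⊕ : ∀ {P Q m} → Deg< P m → Deg< Q m → Deg< (P ⊕ Q) m
  Deg<-⊕ {P} {Q} δ ε k m≤k = ≈-trans (≡⇒≈ (coef-⊕ P Q k)) (+-cong (δ k m≤k) (ε k m≤k))

  Deg<-• : ∀ {P m} c → Deg< P m → Deg< (c • P) m
  Deg<-• {P} c δ k m≤k = ≈-trans (≡⇒≈ (coef-• c P k)) (*-zeroʳ′ c (δ k m≤k))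

  Deg<-D : ∀ {P m} → Deg< P (suc m) → Deg< (D P) m
  Deg<-D {P} δ k m≤k = ≈-trans (≡⇒≈ (coef-D P k)) (*-zeroʳ′ (+ suc k) (δ (suc k) (s≤s m≤k)))

  -- The second bound is a successor to keep the result sharp: a degree below `m` and one of at most
  -- `m′` add up to less than `m + m′`.
  Deg<-⊗ : ∀ {P Q m m′} → Deg< P m → Deg< Q (suc m′) → Deg< (P ⊗ Q) (m +ⁿ m′)
  Deg<-⊗ {[]}    {Q} δ ε k m≤k = ≈-refl
  Deg<-⊗ {a ∷ P} {Q} {zero}  {m′} δ ε k m≤k =
    at (⊗-cong {a ∷ P} {[]} {Q} (coefwise λ j → δ j z≤n) ≋-refl) k
  Deg<-⊗ {a ∷ P} {Q} {suc m} {m′} δ ε = Deg<-⊕ {a • Q}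
    (Deg<-• {Q} a (Deg<-mono {Q} (s≤s (ℕₚ.m≤n+m m′ m)) ε)) shifted
    where
    shifted : Deg< (0ℤ ∷ P ⊗ Q) (suc m +ⁿ m′)
    shifted (suc k) (s≤s m≤k) = Deg<-⊗ {P} {Q} (λ j m≤j → δ (suc j) (s≤s m≤j)) ε k m≤k

  Deg<-lin-⊗ : ∀ {P m} a → Deg< P m → Deg< (lin a ⊗ P) (suc m)
  Deg<-lin-⊗ {P} a δ (suc k) (s≤s m≤k) = ≈-trans (≡⇒≈ (coef-lin-suc a P k))
    (+-cong (*-zeroʳ′ a (δ (suc k) (ℕₚ.m≤n⇒m≤1+n m≤k))) (δ k m≤k))

  -- As `lin a` is monic, the coefficients of `Q` can be recovered from those of the product from
  -- the top down. The descent starts beyond the length of the list, where coefficients are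
  -- literally zero; `j` is the distance to that point. The case `m = 0` is cancellation of `lin a`.
  lin-⊗-Deg< : ∀ a {Q m} → Deg< (lin a ⊗ Q) (suc m) → Deg< Q m
  lin-⊗-Deg< a {Q} {m} δ k m≤k = go (length Q) k m≤k (ℕₚ.m≤n+m (length Q) k)
    where
    lemma : ∀ a x y → y - 0ℤ ≡ - a * (x - 0ℤ) + 1ℤ * (a * x + y - 0ℤ)
    lemma = solve-∀
    go : ∀ j k → m ≤ⁿ k → length Q ≤ⁿ k +ⁿ j → coef Q k ≈ 0ℤ
    go zero    k m≤k l = ≡⇒≈ (coef-beyond Q (subst (length Q ≤ⁿ_) (ℕₚ.+-identityʳ k) l))
    go (suc j) k m≤k l = combine₂ (- a) 1ℤ
      (go j (suc k) (ℕₚ.m≤n⇒m≤1+n m≤k) (subst (length Q ≤ⁿ_) (ℕₚ.+-suc k j) l))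
      (≈-trans (≡⇒≈ (sym (coef-lin-suc a Q k))) (δ (suc k) (s≤s m≤k)))
      (lemma a (coef Q (suc k)) (coef Q k))

  lin-cancel-[] : ∀ a {W} → lin a ⊗ W ≋ [] → W ≋ []
  lin-cancel-[] a {W} e = coefwise λ k → lin-⊗-Deg< a {W} {0} (λ j _ → at e j) k z≤n

  lin-cancel : ∀ a {P Q} → lin a ⊗ P ≋ lin a ⊗ Q → P ≋ Q
  lin-cancel a {P} {Q} e = ⊖≋[]⇒≋ (lin-cancel-[] a (≋-trans (⊗-⊖ (lin a) P Q) (≋⇒⊖≋[] e)))

  lin^-cancel : ∀ a k {P Q} → lin a ^ᵖ k ⊗ P ≋ lin a ^ᵖ k ⊗ Q → P ≋ Q
  lin^-cancel a zero    {P} {Q} e =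
    ≋-trans (digits≈0⇒factor a 0 P (λ _ ())) (≋-trans e (≋-sym (digits≈0⇒factor a 0 Q (λ _ ()))))
  lin^-cancel a (suc k) {P} {Q} e = lin^-cancel a k (lin-cancel a
    (≋-trans (≋-sym (⊗-assoc (lin a) (lin a ^ᵖ k) P)) (≋-trans e (⊗-assoc (lin a) (lin a ^ᵖ k) Q))))

  lin^-⊗-Deg< : ∀ a k {Q m} → Deg< (lin a ^ᵖ k ⊗ Q) (k +ⁿ m) → Deg< Q m
  lin^-⊗-Deg< a zero    {Q} δ = Deg<-resp {const 1ℤ ⊗ Q} (≋-sym (digits≈0⇒factor a 0 Q (λ _ ()))) δ
  lin^-⊗-Deg< a (suc k) {Q} δ = lin^-⊗-Deg< a k {Q} (lin-⊗-Deg< a {lin a ^ᵖ k ⊗ Q}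
    (Deg<-resp {lin a ^ᵖ suc k ⊗ Q} (⊗-assoc (lin a) (lin a ^ᵖ k) Q) δ))

  -- Multiplicity at least `k` of the root `- a`; the bars do not assert exactness here.
  _^_∥_ : ℤ → ℕ → Poly → Set
  a ^ k ∥ P = Σ Poly λ Q → P ≋ lin a ^ᵖ k ⊗ Q

  module Roots (p-prime : Prime p) where
    open Domain p-prime

    !-≉0 : ∀ l → l <ⁿ p → + (l !) ≉ 0ℤ
    !-≉0 zero    l<p = 1≉0
    !-≉0 (suc l) l<p e = *-≉0 (0<m<p⇒≉0 (s≤s z≤n) l<p) (!-≉0 l (ℕₚ.<-trans (ℕₚ.n<1+n l) l<p))
      (≈-trans (≡⇒≈ (sym (ℤₚ.pos-* (suc l) (l !)))) e)

    -- At `- b` the factor `lin a` takes the value `a - b`, which is not zero, so the zero belongs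
    -- to `W`; one factor `lin b` is then cancelled on both sides.
    coprime-lin : ∀ {a b} → a ≉ b → ∀ k {W} → b ^ k ∥ (lin a ⊗ W) → b ^ k ∥ W
    coprime-lin a≉b zero {W} _ = W , digits≈0⇒factor 0ℤ 0 W (λ _ ())
    coprime-lin {a} {b} a≉b (suc k) {W} (Q , e) =
      proj₁ ih , ≋-trans W≋ (≋-trans (⊗-congˡ (lin b) (proj₂ ih)) (≋-sym (⊗-assoc (lin b) (lin b ^ᵖ k) (proj₁ ih))))
      where
      W[-b]≈0 : ev W (- b) ≈ 0ℤ
      W[-b]≈0 = *-cancel-≈0 (a - b) (λ z → a≉b (-≈0⇒≈ z)) (begin
        (a - b) * ev W (- b)                ≡⟨ cong (λ z → z * ev W (- b)) (ev-lin a (- b)) ⟨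
        ev (lin a) (- b) * ev W (- b)       ≡⟨ ev-⊗ (lin a) W (- b) ⟨
        ev (lin a ⊗ W) (- b)                ≈⟨ ev-cong (- b) (≋-trans e (⊗-assoc (lin b) (lin b ^ᵖ k) Q)) ⟩
        ev (lin b ⊗ (lin b ^ᵖ k ⊗ Q)) (- b) ≈⟨ ev-lin-⊗ b (lin b ^ᵖ k ⊗ Q) ⟩
        0ℤ                                  ∎)
        where open SetoidReasoning ≈-setoid
      W≋ : W ≋ lin b ⊗ quo b W
      W≋ = factor-theorem b W W[-b]≈0
      open PolySolver
      ih : b ^ k ∥ quo b W
      ih = coprime-lin a≉b k (Q , lin-cancel b (≋-trans
        (solve 3 (λ x y z → x :* (y :* z) := y :* (x :* z)) ≋-refl (lin b) (lin a) (quo b W))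
        (≋-trans (⊗-congˡ (lin a) (≋-sym W≋)) (≋-trans e (⊗-assoc (lin b) (lin b ^ᵖ k) Q)))))

    coprime-lin^ : ∀ {a b} → a ≉ b → ∀ j k {W} → b ^ k ∥ (lin a ^ᵖ j ⊗ W) → b ^ k ∥ W
    coprime-lin^ {a} {b} a≉b zero    k {W} (Q , e) = Q , ≋-trans (digits≈0⇒factor a 0 W (λ _ ())) e
    coprime-lin^ {a} {b} a≉b (suc j) k {W} (Q , e) = coprime-lin^ a≉b j k
      (coprime-lin a≉b k (Q , ≋-trans (≋-sym (⊗-assoc (lin a) (lin a ^ᵖ j) W)) e))

    -- Removing `lin a ^ᵖ k` lowers the degree bound by `k` and keeps the multiplicities at the
    -- other roots. It serves for multiplicity `k` (to identify `F`), 2 (to kill `T`) and 1 (for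
    -- simplicity of the roots of `f`).
    too-many-roots : ∀ {as} k P → AllPairs _≉_ as → All (λ a → a ^ k ∥ P) as →
                     Deg< P (length as *ⁿ k) → P ≋ []
    too-many-roots k P []          []       δ = coefwise λ j → δ j z≤n
    too-many-roots {a ∷ as} k P (a≉as ∷ as≉) ((Q , e) ∷ divs) δ =
      ≋-trans e (≋-trans (⊗-congˡ (lin a ^ᵖ k) Q≋[]) (⊗-zeroʳ (lin a ^ᵖ k)))
      where
      Q≋[] : Q ≋ []
      Q≋[] = too-many-roots k Q as≉
        (All.zipWith (λ (a≉b , (R , e′)) → coprime-lin^ a≉b k k (R , ≋-trans (≋-sym e) e′)) (a≉as , divs))
        (lin^-⊗-Deg< a k {Q} (Deg<-resp e δ))

-- Weighted sums and divided differences.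

wsum : List (ℤ × ℤ) → (ℤ → ℤ) → ℤ
wsum []             h = 0ℤ
wsum ((c , a) ∷ ws) h = c * h a + wsum ws h

nodes : List (ℤ × ℤ) → List ℤ
nodes = map proj₂

wsum-+ : ∀ ws h g → wsum ws (λ a → h a + g a) ≡ wsum ws h + wsum ws g
wsum-+ []             h g = refl
wsum-+ ((c , a) ∷ ws) h g = trans (cong (λ z → c * (h a + g a) + z) (wsum-+ ws h g))
  (lemma c (h a) (g a) _ _)
  where
  lemma : ∀ c x y u v → c * (x + y) + (u + v) ≡ c * x + u + (c * y + v)
  lemma = solve-∀

wsum-* : ∀ ws b h → wsum ws (λ a → b * h a) ≡ b * wsum ws h
wsum-* []             b h = sym (ℤₚ.*-zeroʳ b)
wsum-* ((c , a) ∷ ws) b h = trans (cong (λ z → c * (b * h a) + z) (wsum-* ws b h))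
  (lemma c b (h a) _)
  where
  lemma : ∀ c b x u → c * (b * x) + b * u ≡ b * (c * x + u)
  lemma = solve-∀

wsum-ext : ∀ ws {h g} → (∀ a → h a ≡ g a) → wsum ws h ≡ wsum ws g
wsum-ext []             e = refl
wsum-ext ((c , a) ∷ ws) e = cong₂ (λ y z → c * y + z) (e a) (wsum-ext ws e)

wsum-scale : ∀ ws (s : ℤ → ℤ) h → wsum (map (λ (c , b) → c * s b , b) ws) h ≡ wsum ws (λ b → s b * h b)
wsum-scale []             s h = refl
wsum-scale ((c , b) ∷ ws) s h = cong₂ _+_ (ℤₚ.*-assoc c (s b) (h b)) (wsum-scale ws s h)

nodes-scale : ∀ ws (s : ℤ → ℤ) → nodes (map (λ (c , b) → c * s b , b) ws) ≡ nodes ws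
nodes-scale []             s = refl
nodes-scale ((c , b) ∷ ws) s = cong (b ∷_) (nodes-scale ws s)

-- The product of e + 1, ..., e + j, that is (e + j)! / e!: the factor produced by `j` derivatives
-- of a power with exponent `j + e`.
rising : ℕ → ℕ → ℕ
rising e zero    = 1
rising e (suc j) = suc e *ⁿ rising (suc e) j

ev-lin^ : ∀ a b e → ev (lin a ^ᵖ e) (- b) ≡ (a - b) ^ e
ev-lin^ a b zero    = trans (cong (λ z → 1ℤ + z) (ℤₚ.*-zeroʳ (- b))) refl
ev-lin^ a b (suc e) = trans (ev-⊗ (lin a) (lin a ^ᵖ e) (- b)) (cong₂ _*_ (ev-lin a (- b)) (ev-lin^ a b e))

coef₀-lin^ : ∀ a e → coef (lin a ^ᵖ e) 0 ≡ a ^ e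
coef₀-lin^ a zero    = refl
coef₀-lin^ a (suc e) = trans (coef-lin-zero a (lin a ^ᵖ e)) (cong (λ z → a * z) (coef₀-lin^ a e))

powerSum : List (ℤ × ℤ) → ℕ → Poly
powerSum []             e = []
powerSum ((c , a) ∷ ws) e = c • lin a ^ᵖ e ⊕ powerSum ws e

ev-powerSum : ∀ ws e b → ev (powerSum ws e) (- b) ≡ wsum ws (λ a → (a - b) ^ e)
ev-powerSum []             e b = refl
ev-powerSum ((c , a) ∷ ws) e b = trans (ev-⊕ (c • lin a ^ᵖ e) (powerSum ws e) (- b))
  (cong₂ _+_ (trans (ev-• c (lin a ^ᵖ e) (- b)) (cong (λ z → c * z) (ev-lin^ a b e))) (ev-powerSum ws e b))

coef₀-powerSum : ∀ ws e → coef (powerSum ws e) 0 ≡ wsum ws (_^ e)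
coef₀-powerSum []             e = refl
coef₀-powerSum ((c , a) ∷ ws) e = trans (coef-⊕ (c • lin a ^ᵖ e) (powerSum ws e) 0)
  (cong₂ _+_ (trans (coef-• c (lin a ^ᵖ e) 0) (cong (λ z → c * z) (coef₀-lin^ a e))) (coef₀-powerSum ws e))

module Weights (p : ℕ) where
  open Congruence p
  open PolynomialCongruence p
  open Expansion p

  wsum-cong : ∀ ws {h g} → All (λ a → h a ≈ g a) (nodes ws) → wsum ws h ≈ wsum ws g
  wsum-cong []             []       = ≈-refl
  wsum-cong ((c , a) ∷ ws) (e ∷ es) = +-cong (*-congˡ c e) (wsum-cong ws es)

  wsum-≈0 : ∀ ws {h} → All (λ a → h a ≈ 0ℤ) (nodes ws) → wsum ws h ≈ 0ℤ
  wsum-≈0 []             []       = ≈-refl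
  wsum-≈0 ((c , a) ∷ ws) (e ∷ es) = +-cong (*-zeroʳ′ c e) (wsum-≈0 ws es)

  -- The weights cᵢ of the (m + 1)-point divided difference: ∑ cᵢ g(aᵢ) is the leading
  -- coefficient of g for every polynomial g of degree at most m.
  record IsDividedDifference (m : ℕ) (ws : List (ℤ × ℤ)) : Set where
    field
      low : ∀ k → k <ⁿ m → wsum ws (_^ k) ≈ 0ℤ
      top : wsum ws (_^ m) ≈ 1ℤ

  module _ (e : ℕ) where

    -- Adding a node `a` divides each old weight by `x - a`. The inverse is `(x - a) ^ e`, because
    -- differences of nodes are roots of unity; the weight at `a` is chosen to make the total zero.
    dividedDifference : ∀ a as → AllPairs (λ a b → (b - a) ^ suc e ≈ 1ℤ) (a ∷ as) →
                        Σ (List (ℤ × ℤ)) λ ws → nodes ws ≡ a ∷ as × IsDividedDifference (length as) ws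
    dividedDifference a [] _ = (1ℤ , a) ∷ [] , refl , record { low = λ _ () ; top = ≈-refl }
    dividedDifference a (b ∷ bs) (units ∷ rest) with dividedDifference b bs rest
    ... | ws , ns , dd = ws″ , cong (a ∷_) (trans (nodes-scale ws s) ns) , record { low = low′ ; top = top′ }
      where
      open IsDividedDifference dd
      s : ℤ → ℤ
      s x = (x - a) ^ e
      ws′ ws″ : List (ℤ × ℤ)
      ws′ = map (λ (c , x) → c * s x , x) ws
      ws″ = (- wsum ws′ (λ _ → 1ℤ) , a) ∷ ws′
      M m : ℕ → ℤ
      M k = wsum ws″ (_^ k)
      m k = wsum ws (_^ k)
      M₀ : M 0 ≈ 0ℤ
      M₀ = ≡⇒≈ (lemma (wsum ws′ (λ _ → 1ℤ)))
        where
        lemma : ∀ x → - x * 1ℤ + x ≡ 0ℤ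
        lemma = solve-∀
      -- Write x = a + (x - a). The second part undoes the division in the new weights and removes
      -- the node `a`, leaving the old moment, so `low` and `top` move up by one order.
      step : ∀ k → M (suc k) ≈ a * M k + m k
      step k = begin
        M (suc k)                                                           ≡⟨ wsum-ext ws″ (λ x → split x a (x ^ k)) ⟩
        wsum ws″ (λ x → a * x ^ k + (x - a) * x ^ k)                        ≡⟨ wsum-+ ws″ (λ x → a * x ^ k) (λ x → (x - a) * x ^ k) ⟩
        wsum ws″ (λ x → a * x ^ k) + wsum ws″ (λ x → (x - a) * x ^ k)       ≈⟨ +-cong (≡⇒≈ (wsum-* ws″ a (_^ k))) inner ⟩
        a * M k + m k                                                       ∎
        where
        open SetoidReasoning ≈-setoid
        split : ∀ x a y → x * y ≡ a * y + (x - a) * y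
        split = solve-∀
        drop : ∀ c a y z → c * ((a - a) * y) + z ≡ z
        drop = solve-∀
        regroup : ∀ u v w → u * (v * w) ≡ v * u * w
        regroup = solve-∀
        inner : wsum ws″ (λ x → (x - a) * x ^ k) ≈ m k
        inner = begin
          wsum ws″ (λ x → (x - a) * x ^ k)             ≡⟨ drop (- wsum ws′ (λ _ → 1ℤ)) a (a ^ k) _ ⟩
          wsum ws′ (λ x → (x - a) * x ^ k)             ≡⟨ wsum-scale ws s (λ x → (x - a) * x ^ k) ⟩
          wsum ws (λ x → s x * ((x - a) * x ^ k))      ≡⟨ wsum-ext ws (λ x → regroup (s x) (x - a) (x ^ k)) ⟩
          wsum ws (λ x → (x - a) ^ suc e * x ^ k)      ≈⟨ wsum-cong ws (subst (All _) (sym ns) (All.map (λ {x} u → *-cong u (≈-refl {x ^ k})) units)) ⟩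
          wsum ws (λ x → 1ℤ * x ^ k)                   ≡⟨ wsum-ext ws (λ x → ℤₚ.*-identityˡ (x ^ k)) ⟩
          m k                                          ∎
      low′ : ∀ k → k <ⁿ suc (length bs) → M k ≈ 0ℤ
      low′ zero    _         = M₀
      low′ (suc k) (s≤s k<m) = ≈-trans (step k)
        (+-cong (*-zeroʳ′ a (low′ k (ℕₚ.<-trans k<m (ℕₚ.n<1+n _)))) (low k k<m))
      top′ : M (suc (length bs)) ≈ 1ℤ
      top′ = ≈-trans (step (length bs)) (+-cong (*-zeroʳ′ a (low′ (length bs) (ℕₚ.n<1+n _))) top)

  module _ {m ws} (dd : IsDividedDifference m ws) where
    open IsDividedDifference dd

    private
      step : ∀ b k l → wsum ws (λ a → (a - b) ^ suc k * a ^ l) ≡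
             wsum ws (λ a → (a - b) ^ k * a ^ suc l) + - b * wsum ws (λ a → (a - b) ^ k * a ^ l)
      step b k l = trans (wsum-ext ws (λ a → lemma a b ((a - b) ^ k) (a ^ l)))
        (trans (wsum-+ ws (λ a → (a - b) ^ k * a ^ suc l) (λ a → - b * ((a - b) ^ k * a ^ l)))
          (cong (λ z → wsum ws (λ a → (a - b) ^ k * a ^ suc l) + z) (wsum-* ws (- b) (λ a → (a - b) ^ k * a ^ l))))
        where
        lemma : ∀ a b x y → (a - b) * x * y ≡ x * (a * y) + - b * (x * y)
        lemma = solve-∀

      -- Recentres the moments at `b` without the binomial theorem: one factor `a - b` at a time is
      -- expanded, and the auxiliary power `a ^ l` absorbs the result.
      low-mixed : ∀ b k l → k +ⁿ l <ⁿ m → wsum ws (λ a → (a - b) ^ k * a ^ l) ≈ 0ℤ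
      low-mixed b zero    l l<m = ≈-trans (≡⇒≈ (wsum-ext ws (λ a → ℤₚ.*-identityˡ (a ^ l)))) (low l l<m)
      low-mixed b (suc k) l l<m = ≈-trans (≡⇒≈ (step b k l))
        (+-cong (low-mixed b k (suc l) (subst (_<ⁿ m) (sym (ℕₚ.+-suc k l)) l<m))
                (*-zeroʳ′ (- b) (low-mixed b k l (ℕₚ.<-trans (ℕₚ.n<1+n _) l<m))))

      top-mixed : ∀ b k l → k +ⁿ l ≡ m → wsum ws (λ a → (a - b) ^ k * a ^ l) ≈ 1ℤ
      top-mixed b zero    l l≡m = ≈-trans (≡⇒≈ (wsum-ext ws (λ a → ℤₚ.*-identityˡ (a ^ l))))
        (subst (λ j → wsum ws (_^ j) ≈ 1ℤ) (sym l≡m) top)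
      top-mixed b (suc k) l l≡m = ≈-trans (≡⇒≈ (step b k l))
        (+-cong (top-mixed b k (suc l) (trans (ℕₚ.+-suc k l) l≡m))
                (*-zeroʳ′ (- b) (low-mixed b k l (subst (k +ⁿ l <ⁿ_) l≡m (ℕₚ.n<1+n _)))))

    low-shifted : ∀ b k → k <ⁿ m → wsum ws (λ a → (a - b) ^ k) ≈ 0ℤ
    low-shifted b k k<m = ≈-trans (≡⇒≈ (wsum-ext ws (λ a → sym (ℤₚ.*-identityʳ ((a - b) ^ k)))))
      (low-mixed b k 0 (subst (_<ⁿ m) (sym (ℕₚ.+-identityʳ k)) k<m))

    top-shifted : ∀ b → wsum ws (λ a → (a - b) ^ m) ≈ 1ℤ
    top-shifted b = ≈-trans (≡⇒≈ (wsum-ext ws (λ a → sym (ℤₚ.*-identityʳ ((a - b) ^ m)))))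
      (top-mixed b m 0 (ℕₚ.+-identityʳ m))

    private
      -- Horner evaluation pulls out a factor `- a` at each step, and `a ^ l` collects these
      -- factors.
      low-ev : ∀ P j l → Deg< P j → j +ⁿ l ≤ⁿ m → wsum ws (λ a → a ^ l * ev P (- a)) ≈ 0ℤ
      low-ev []      j       l δ j+l≤m = wsum-≈0 ws (All.universal (λ a → ≡⇒≈ (ℤₚ.*-zeroʳ (a ^ l))) (nodes ws))
      low-ev (c ∷ P) zero    l δ j+l≤m = wsum-≈0 ws (All.universal
        (λ a → *-zeroʳ′ (a ^ l) (ev-cong {c ∷ P} {[]} (- a) (coefwise λ k → δ k z≤n))) (nodes ws))
      low-ev (c ∷ P) (suc j) l δ j+l≤m = ≈-trans (≡⇒≈ (begin
        wsum ws (λ a → a ^ l * (c + - a * ev P (- a)))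
          ≡⟨ wsum-ext ws (λ a → lemma (a ^ l) c a (ev P (- a))) ⟩
        wsum ws (λ a → c * a ^ l + - 1ℤ * (a ^ suc l * ev P (- a)))
          ≡⟨ wsum-+ ws (λ a → c * a ^ l) (λ a → - 1ℤ * (a ^ suc l * ev P (- a))) ⟩
        wsum ws (λ a → c * a ^ l) + wsum ws (λ a → - 1ℤ * (a ^ suc l * ev P (- a)))
          ≡⟨ cong₂ _+_ (wsum-* ws c (_^ l)) (wsum-* ws (- 1ℤ) (λ a → a ^ suc l * ev P (- a))) ⟩
        c * wsum ws (_^ l) + - 1ℤ * wsum ws (λ a → a ^ suc l * ev P (- a)) ∎))
        (+-cong (*-zeroʳ′ c (low l (ℕₚ.≤-trans (s≤s (ℕₚ.m≤n+m l j)) j+l≤m)))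
                (*-zeroʳ′ (- 1ℤ) (low-ev P j (suc l) (λ k j≤k → δ (suc k) (s≤s j≤k))
                  (subst (_≤ⁿ m) (sym (ℕₚ.+-suc j l)) j+l≤m))))
        where
        open ≡-Reasoning
        lemma : ∀ y c a x → y * (c + - a * x) ≡ c * y + - 1ℤ * (a * y * x)
        lemma = solve-∀

    kills-low-degree : ∀ P → Deg< P m → wsum ws (λ a → ev P (- a)) ≈ 0ℤ
    kills-low-degree P δ = ≈-trans (≡⇒≈ (wsum-ext ws (λ a → sym (ℤₚ.*-identityˡ (ev P (- a))))))
      (low-ev P m 0 δ (ℕₚ.≤-reflexive (ℕₚ.+-identityʳ m)))

  D-lin^ : ∀ a e → D (lin a ^ᵖ suc e) ≋ + suc e • lin a ^ᵖ e
  D-lin^ a zero    = ≋-trans (D-lin-⊗ a (const 1ℤ)) (≋-trans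
    (⊕-cong (≋-refl {const 1ℤ}) (≋-trans (⊗-congˡ (lin a) (D-const 1ℤ)) (⊗-zeroʳ (lin a))))
    (≋-sym (1•P≋P (const 1ℤ))))
  D-lin^ a (suc e) = begin
    D (lin a ⊗ U)                                       ≈⟨ D-lin-⊗ a U ⟩
    U ⊕ lin a ⊗ D U                                     ≈⟨ ⊕-cong (≋-refl {U}) (⊗-congˡ (lin a) (D-lin^ a e)) ⟩
    U ⊕ lin a ⊗ (+ suc e • lin a ^ᵖ e)                  ≈⟨ ⊕-cong (≋-refl {U}) (⊗-• (+ suc e) (lin a) (lin a ^ᵖ e)) ⟩
    U ⊕ + suc e • U                                     ≈⟨ suc-• (suc e) U ⟩
    + suc (suc e) • U                                   ∎
    where
    open ≋-Reasoning
    U = lin a ^ᵖ suc e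

  •-• : ∀ c c′ P → c • c′ • P ≋ (c * c′) • P
  •-• c c′ P = ≡⇒≋ λ k → trans (coef-• c (c′ • P) k) (trans (cong (λ z → c * z) (coef-• c′ P k))
    (trans (sym (ℤₚ.*-assoc c c′ (coef P k))) (sym (coef-• (c * c′) P k))))

  •-⊕ : ∀ c P Q → c • (P ⊕ Q) ≋ c • P ⊕ c • Q
  •-⊕ c P Q = ≋-trans (≋-sym (const-⊗ c (P ⊕ Q)))
    (≋-trans (⊗-distribˡ (const c) P Q) (⊕-cong (const-⊗ c P) (const-⊗ c Q)))

  Ds-lin^ : ∀ a j e → Ds j (lin a ^ᵖ (j +ⁿ e)) ≋ + rising e j • lin a ^ᵖ e
  Ds-lin^ a zero    e = ≋-sym (1•P≋P (lin a ^ᵖ e))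
  Ds-lin^ a (suc j) e = begin
    D (Ds j (lin a ^ᵖ suc (j +ⁿ e)))                      ≡⟨ cong (λ i → D (Ds j (lin a ^ᵖ i))) (ℕₚ.+-suc j e) ⟨
    D (Ds j (lin a ^ᵖ (j +ⁿ suc e)))                      ≈⟨ D-cong (Ds-lin^ a j (suc e)) ⟩
    D (+ rising (suc e) j • lin a ^ᵖ suc e)               ≈⟨ D-• (+ rising (suc e) j) (lin a ^ᵖ suc e) ⟩
    + rising (suc e) j • D (lin a ^ᵖ suc e)               ≈⟨ •-congˡ (+ rising (suc e) j) (D-lin^ a e) ⟩
    + rising (suc e) j • + suc e • lin a ^ᵖ e             ≈⟨ •-• (+ rising (suc e) j) (+ suc e) (lin a ^ᵖ e) ⟩
    (+ rising (suc e) j * + suc e) • lin a ^ᵖ e           ≡⟨ cong (_• lin a ^ᵖ e) (trans (ℤₚ.*-comm (+ rising (suc e) j) (+ suc e)) (sym (ℤₚ.pos-* (suc e) (rising (suc e) j)))) ⟩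
    + rising e (suc j) • lin a ^ᵖ e                       ∎
    where open ≋-Reasoning

  Ds-powerSum : ∀ ws j e → Ds j (powerSum ws (j +ⁿ e)) ≋ + rising e j • powerSum ws e
  Ds-powerSum []             j e = Ds-[] j
    where
    Ds-[] : ∀ j → Ds j [] ≋ []
    Ds-[] zero    = ≋-refl
    Ds-[] (suc j) = D-cong (Ds-[] j)
  Ds-powerSum ((c , a) ∷ ws) j e = begin
    Ds j (c • U ⊕ powerSum ws (j +ⁿ e))                           ≈⟨ Ds-⊕ j (c • U) (powerSum ws (j +ⁿ e)) ⟩
    Ds j (c • U) ⊕ Ds j (powerSum ws (j +ⁿ e))                    ≈⟨ ⊕-cong (Ds-• j c U) (Ds-powerSum ws j e) ⟩
    c • Ds j U ⊕ R • powerSum ws e                                ≈⟨ ⊕-cong (•-congˡ c (Ds-lin^ a j e)) (≋-refl {R • powerSum ws e}) ⟩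
    c • R • V ⊕ R • powerSum ws e                                 ≈⟨ ⊕-cong (≋-trans (•-• c R V) (≋-trans (•-cong (≡⇒≈ (ℤₚ.*-comm c R)) (≋-refl {V})) (≋-sym (•-• R c V)))) (≋-refl {R • powerSum ws e}) ⟩
    R • c • V ⊕ R • powerSum ws e                                 ≈⟨ •-⊕ R (c • V) (powerSum ws e) ⟨
    R • (c • V ⊕ powerSum ws e)                                   ∎
    where
    open ≋-Reasoning
    R = + rising e j
    U = lin a ^ᵖ (j +ⁿ e)
    V = lin a ^ᵖ e

-- Elimination among the Taylor coefficients at a root.

module LocalElimination
  (p : ℕ) (p-prime : Prime p)
  (κ K₁ K₂ φ₀ φ₁ φ₂ φ₃ γ₀ γ₁ γ₂ γ₃ τ₀ τ₁ τ₂ τ₃ : ℤ)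
  where
  open Congruence p
  open Domain p-prime

  -- `φᵢ` and `γᵢ` are the coefficients of φ and G in f = s φ and F = s^k G, and `τᵢ` is the
  -- weighted sum of the (a - b)^(d - i). The `h` express γ by τ, the `o` say that G is a multiple
  -- of φ^κ, and the `t` that the series of the τᵢ times φ(- s) is constant. There is no `h₁`
  -- because in order one `o₁`, `t₁` and `h₀` already imply it, d being κ (κ + 1).
  module _
    (h₀ : K₁ * γ₀ ≈ K₂ * τ₀)
    (o₁ : φ₀ * γ₁ ≈ κ * (φ₁ * γ₀))
    (t₁ : φ₀ * τ₁ ≈ φ₁ * τ₀)
    (h₂ : (+ 2 + κ) * ((1ℤ + κ) * K₁) * γ₂ ≈ ((1ℤ + κ) * κ - 1ℤ) * ((1ℤ + κ) * κ * K₂) * τ₂)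
    (o₂ : + 2 * (φ₀ * γ₂) + φ₁ * γ₁ ≈ κ * (+ 2 * (φ₂ * γ₀) + φ₁ * γ₁))
    (t₂ : φ₀ * τ₂ ≈ φ₁ * τ₁ - φ₂ * τ₀)
    (φ₀≉0 : φ₀ ≉ 0ℤ) (K₁γ₀≉0 : K₁ * γ₀ ≉ 0ℤ)
    (κ≉0 : κ ≉ 0ℤ) (1+κ≉0 : 1ℤ + κ ≉ 0ℤ)
    where

    -- The second coefficient of γ₀ (φ / φ₀)^κ, cleared of denominators.
    g₂ : + 2 * (φ₀ * φ₀) * γ₂ ≈ κ * γ₀ * (+ 2 * (φ₀ * φ₂) + (κ - 1ℤ) * (φ₁ * φ₁))
    g₂ = combine₂ φ₀ ((κ - 1ℤ) * φ₁) o₂ o₁ (lemma κ φ₀ φ₁ φ₂ γ₀ γ₁ γ₂)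
      where
      lemma : ∀ κ φ₀ φ₁ φ₂ γ₀ γ₁ γ₂ →
        + 2 * (φ₀ * φ₀) * γ₂ - κ * γ₀ * (+ 2 * (φ₀ * φ₂) + (κ - 1ℤ) * (φ₁ * φ₁)) ≡
        φ₀ * (+ 2 * (φ₀ * γ₂) + φ₁ * γ₁ - κ * (+ 2 * (φ₂ * γ₀) + φ₁ * γ₁))
        + (κ - 1ℤ) * φ₁ * (φ₀ * γ₁ - κ * (φ₁ * γ₀))
      lemma = solve-∀

    -- The second coefficient of φ₀ τ₀ / φ(- s), cleared of denominators.
    s₂ : φ₀ * φ₀ * τ₂ ≈ τ₀ * (φ₁ * φ₁ - φ₀ * φ₂)
    s₂ = combine₂ φ₀ φ₁ t₂ t₁ (lemma φ₀ φ₁ φ₂ τ₀ τ₁ τ₂)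
      where
      lemma : ∀ φ₀ φ₁ φ₂ τ₀ τ₁ τ₂ →
        φ₀ * φ₀ * τ₂ - τ₀ * (φ₁ * φ₁ - φ₀ * φ₂) ≡
        φ₀ * (φ₀ * τ₂ - (φ₁ * τ₁ - φ₂ * τ₀)) + φ₁ * (φ₀ * τ₁ - φ₁ * τ₀)
      lemma = solve-∀

    -- This is the relation satisfied by φ₀ (1 + α s)^(κ + 1) in order two. With `g₂` and `s₂` put
    -- into `h₂`, both sides share a multiple of `K₁ * γ₀` by `h₀`; what remains is `1 + κ` times
    -- the claim.
    second-order : + 2 * (1ℤ + κ) * (φ₀ * φ₂) ≈ κ * (φ₁ * φ₁)
    second-order = -≈0⇒≈ (*-cancel-≈0 (1ℤ + κ) 1+κ≉0 (≈-trans (≡⇒≈ (tidy κ (φ₀ * φ₂) (φ₁ * φ₁)))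
      (*-cancel-≈0 (K₁ * γ₀ * ((1ℤ + κ) * κ)) (*-≉0 K₁γ₀≉0 (*-≉0 1+κ≉0 κ≉0)) key)))
      where
      A B : ℤ
      A = + 2 * (φ₀ * φ₂) + (κ - 1ℤ) * (φ₁ * φ₁)
      B = φ₁ * φ₁ - φ₀ * φ₂
      tidy : ∀ κ x y → (1ℤ + κ) * (+ 2 * (1ℤ + κ) * x - κ * y) ≡
        (+ 2 + κ) * (+ 2 * x + (κ - 1ℤ) * y) - + 2 * (((1ℤ + κ) * κ - 1ℤ) * (y - x))
      tidy = solve-∀
      lemma : ∀ κ K₁ K₂ γ₀ γ₂ τ₀ τ₂ X A B →
        K₁ * γ₀ * ((1ℤ + κ) * κ) * ((+ 2 + κ) * A - + 2 * (((1ℤ + κ) * κ - 1ℤ) * B)) - 0ℤ ≡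
        - ((+ 2 + κ) * ((1ℤ + κ) * K₁)) * (+ 2 * X * γ₂ - κ * γ₀ * A)
        + + 2 * X * ((+ 2 + κ) * ((1ℤ + κ) * K₁) * γ₂ - ((1ℤ + κ) * κ - 1ℤ) * ((1ℤ + κ) * κ * K₂) * τ₂)
        + + 2 * (((1ℤ + κ) * κ - 1ℤ) * ((1ℤ + κ) * κ * K₂)) * (X * τ₂ - τ₀ * B)
        + - (+ 2 * (((1ℤ + κ) * κ - 1ℤ) * ((1ℤ + κ) * κ * B))) * (K₁ * γ₀ - K₂ * τ₀)
      lemma = solve-∀
      key : K₁ * γ₀ * ((1ℤ + κ) * κ) * ((+ 2 + κ) * A - + 2 * (((1ℤ + κ) * κ - 1ℤ) * B)) ≈ 0ℤ
      key = combine₄ (- ((+ 2 + κ) * ((1ℤ + κ) * K₁))) (+ 2 * (φ₀ * φ₀))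
        (+ 2 * (((1ℤ + κ) * κ - 1ℤ) * ((1ℤ + κ) * κ * K₂)))
        (- (+ 2 * (((1ℤ + κ) * κ - 1ℤ) * ((1ℤ + κ) * κ * B))))
        g₂ h₂ s₂ h₀ (lemma κ K₁ K₂ γ₀ γ₂ τ₀ τ₂ (φ₀ * φ₀) A B)

    module _
      (h₃ : (+ 3 + κ) * ((+ 2 + κ) * ((1ℤ + κ) * K₁)) * γ₃ ≈
            ((1ℤ + κ) * κ - + 2) * (((1ℤ + κ) * κ - 1ℤ) * ((1ℤ + κ) * κ * K₂)) * τ₃)
      (o₃ : + 6 * (φ₀ * γ₃) + + 4 * (φ₁ * γ₂) + + 2 * (φ₂ * γ₁) ≈
            κ * (+ 6 * (φ₃ * γ₀) + + 4 * (φ₂ * γ₁) + + 2 * (φ₁ * γ₂)))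
      (t₃ : φ₀ * τ₃ ≈ φ₁ * τ₂ - φ₂ * τ₁ + φ₃ * τ₀)
      (2≉0 : + 2 ≉ 0ℤ) (2+κ≉0 : + 2 + κ ≉ 0ℤ) (κ-2≉0 : κ - + 2 ≉ 0ℤ)
      where

      g₃ : + 6 * (φ₀ * φ₀ * φ₀) * γ₃ ≈ κ * γ₀ *
           (+ 6 * (φ₀ * φ₀ * φ₃) + + 6 * (κ - 1ℤ) * (φ₀ * φ₁ * φ₂) + (κ - 1ℤ) * (κ - + 2) * (φ₁ * φ₁ * φ₁))
      g₃ = combine₃ (φ₀ * φ₀) ((+ 4 * κ - + 2) * (φ₀ * φ₂)) ((κ - + 2) * φ₁) o₃ o₁ g₂
        (lemma κ φ₀ φ₁ φ₂ φ₃ γ₀ γ₁ γ₂ γ₃)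
        where
        lemma : ∀ κ φ₀ φ₁ φ₂ φ₃ γ₀ γ₁ γ₂ γ₃ →
          + 6 * (φ₀ * φ₀ * φ₀) * γ₃ - κ * γ₀ *
            (+ 6 * (φ₀ * φ₀ * φ₃) + + 6 * (κ - 1ℤ) * (φ₀ * φ₁ * φ₂) + (κ - 1ℤ) * (κ - + 2) * (φ₁ * φ₁ * φ₁)) ≡
          φ₀ * φ₀ * (+ 6 * (φ₀ * γ₃) + + 4 * (φ₁ * γ₂) + + 2 * (φ₂ * γ₁)
            - κ * (+ 6 * (φ₃ * γ₀) + + 4 * (φ₂ * γ₁) + + 2 * (φ₁ * γ₂)))
          + (+ 4 * κ - + 2) * (φ₀ * φ₂) * (φ₀ * γ₁ - κ * (φ₁ * γ₀))
          + (κ - + 2) * φ₁ * (+ 2 * (φ₀ * φ₀) * γ₂ - κ * γ₀ * (+ 2 * (φ₀ * φ₂) + (κ - 1ℤ) * (φ₁ * φ₁)))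
        lemma = solve-∀

      s₃ : φ₀ * φ₀ * φ₀ * τ₃ ≈ τ₀ * (φ₁ * φ₁ * φ₁ - + 2 * (φ₀ * φ₁ * φ₂) + φ₀ * φ₀ * φ₃)
      s₃ = combine₃ (φ₀ * φ₀) φ₁ (- (φ₀ * φ₂)) t₃ s₂ t₁ (lemma φ₀ φ₁ φ₂ φ₃ τ₀ τ₁ τ₂ τ₃)
        where
        lemma : ∀ φ₀ φ₁ φ₂ φ₃ τ₀ τ₁ τ₂ τ₃ →
          φ₀ * φ₀ * φ₀ * τ₃ - τ₀ * (φ₁ * φ₁ * φ₁ - + 2 * (φ₀ * φ₁ * φ₂) + φ₀ * φ₀ * φ₃) ≡
          φ₀ * φ₀ * (φ₀ * τ₃ - (φ₁ * τ₂ - φ₂ * τ₁ + φ₃ * τ₀))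
          + φ₁ * (φ₀ * φ₀ * τ₂ - τ₀ * (φ₁ * φ₁ - φ₀ * φ₂))
          + - (φ₀ * φ₂) * (φ₀ * τ₁ - φ₁ * τ₀)
        lemma = solve-∀

      -- The relation of the same binomial power in order three. As (1 + κ) κ - 2 = (κ + 2) (κ - 1),
      -- a factor `2 + κ` cancels as well.
      third-order : + 3 * (1ℤ + κ) * (φ₀ * φ₃) ≈ (κ - 1ℤ) * (φ₁ * φ₂)
      third-order = -≈0⇒≈ (*-cancel-≈0 (+ 2 * ((κ - + 2) * (1ℤ + κ)) * φ₀)
        (*-≉0 (*-≉0 2≉0 (*-≉0 κ-2≉0 1+κ≉0)) φ₀≉0) reduced)
        where
        A B : ℤ
        A = + 6 * (φ₀ * φ₀ * φ₃) + + 6 * (κ - 1ℤ) * (φ₀ * φ₁ * φ₂) + (κ - 1ℤ) * (κ - + 2) * (φ₁ * φ₁ * φ₁)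
        B = φ₁ * φ₁ * φ₁ - + 2 * (φ₀ * φ₁ * φ₂) + φ₀ * φ₀ * φ₃
        lemma : ∀ κ K₁ K₂ γ₀ γ₃ τ₀ τ₃ X A B →
          K₁ * γ₀ * ((1ℤ + κ) * κ * (+ 2 + κ)) * ((+ 3 + κ) * A - + 6 * ((κ - 1ℤ) * (((1ℤ + κ) * κ - 1ℤ) * B))) - 0ℤ ≡
          - ((+ 3 + κ) * ((+ 2 + κ) * ((1ℤ + κ) * K₁))) * (+ 6 * X * γ₃ - κ * γ₀ * A)
          + + 6 * X * ((+ 3 + κ) * ((+ 2 + κ) * ((1ℤ + κ) * K₁)) * γ₃
            - ((1ℤ + κ) * κ - + 2) * (((1ℤ + κ) * κ - 1ℤ) * ((1ℤ + κ) * κ * K₂)) * τ₃)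
          + + 6 * (((1ℤ + κ) * κ - + 2) * (((1ℤ + κ) * κ - 1ℤ) * ((1ℤ + κ) * κ * K₂))) * (X * τ₃ - τ₀ * B)
          + - (+ 6 * (((1ℤ + κ) * κ - + 2) * (((1ℤ + κ) * κ - 1ℤ) * ((1ℤ + κ) * κ * B)))) * (K₁ * γ₀ - K₂ * τ₀)
        lemma = solve-∀
        key : K₁ * γ₀ * ((1ℤ + κ) * κ * (+ 2 + κ)) *
              ((+ 3 + κ) * A - + 6 * ((κ - 1ℤ) * (((1ℤ + κ) * κ - 1ℤ) * B))) ≈ 0ℤ
        key = combine₄ (- ((+ 3 + κ) * ((+ 2 + κ) * ((1ℤ + κ) * K₁)))) (+ 6 * (φ₀ * φ₀ * φ₀))
          (+ 6 * (((1ℤ + κ) * κ - + 2) * (((1ℤ + κ) * κ - 1ℤ) * ((1ℤ + κ) * κ * K₂))))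
          (- (+ 6 * (((1ℤ + κ) * κ - + 2) * (((1ℤ + κ) * κ - 1ℤ) * ((1ℤ + κ) * κ * B)))))
          g₃ h₃ s₃ h₀ (lemma κ K₁ K₂ γ₀ γ₃ τ₀ τ₃ (φ₀ * φ₀ * φ₀) A B)
        cancelled : (+ 3 + κ) * A - + 6 * ((κ - 1ℤ) * (((1ℤ + κ) * κ - 1ℤ) * B)) ≈ 0ℤ
        cancelled = *-cancel-≈0 (K₁ * γ₀ * ((1ℤ + κ) * κ * (+ 2 + κ)))
          (*-≉0 K₁γ₀≉0 (*-≉0 (*-≉0 1+κ≉0 κ≉0) 2+κ≉0)) key
        -- In `cancelled` the cube of φ₁ has the coefficient - 5 κ (κ - 1) (κ + 1), which dictates
        -- the multiple of `second-order` used to remove it.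
        reduced : + 2 * ((κ - + 2) * (1ℤ + κ)) * φ₀ * (+ 3 * (1ℤ + κ) * (φ₀ * φ₃) - (κ - 1ℤ) * (φ₁ * φ₂)) ≈ 0ℤ
        reduced = combine₂ (- 1ℤ) (+ 5 * ((1ℤ + κ) * (κ - 1ℤ)) * φ₁) cancelled second-order (identity κ φ₀ φ₁ φ₂ φ₃)
          where
          identity : ∀ κ φ₀ φ₁ φ₂ φ₃ →
            + 2 * ((κ - + 2) * (1ℤ + κ)) * φ₀ * (+ 3 * (1ℤ + κ) * (φ₀ * φ₃) - (κ - 1ℤ) * (φ₁ * φ₂)) - 0ℤ ≡
            - 1ℤ * ((+ 3 + κ) * (+ 6 * (φ₀ * φ₀ * φ₃) + + 6 * (κ - 1ℤ) * (φ₀ * φ₁ * φ₂)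
                + (κ - 1ℤ) * (κ - + 2) * (φ₁ * φ₁ * φ₁))
              - + 6 * ((κ - 1ℤ) * (((1ℤ + κ) * κ - 1ℤ) * (φ₁ * φ₁ * φ₁ - + 2 * (φ₀ * φ₁ * φ₂) + φ₀ * φ₀ * φ₃))) - 0ℤ)
            + + 5 * ((1ℤ + κ) * (κ - 1ℤ)) * φ₁ * (+ 2 * (1ℤ + κ) * (φ₀ * φ₂) - κ * (φ₁ * φ₁))
          identity = solve-∀

-- The two highest terms of a product.

raise : ℕ → Poly → Poly
raise zero    P = P
raise (suc a) P = 0ℤ ∷ raise a P

coef-raise : ∀ a P i → coef (raise a P) (a +ⁿ i) ≡ coef P i
coef-raise zero    P i = refl
coef-raise (suc a) P i = coef-raise a P i

ev-raise : ∀ a P r → ev (raise a P) r ≡ r ^ a * ev P r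
ev-raise zero    P r = sym (ℤₚ.*-identityˡ _)
ev-raise (suc a) P r = trans (ℤₚ.+-identityˡ _)
  (trans (cong (λ z → r * z) (ev-raise a P r)) (sym (ℤₚ.*-assoc r (r ^ a) (ev P r))))

coef-raise-1 : ∀ a {i} → i ≢ a → coef (raise a (const 1ℤ)) i ≡ 0ℤ
coef-raise-1 zero    {zero}  i≢a = contradiction refl i≢a
coef-raise-1 zero    {suc i} i≢a = refl
coef-raise-1 (suc a) {zero}  i≢a = refl
coef-raise-1 (suc a) {suc i} i≢a = coef-raise-1 a (λ i≡a → i≢a (cong suc i≡a))

coef-raise-1-top : ∀ a → coef (raise a (const 1ℤ)) a ≡ 1ℤ
coef-raise-1-top zero    = refl
coef-raise-1-top (suc a) = coef-raise-1-top a

module TopCoefficients (p : ℕ) where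
  open Congruence p
  open PolynomialCongruence p
  open Expansion p

  0∷-⊗ : ∀ P Q → (0ℤ ∷ P) ⊗ Q ≋ 0ℤ ∷ (P ⊗ Q)
  0∷-⊗ P Q = ≡⇒≋ λ k → trans (coef-⊕ (0ℤ • Q) (0ℤ ∷ P ⊗ Q) k)
    (trans (cong (λ z → z + coef (0ℤ ∷ P ⊗ Q) k) (coef-• 0ℤ Q k)) (ℤₚ.+-identityˡ _))

  0∷-cong : ∀ {P Q} → P ≋ Q → 0ℤ ∷ P ≋ 0ℤ ∷ Q
  0∷-cong e = coefwise λ { zero → ≈-refl ; (suc k) → at e k }

  raise-⊗ : ∀ a P Q → raise a P ⊗ Q ≋ raise a (P ⊗ Q)
  raise-⊗ zero    P Q = ≋-refl
  raise-⊗ (suc a) P Q = ≋-trans (0∷-⊗ (raise a P) Q) (0∷-cong (raise-⊗ a P Q))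

  raise-cong : ∀ a {P Q} → P ≋ Q → raise a P ≋ raise a Q
  raise-cong zero    e = e
  raise-cong (suc a) e = 0∷-cong (raise-cong a e)

  -- The top degree of P is m + s, and its next coefficient sits at degree s or below.
  Gap : Poly → ℕ → ℕ → Set
  Gap P m s = ∀ i → s <ⁿ i → i ≢ m +ⁿ s → coef P i ≈ 0ℤ

  remainder : Poly → ℕ → Poly
  remainder P a = P ⊖ coef P a • raise a (const 1ℤ)

  split-top : ∀ P a → P ≋ coef P a • raise a (const 1ℤ) ⊕ remainder P a
  split-top P a = ≡⇒≋ λ i → sym (begin
    coef (c • X ⊕ (P ⊖ c • X)) i                  ≡⟨ coef-⊕ (c • X) (P ⊖ c • X) i ⟩
    coef (c • X) i + coef (P ⊖ c • X) i           ≡⟨ cong (λ z → coef (c • X) i + z) (coef-⊖ P (c • X) i) ⟩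
    coef (c • X) i + (coef P i - coef (c • X) i)  ≡⟨ lemma (coef (c • X) i) (coef P i) ⟩
    coef P i                                      ∎)
    where
    open ≡-Reasoning
    c = coef P a
    X = raise a (const 1ℤ)
    lemma : ∀ x y → x + (y - x) ≡ y
    lemma = solve-∀

  coef-remainder : ∀ P a {i} → i ≢ a → coef (remainder P a) i ≡ coef P i
  coef-remainder P a {i} i≢a = begin
    coef (remainder P a) i                                        ≡⟨ coef-⊖ P (coef P a • raise a (const 1ℤ)) i ⟩
    coef P i - coef (coef P a • raise a (const 1ℤ)) i             ≡⟨ cong (λ z → coef P i - z) (coef-• (coef P a) (raise a (const 1ℤ)) i) ⟩
    coef P i - coef P a * coef (raise a (const 1ℤ)) i             ≡⟨ cong (λ z → coef P i - coef P a * z) (coef-raise-1 a i≢a) ⟩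
    coef P i - coef P a * 0ℤ                                      ≡⟨ lemma (coef P i) (coef P a) ⟩
    coef P i                                                      ∎
    where
    open ≡-Reasoning
    lemma : ∀ x y → x - y * 0ℤ ≡ x
    lemma = solve-∀

  coef-remainder-top : ∀ P a → coef (remainder P a) a ≡ 0ℤ
  coef-remainder-top P a = begin
    coef (remainder P a) a                                        ≡⟨ coef-⊖ P (coef P a • raise a (const 1ℤ)) a ⟩
    coef P a - coef (coef P a • raise a (const 1ℤ)) a             ≡⟨ cong (λ z → coef P a - z) (coef-• (coef P a) (raise a (const 1ℤ)) a) ⟩
    coef P a - coef P a * coef (raise a (const 1ℤ)) a             ≡⟨ cong (λ z → coef P a - coef P a * z) (coef-raise-1-top a) ⟩
    coef P a - coef P a * 1ℤ                                      ≡⟨ lemma (coef P a) ⟩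
    0ℤ                                                            ∎
    where
    open ≡-Reasoning
    lemma : ∀ x → x - x * 1ℤ ≡ 0ℤ
    lemma = solve-∀

  remainder-Deg< : ∀ P m s → Gap P m s → Deg< (remainder P (m +ⁿ s)) (suc s)
  remainder-Deg< P m s g i s<i with i ℕₚ.≟ m +ⁿ s
  ... | yes refl = ≡⇒≈ (coef-remainder-top P (m +ⁿ s))
  ... | no  i≢   = ≈-trans (≡⇒≈ (coef-remainder P (m +ⁿ s) i≢)) (g i s<i i≢)

  scaled-raise-⊗ : ∀ c a Q → (c • raise a (const 1ℤ)) ⊗ Q ≋ c • raise a Q
  scaled-raise-⊗ c a Q = ≋-trans (•-⊗ c (raise a (const 1ℤ)) Q)
    (•-congˡ c (≋-trans (raise-⊗ a (const 1ℤ) Q) (raise-cong a (≋-trans (const-⊗ 1ℤ Q) (1•P≋P Q)))))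

  -- Both factors have the same positive gap. The cross terms therefore meet in degree a + t = b +
  -- s, while the product of the two remainders, of degree at most s + t, stays strictly below.
  module _ (P Q : Poly) (m s t : ℕ) (gP : Gap P (suc m) s) (gQ : Gap Q (suc m) t) where
    private
      a b : ℕ
      a = suc m +ⁿ s
      b = suc m +ⁿ t
      A B : Poly
      A = remainder P a
      B = remainder Q b

      expand : P ⊗ Q ≋ coef P a • raise a Q ⊕ (coef Q b • raise b A ⊕ B ⊗ A)
      expand = begin
        P ⊗ Q                                                                      ≈⟨ ⊗-cong (split-top P a) (≋-refl {Q}) ⟩
        (coef P a • raise a (const 1ℤ) ⊕ A) ⊗ Q                                    ≈⟨ ⊗-distribʳ Q (coef P a • raise a (const 1ℤ)) A ⟩
        (coef P a • raise a (const 1ℤ)) ⊗ Q ⊕ A ⊗ Q                                ≈⟨ ⊕-cong (scaled-raise-⊗ (coef P a) a Q) (⊗-comm A Q) ⟩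
        coef P a • raise a Q ⊕ Q ⊗ A                                               ≈⟨ ⊕-cong (≋-refl {coef P a • raise a Q}) (⊗-cong (split-top Q b) (≋-refl {A})) ⟩
        coef P a • raise a Q ⊕ (coef Q b • raise b (const 1ℤ) ⊕ B) ⊗ A             ≈⟨ ⊕-cong (≋-refl {coef P a • raise a Q}) (⊗-distribʳ A (coef Q b • raise b (const 1ℤ)) B) ⟩
        coef P a • raise a Q ⊕ ((coef Q b • raise b (const 1ℤ)) ⊗ A ⊕ B ⊗ A)       ≈⟨ ⊕-cong (≋-refl {coef P a • raise a Q}) (⊕-cong (scaled-raise-⊗ (coef Q b) b A) (≋-refl {B ⊗ A})) ⟩
        coef P a • raise a Q ⊕ (coef Q b • raise b A ⊕ B ⊗ A)                      ∎
        where open ≋-Reasoning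

      coef-expand : ∀ j → t ≤ⁿ j → coef (P ⊗ Q) (a +ⁿ j) ≈ coef P a * coef Q j + coef Q b * coef A (s +ⁿ (j ∸ⁿ t))
      coef-expand j t≤j = begin
        coef (P ⊗ Q) i                                                              ≈⟨ at expand i ⟩
        coef (coef P a • raise a Q ⊕ (coef Q b • raise b A ⊕ B ⊗ A)) i              ≡⟨ coef-⊕ (coef P a • raise a Q) (coef Q b • raise b A ⊕ B ⊗ A) i ⟩
        coef (coef P a • raise a Q) i + coef (coef Q b • raise b A ⊕ B ⊗ A) i       ≡⟨ cong (λ z → coef (coef P a • raise a Q) i + z) (coef-⊕ (coef Q b • raise b A) (B ⊗ A) i) ⟩
        coef (coef P a • raise a Q) i + (coef (coef Q b • raise b A) i + coef (B ⊗ A) i)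
          ≡⟨ cong₂ (λ y z → y + (z + coef (B ⊗ A) i)) (trans (coef-• (coef P a) (raise a Q) i) (cong (λ z → coef P a * z) (coef-raise a Q j)))
               (trans (coef-• (coef Q b) (raise b A) i) (cong (λ z → coef Q b * z) (trans (cong (coef (raise b A)) i≡) (coef-raise b A (s +ⁿ (j ∸ⁿ t)))))) ⟩
        coef P a * coef Q j + (coef Q b * coef A (s +ⁿ (j ∸ⁿ t)) + coef (B ⊗ A) i)
          ≈⟨ +-cong (≈-refl {coef P a * coef Q j}) (+-cong (≈-refl {coef Q b * coef A (s +ⁿ (j ∸ⁿ t))}) BA≈0) ⟩
        coef P a * coef Q j + (coef Q b * coef A (s +ⁿ (j ∸ⁿ t)) + 0ℤ)
          ≡⟨ cong (λ z → coef P a * coef Q j + z) (ℤₚ.+-identityʳ (coef Q b * coef A (s +ⁿ (j ∸ⁿ t)))) ⟩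
        coef P a * coef Q j + coef Q b * coef A (s +ⁿ (j ∸ⁿ t)) ∎
        where
        open SetoidReasoning ≈-setoid
        i = a +ⁿ j
        i≡ : i ≡ b +ⁿ (s +ⁿ (j ∸ⁿ t))
        i≡ = trans (cong (a +ⁿ_) (sym (ℕₚ.m+[n∸m]≡n t≤j))) (interchange (suc m) s t (j ∸ⁿ t))
          where
          interchange : ∀ m s t r → m +ⁿ s +ⁿ (t +ⁿ r) ≡ m +ⁿ t +ⁿ (s +ⁿ r)
          interchange = ℕ-solve-∀
        BA≈0 : coef (B ⊗ A) i ≈ 0ℤ
        BA≈0 = Deg<-⊗ {B} {A} (remainder-Deg< Q (suc m) t gQ) (remainder-Deg< P (suc m) s gP) i
          (ℕₚ.≤-trans (s≤s (ℕₚ.+-monoˡ-≤ s t≤j)) (ℕₚ.≤-trans (ℕₚ.≤-reflexive (cong suc (ℕₚ.+-comm j s)))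
            (s≤s (ℕₚ.+-monoˡ-≤ j (ℕₚ.m≤n+m s m)))))

    product-above : ∀ j → t <ⁿ j → coef (P ⊗ Q) (a +ⁿ j) ≈ coef P a * coef Q j
    product-above j t<j = ≈-trans (coef-expand j (ℕₚ.<⇒≤ t<j))
      (≈-trans (+-cong (≈-refl {coef P a * coef Q j}) (*-zeroʳ′ (coef Q b)
        (remainder-Deg< P (suc m) s gP (s +ⁿ (j ∸ⁿ t)) (ℕₚ.m<m+n s (ℕₚ.m<n⇒0<n∸m t<j)))))
        (≡⇒≈ (ℤₚ.+-identityʳ (coef P a * coef Q j))))

    product-next : coef (P ⊗ Q) (a +ⁿ t) ≈ coef P a * coef Q t + coef Q b * coef P s
    product-next = ≈-trans (coef-expand t ℕₚ.≤-refl) (≡⇒≈ (cong (λ z → coef P a * coef Q t + coef Q b * z)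
      (trans (cong (coef A) (trans (cong (s +ⁿ_) (ℕₚ.n∸n≡0 t)) (ℕₚ.+-identityʳ s)))
        (coef-remainder P a (ℕₚ.<⇒≢ (s≤s (ℕₚ.m≤n+m s m)))))))

    product-gap : Gap (P ⊗ Q) (suc m) (a +ⁿ t)
    product-gap i a+t<i i≢ = subst (λ z → coef (P ⊗ Q) z ≈ 0ℤ) i≡
      (≈-trans (product-above j t<j) (*-zeroʳ′ (coef P a) (gQ j t<j λ j≡ → i≢ (trans (sym i≡)
        (trans (cong (a +ⁿ_) j≡) (rearrange (suc m) s t))))))
      where
      j = i ∸ⁿ a
      i≡ : a +ⁿ j ≡ i
      i≡ = ℕₚ.m+[n∸m]≡n (ℕₚ.≤-trans (ℕₚ.m≤m+n a t) (ℕₚ.<⇒≤ a+t<i))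
      t<j : t <ⁿ j
      t<j = ℕₚ.+-cancelˡ-< a t j (subst (a +ⁿ t <ⁿ_) (sym i≡) a+t<i)
      rearrange : ∀ m s t → m +ⁿ s +ⁿ (m +ⁿ t) ≡ m +ⁿ (m +ⁿ s +ⁿ t)
      rearrange = ℕ-solve-∀

  raise-⊕ : ∀ a P Q → raise a (P ⊕ Q) ≋ raise a P ⊕ raise a Q
  raise-⊕ zero    P Q = ≋-refl
  raise-⊕ (suc a) P Q = 0∷-cong (raise-⊕ a P Q)

  raise-• : ∀ a c P → raise a (c • P) ≋ c • raise a P
  raise-• zero    c P = ≋-refl
  raise-• (suc a) c P = coefwise λ
    { zero → ≡⇒≈ (sym (ℤₚ.*-zeroʳ c)) ; (suc k) → at (raise-• a c P) k }

  ⊗-raise : ∀ a P Q → P ⊗ raise a Q ≋ raise a (P ⊗ Q)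
  ⊗-raise a P Q = ≋-trans (⊗-comm P (raise a Q)) (≋-trans (raise-⊗ a Q P) (raise-cong a (⊗-comm Q P)))

  Gap-resp : ∀ {P Q m s} → P ≋ Q → Gap P m s → Gap Q m s
  Gap-resp e g i s<i i≢ = ≈-trans (≈-sym (at e i)) (g i s<i i≢)

falling : ℕ → ℤ → ℤ
falling zero    x = 1ℤ
falling (suc j) x = (x - + j) * falling j x

coef-raise-D : ∀ j Q i → coef (raise (suc j) (D Q)) i ≡ (+ i - + j) * coef (raise j Q) i
coef-raise-D zero    Q zero    = refl
coef-raise-D zero    Q (suc i) = trans (coef-D Q i) (cong (λ z → z * coef Q (suc i)) (sym (ℤₚ.+-identityʳ (+ suc i))))
coef-raise-D (suc j) Q zero    = sym (ℤₚ.*-zeroʳ (+ 0 - + suc j))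
coef-raise-D (suc j) Q (suc i) = trans (coef-raise-D j Q i)
  (cong (λ z → z * coef (raise j Q) i) (lemma (+ i) (+ j)))
  where
  lemma : ∀ x y → x - y ≡ 1ℤ + x - (1ℤ + y)
  lemma = solve-∀

-- Multiplied back by the `j`-th power of x, the `j`-th derivative becomes diagonal on monomials, so
-- it preserves gaps.
coef-raise-Ds : ∀ j P i → coef (raise j (Ds j P)) i ≡ falling j (+ i) * coef P i
coef-raise-Ds zero    P i = sym (ℤₚ.*-identityˡ (coef P i))
coef-raise-Ds (suc j) P i = trans (coef-raise-D j (Ds j P) i)
  (trans (cong (λ z → (+ i - + j) * z) (coef-raise-Ds j P i)) (sym (ℤₚ.*-assoc (+ i - + j) (falling j (+ i)) (coef P i))))

rising-+ : ∀ e i j → rising e (i +ⁿ j) ≡ rising e i *ⁿ rising (e +ⁿ i) j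
rising-+ e zero    j = trans (cong (λ z → rising z j) (sym (ℕₚ.+-identityʳ e))) (sym (ℕₚ.+-identityʳ (rising (e +ⁿ 0) j)))
rising-+ e (suc i) j = trans (cong (suc e *ⁿ_) (trans (rising-+ (suc e) i j)
    (cong (λ z → rising (suc e) i *ⁿ rising z j) (sym (ℕₚ.+-suc e i)))))
  (sym (ℕₚ.*-assoc (suc e) (rising (suc e) i) (rising (e +ⁿ suc i) j)))

!-rising : ∀ e j → (e +ⁿ j) ! ≡ e ! *ⁿ rising e j
!-rising e zero    = trans (cong _! (ℕₚ.+-identityʳ e)) (sym (ℕₚ.*-identityʳ (e !)))
!-rising e (suc j) = begin
  (e +ⁿ suc j) !                          ≡⟨ cong _! (ℕₚ.+-suc e j) ⟩
  (suc e +ⁿ j) !                          ≡⟨ !-rising (suc e) j ⟩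
  suc e *ⁿ e ! *ⁿ rising (suc e) j        ≡⟨ lemma (suc e) (e !) (rising (suc e) j) ⟩
  e ! *ⁿ (suc e *ⁿ rising (suc e) j)      ∎
  where
  open ≡-Reasoning
  lemma : ∀ x y z → x *ⁿ y *ⁿ z ≡ y *ⁿ (x *ⁿ z)
  lemma = ℕ-solve-∀

^-neg : ∀ x j → (- x) ^ j ≡ (- 1ℤ) ^ j * x ^ j
^-neg x zero    = refl
^-neg x (suc j) = trans (cong (λ z → - x * z) (^-neg x j)) (lemma x ((- 1ℤ) ^ j) (x ^ j))
  where
  lemma : ∀ x y z → - x * (y * z) ≡ - 1ℤ * y * (x * z)
  lemma = solve-∀

-- The right-hand side, here and in the next bound, is 2 d and hence below p. Both terms of the
-- decisive factor of the leading coefficient are thus residues, and their congruence is an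
-- equality.
6k≤2[k+1]k : ∀ k → 3 ≤ⁿ k → 6 *ⁿ k ≤ⁿ suc k *ⁿ k +ⁿ suc k *ⁿ k
6k≤2[k+1]k k 3≤k = begin
  6 *ⁿ k                           ≡⟨ l k ⟩
  3 *ⁿ k +ⁿ 3 *ⁿ k                 ≤⟨ ℕₚ.+-mono-≤ (ℕₚ.*-monoˡ-≤ k 3≤1+k) (ℕₚ.*-monoˡ-≤ k 3≤1+k) ⟩
  suc k *ⁿ k +ⁿ suc k *ⁿ k         ∎
  where
  open ℕₚ.≤-Reasoning
  3≤1+k : 3 ≤ⁿ suc k
  3≤1+k = ℕₚ.m≤n⇒m≤1+n 3≤k
  l : ∀ k → 6 *ⁿ k ≡ 3 *ⁿ k +ⁿ 3 *ⁿ k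
  l = ℕ-solve-∀

[k+2][m+1]≤2[k+1]k : ∀ k m → 3 ≤ⁿ k → m ≤ⁿ k → (2 +ⁿ k) *ⁿ suc m ≤ⁿ suc k *ⁿ k +ⁿ suc k *ⁿ k
[k+2][m+1]≤2[k+1]k k m 3≤k m≤k = begin
  (2 +ⁿ k) *ⁿ suc m                ≤⟨ ℕₚ.*-mono-≤ (ℕₚ.+-monoˡ-≤ k (ℕₚ.≤-trans (s≤s (s≤s z≤n)) 3≤k)) (s≤s m≤k) ⟩
  (k +ⁿ k) *ⁿ suc k                ≡⟨ l k ⟩
  suc k *ⁿ k +ⁿ suc k *ⁿ k         ∎
  where
  open ℕₚ.≤-Reasoning
  l : ∀ k → (k +ⁿ k) *ⁿ suc k ≡ suc k *ⁿ k +ⁿ suc k *ⁿ k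
  l = ℕ-solve-∀

-- The octahedral and icosahedral sizes.

module ExceptionalSizes (p : ℕ) (p-prime : Prime p) where
  open Congruence p
  open Domain p-prime

  +-injective-≈ : ∀ {x y} → x <ⁿ p → y <ⁿ p → + x ≈ + y → x ≡ y
  +-injective-≈ {x} {y} x<p y<p e with ℕₚ.<-cmp x y
  ... | tri≈ _ x≡y _ = x≡y
  ... | tri< x<y _ _ = contradiction
    (≈-trans (≡⇒≈ (sym (trans (ℤₚ.m-n≡m⊖n y x) (ℤₚ.⊖-≥ (ℕₚ.<⇒≤ x<y))))) (≈⇒-≈0 (≈-sym e)))
    (0<m<p⇒≉0 (ℕₚ.m<n⇒0<n∸m x<y) (ℕₚ.≤-<-trans (ℕₚ.m∸n≤m y x) y<p))
  ... | tri> _ _ y<x = contradiction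
    (≈-trans (≡⇒≈ (sym (trans (ℤₚ.m-n≡m⊖n x y) (ℤₚ.⊖-≥ (ℕₚ.<⇒≤ y<x))))) (≈⇒-≈0 e))
    (0<m<p⇒≉0 (ℕₚ.m<n⇒0<n∸m y<x) (ℕₚ.≤-<-trans (ℕₚ.m∸n≤m x y) x<p))

  -- For m + 1 = 2, 3, 4, 5 the equation is linear in k with solutions 1, 2, 4, 10; from 6 on the
  -- left side is larger. The solutions 1 and 2 belong to d = 2 and d = 6.
  exceptional-sizes : ∀ k m → 3 ≤ⁿ k → 1 ≤ⁿ m → (2 +ⁿ k) *ⁿ suc m ≡ 6 *ⁿ k → (k ≡ 4 × m ≡ 3) ⊎ (k ≡ 10 × m ≡ 4)
  exceptional-sizes k 1 3≤k _ eq = contradiction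
    (ℕₚ.*-cancelˡ-≡ k 1 4 (ℕₚ.+-cancelˡ-≡ (2 *ⁿ k) (4 *ⁿ k) 4 (trans (l k) (trans (sym eq) (r k)))))
    (λ { refl → ℕₚ.<⇒≱ (s≤s (s≤s z≤n)) 3≤k })
    where
    l : ∀ k → 2 *ⁿ k +ⁿ 4 *ⁿ k ≡ 6 *ⁿ k
    l = ℕ-solve-∀
    r : ∀ k → (2 +ⁿ k) *ⁿ 2 ≡ 2 *ⁿ k +ⁿ 4
    r = ℕ-solve-∀
  exceptional-sizes k 2 3≤k _ eq = contradiction
    (ℕₚ.*-cancelˡ-≡ k 2 3 (ℕₚ.+-cancelˡ-≡ (3 *ⁿ k) (3 *ⁿ k) 6 (trans (l k) (trans (sym eq) (r k)))))
    (λ { refl → ℕₚ.<⇒≱ (s≤s (s≤s (s≤s z≤n))) 3≤k })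
    where
    l : ∀ k → 3 *ⁿ k +ⁿ 3 *ⁿ k ≡ 6 *ⁿ k
    l = ℕ-solve-∀
    r : ∀ k → (2 +ⁿ k) *ⁿ 3 ≡ 3 *ⁿ k +ⁿ 6
    r = ℕ-solve-∀
  exceptional-sizes k 3 3≤k _ eq = inj₁
    (ℕₚ.*-cancelˡ-≡ k 4 2 (ℕₚ.+-cancelˡ-≡ (4 *ⁿ k) (2 *ⁿ k) 8 (trans (l k) (trans (sym eq) (r k)))) , refl)
    where
    l : ∀ k → 4 *ⁿ k +ⁿ 2 *ⁿ k ≡ 6 *ⁿ k
    l = ℕ-solve-∀
    r : ∀ k → (2 +ⁿ k) *ⁿ 4 ≡ 4 *ⁿ k +ⁿ 8
    r = ℕ-solve-∀
  exceptional-sizes k 4 3≤k _ eq = inj₂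
    (ℕₚ.+-cancelˡ-≡ (5 *ⁿ k) k 10 (trans (l k) (trans (sym eq) (r k))) , refl)
    where
    l : ∀ k → 5 *ⁿ k +ⁿ k ≡ 6 *ⁿ k
    l = ℕ-solve-∀
    r : ∀ k → (2 +ⁿ k) *ⁿ 5 ≡ 5 *ⁿ k +ⁿ 10
    r = ℕ-solve-∀
  exceptional-sizes k (suc (suc (suc (suc (suc m))))) 3≤k _ eq = contradiction (sym eq) (ℕₚ.<⇒≢ (begin-strict
    6 *ⁿ k                             <⟨ ℕₚ.m<m+n (6 *ⁿ k) {12 +ⁿ (2 +ⁿ k) *ⁿ m} (s≤s z≤n) ⟩
    6 *ⁿ k +ⁿ (12 +ⁿ (2 +ⁿ k) *ⁿ m)    ≡⟨ r k m ⟨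
    (2 +ⁿ k) *ⁿ (6 +ⁿ m)               ∎))
    where
    open ℕₚ.≤-Reasoning
    r : ∀ k m → (2 +ⁿ k) *ⁿ (6 +ⁿ m) ≡ 6 *ⁿ k +ⁿ (12 +ⁿ (2 +ⁿ k) *ⁿ m)
    r = ℕ-solve-∀

  -- The relations between the first nonzero coefficient ε of f and the moment W = ∑ cᵢ aᵢᵏ⁺ᵐ.
  record TopRelations (k m t : ℕ) (ε W : ℤ) : Set where
    field
      moment    : (- 1ℤ) ^ (k +ⁿ m) * W + ε * (- 1ℤ) ^ k ≈ 0ℤ
      expansion : + rising k m * (+ k * ε) ≈ + rising t m * W

  p∤ : ∀ {x} → 0 <ⁿ x → x <ⁿ p → ¬ p ∣ x
  p∤ {suc x} _ x<p p∣x = ℕₚ.<⇒≱ x<p (∣⇒≤ p∣x)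

  p∤* : ∀ {x y} → ¬ p ∣ x → ¬ p ∣ y → ¬ p ∣ x *ⁿ y
  p∤* {x} {y} p∤x p∤y p∣xy = [ p∤x , p∤y ]′ (euclidsLemma x y p-prime p∣xy)

  -- Eliminates `W` between the two relations; `u` is a sign, so it is its own inverse.
  combine-relations : ∀ x y z u v {ε W} → u * u ≡ 1ℤ → x * (y * ε) ≈ z * W → u * W + ε * v ≈ 0ℤ →
                      (x * y + z * (u * v)) * ε ≈ 0ℤ
  combine-relations x y z u v {ε} {W} u²≡1 e₁ e₂ =
    combine₃ 1ℤ (z * u) (z * W) e₁ e₂ (≡⇒≈ (sym u²≡1)) (lemma x y z u v ε W)
    where
    lemma : ∀ x y z u v ε W → (x * y + z * (u * v)) * ε - 0ℤ ≡
      1ℤ * (x * (y * ε) - z * W) + z * u * (u * W + ε * v - 0ℤ) + z * W * (1ℤ - u * u)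
    lemma = solve-∀

  -- Here d = 20 and the signs agree, so the factor is 4·5·6·7·8 + 17·18·19·20 = 123000 =
  -- 41·40·15·5. All divisors shown except 41 are at most 2 d, hence below p.
  five-points : ∀ {ε W} → 40 <ⁿ p → p ≢ 41 → TopRelations 4 4 16 ε W → ε ≈ 0ℤ
  five-points {ε} {W} 40<p p≢41 R = *-cancel-≈0 factor factor≉0
    (combine-relations (+ rising 4 4) (+ 4) (+ rising 16 4) ((- 1ℤ) ^ 8) ((- 1ℤ) ^ 4) {ε} {W} refl expansion moment)
    where
    open TopRelations R
    factor : ℤ
    factor = + rising 4 4 * + 4 + + rising 16 4 * ((- 1ℤ) ^ 8 * (- 1ℤ) ^ 4)
    p∤41 : ¬ p ∣ 41
    p∤41 p∣41 = p≢41 (ℕₚ.≤-antisym (∣⇒≤ p∣41) 40<p)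
    small : ∀ x y → suc x +ⁿ y ≡ 40 → ¬ p ∣ suc x
    small x y eq = p∤ (s≤s z≤n) (ℕₚ.≤-<-trans (subst (suc x ≤ⁿ_) eq (ℕₚ.m≤m+n (suc x) y)) 40<p)
    factorisation : ∣ factor ∣ ≡ 41 *ⁿ (40 *ⁿ (15 *ⁿ 5))
    factorisation = refl
    factor≉0 : factor ≉ 0ℤ
    factor≉0 z = p∤* {41} {40 *ⁿ (15 *ⁿ 5)} p∤41
      (p∤* {40} {15 *ⁿ 5} (small 39 0 refl) (p∤* {15} {5} (small 14 25 refl) (small 4 35 refl)))
      (subst (p ∣_) factorisation (≈0⇒∣ z))

  -- Here d = 110 and the signs differ. The absolute value 106·107·108·109·110 - 10·11·12·13·14·15
  -- happens to split into divisors below 2 d = 220, so this size yields no exceptional prime.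
  eleven-points : ∀ {ε W} → 220 <ⁿ p → TopRelations 10 5 105 ε W → ε ≈ 0ℤ
  eleven-points {ε} {W} 220<p R = *-cancel-≈0 factor factor≉0
    (combine-relations (+ rising 10 5) (+ 10) (+ rising 105 5) ((- 1ℤ) ^ 15) ((- 1ℤ) ^ 10) {ε} {W} refl expansion moment)
    where
    open TopRelations R
    factor : ℤ
    factor = + rising 10 5 * + 10 + + rising 105 5 * ((- 1ℤ) ^ 15 * (- 1ℤ) ^ 10)
    small : ∀ x y → suc x +ⁿ y ≡ 220 → ¬ p ∣ suc x
    small x y eq = p∤ (s≤s z≤n) (ℕₚ.≤-<-trans (subst (suc x ≤ⁿ_) eq (ℕₚ.m≤m+n (suc x) y)) 220<p)
    factorisation : ∣ factor ∣ ≡ 163 *ⁿ (188 *ⁿ (121 *ⁿ (88 *ⁿ 45)))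
    factorisation = refl
    factor≉0 : factor ≉ 0ℤ
    factor≉0 z = p∤* {163} {188 *ⁿ (121 *ⁿ (88 *ⁿ 45))} (small 162 57 refl)
      (p∤* {188} {121 *ⁿ (88 *ⁿ 45)} (small 187 32 refl) (p∤* {121} {88 *ⁿ 45} (small 120 99 refl)
        (p∤* {88} {45} (small 87 132 refl) (small 44 175 refl))))
      (subst (p ∣_) factorisation (≈0⇒∣ z))

  first-coefficient≈0 : ∀ {k m t ε W} → (k ≡ 4 × m ≡ 3) ⊎ (k ≡ 10 × m ≡ 4) → suc m +ⁿ t ≡ suc k *ⁿ k →
                        suc k *ⁿ k +ⁿ suc k *ⁿ k <ⁿ p → (k ≡ 4 → p ≢ 41) → TopRelations k (suc m) t ε W → ε ≈ 0ℤ
  first-coefficient≈0 {t = t} {ε} {W} (inj₁ (refl , refl)) eq 2d<p p≢41 R =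
    five-points 2d<p (p≢41 refl) (subst (λ i → TopRelations 4 4 i ε W) (ℕₚ.+-cancelˡ-≡ 4 t 16 eq) R)
  first-coefficient≈0 {t = t} {ε} {W} (inj₂ (refl , refl)) eq 2d<p p≢41 R =
    eleven-points 2d<p (subst (λ i → TopRelations 10 5 i ε W) (ℕₚ.+-cancelˡ-≡ 5 t 105 eq) R)

-- Monic polynomials with given roots.

fromRoots : List ℤ → Poly
fromRoots []       = const 1ℤ
fromRoots (a ∷ as) = lin a ⊗ fromRoots as

module Monic (p : ℕ) where
  open Congruence p
  open PolynomialCongruence p
  open Expansion p

  record IsMonic (P : Poly) (m : ℕ) : Set where
    field
      leading : coef P m ≈ 1ℤ
      bound   : Deg< P (suc m)
  open IsMonic public

  IsMonic-resp : ∀ {P Q m} → P ≋ Q → IsMonic P m → IsMonic Q m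
  IsMonic-resp {P} e μ = record
    { leading = ≈-trans (≈-sym (at e _)) (leading μ) ; bound = Deg<-resp {P} e (bound μ) }

  const-1-monic : IsMonic (const 1ℤ) 0
  const-1-monic = record { leading = ≈-refl ; bound = λ { (suc k) _ → ≈-refl } }

  lin-⊗-monic : ∀ a {P m} → IsMonic P m → IsMonic (lin a ⊗ P) (suc m)
  lin-⊗-monic a {P} {m} μ = record
    { leading = ≈-trans (≡⇒≈ (coef-lin-suc a P m)) (+-cong (*-zeroʳ′ a (bound μ (suc m) ℕₚ.≤-refl)) (leading μ))
    ; bound   = Deg<-lin-⊗ {P} a (bound μ)
    }

  fromRoots-⊗-monic : ∀ as {P m} → IsMonic P m → IsMonic (fromRoots as ⊗ P) (length as +ⁿ m)
  fromRoots-⊗-monic []       {P} μ = IsMonic-resp (≋-sym (≋-trans (const-⊗ 1ℤ P) (1•P≋P P))) μ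
  fromRoots-⊗-monic (a ∷ as) {P} μ =
    IsMonic-resp (≋-sym (⊗-assoc (lin a) (fromRoots as) P)) (lin-⊗-monic a (fromRoots-⊗-monic as μ))

  fromRoots^-monic : ∀ as k → IsMonic (fromRoots as ^ᵖ k) (k *ⁿ length as)
  fromRoots^-monic as zero    = const-1-monic
  fromRoots^-monic as (suc k) = fromRoots-⊗-monic as (fromRoots^-monic as k)

  fromRoots-monic : ∀ as → IsMonic (fromRoots as) (length as)
  fromRoots-monic []       = const-1-monic
  fromRoots-monic (a ∷ as) = lin-⊗-monic a (fromRoots-monic as)

  fromRoots-roots : ∀ as → All (λ a → ev (fromRoots as) (- a) ≈ 0ℤ) as
  fromRoots-roots []       = []
  fromRoots-roots (a ∷ as) = ev-lin-⊗ a (fromRoots as) ∷ All.map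
    (λ {b} e → ≈-trans (≡⇒≈ (ev-⊗ (lin a) (fromRoots as) (- b))) (*-zeroʳ′ (ev (lin a) (- b)) e))
    (fromRoots-roots as)

  lin^-Deg< : ∀ a e → Deg< (lin a ^ᵖ e) (suc e)
  lin^-Deg< a zero    = bound const-1-monic
  lin^-Deg< a (suc e) = Deg<-lin-⊗ {lin a ^ᵖ e} a (lin^-Deg< a e)

  powerSum-Deg< : ∀ ws e → Deg< (powerSum ws e) (suc e)
  powerSum-Deg< []             e k _ = ≈-refl
  powerSum-Deg< ((c , a) ∷ ws) e =
    Deg<-⊕ {c • lin a ^ᵖ e} (Deg<-• {lin a ^ᵖ e} c (lin^-Deg< a e)) (powerSum-Deg< ws e)

  ev-congʳ : ∀ P {r s} → r ≈ s → ev P r ≈ ev P s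
  ev-congʳ []      e = ≈-refl
  ev-congʳ (a ∷ P) e = +-cong (≈-refl {a}) (*-cong e (ev-congʳ P e))

  Deg<-quo : ∀ a {P m} → Deg< P (suc m) → Deg< (quo a P) m
  Deg<-quo a {P} {m} δ = lin-⊗-Deg< a {quo a P} λ { (suc k) m≤k →
    ≈-trans (≈-sym (≈-trans (≡⇒≈ (division a P (suc k)))
      (≡⇒≈ (trans (coef-⊕ (const (ev P (- a))) (lin a ⊗ quo a P) (suc k)) (ℤₚ.+-identityˡ _))))) (δ (suc k) m≤k) }

  ⊗-^ᵖ : ∀ P Q k → (P ⊗ Q) ^ᵖ k ≋ P ^ᵖ k ⊗ Q ^ᵖ k
  ⊗-^ᵖ P Q zero    = ≋-sym (≋-trans (const-⊗ 1ℤ (const 1ℤ)) (1•P≋P (const 1ℤ)))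
  ⊗-^ᵖ P Q (suc k) = ≋-trans (⊗-congˡ (P ⊗ Q) (⊗-^ᵖ P Q k))
    (solve 4 (λ x y z w → x :* y :* (z :* w) := x :* z :* (y :* w)) ≋-refl P Q (P ^ᵖ k) (Q ^ᵖ k))
    where open PolySolver

  ev-^ᵖ : ∀ P k r → ev (P ^ᵖ k) r ≡ ev P r ^ k
  ev-^ᵖ P zero    r = cong (λ z → 1ℤ + z) (ℤₚ.*-zeroʳ r)
  ev-^ᵖ P (suc k) r = trans (ev-⊗ P (P ^ᵖ k) r) (cong (λ z → ev P r * z) (ev-^ᵖ P k r))

  ev-D-⊗ : ∀ P Q r → ev (D (P ⊗ Q)) r ≈ ev (D P) r * ev Q r + ev P r * ev (D Q) r
  ev-D-⊗ P Q r = ≈-trans (ev-cong r (D-⊗ P Q)) (≡⇒≈ (trans (ev-⊕ (D P ⊗ Q) (P ⊗ D Q) r)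
    (cong₂ _+_ (ev-⊗ (D P) Q r) (ev-⊗ P (D Q) r))))

  ev-D²-⊗ : ∀ P Q r → ev (D (D (P ⊗ Q))) r ≈
            ev (D (D P)) r * ev Q r + + 2 * (ev (D P) r * ev (D Q) r) + ev P r * ev (D (D Q)) r
  ev-D²-⊗ P Q r = begin
    ev (D (D (P ⊗ Q))) r                                ≈⟨ ev-cong r (D-cong (D-⊗ P Q)) ⟩
    ev (D (D P ⊗ Q ⊕ P ⊗ D Q)) r                        ≈⟨ ev-cong r (D-⊕ (D P ⊗ Q) (P ⊗ D Q)) ⟩
    ev (D (D P ⊗ Q) ⊕ D (P ⊗ D Q)) r                    ≡⟨ ev-⊕ (D (D P ⊗ Q)) (D (P ⊗ D Q)) r ⟩
    ev (D (D P ⊗ Q)) r + ev (D (P ⊗ D Q)) r             ≈⟨ +-cong (ev-D-⊗ (D P) Q r) (ev-D-⊗ P (D Q) r) ⟩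
    _                                                   ≡⟨ lemma (ev P r) (ev (D P) r) (ev (D (D P)) r) (ev Q r) (ev (D Q) r) (ev (D (D Q)) r) ⟩
    _                                                   ∎
    where
    open SetoidReasoning ≈-setoid
    lemma : ∀ x x′ x″ y y′ y″ → x″ * y + x′ * y′ + (x′ * y′ + x * y″) ≡ x″ * y + + 2 * (x′ * y′) + x * y″
    lemma = solve-∀

  -- The logarithmic derivative of a power, multiplied out so that neither a quotient nor the
  -- exponent k - 1 occurs.
  power-ode : ∀ P k → P ⊗ D (P ^ᵖ k) ≋ + k • (D P ⊗ P ^ᵖ k)
  power-ode P zero    = ≋-trans (⊗-congˡ P (D-const 1ℤ)) (≋-trans (⊗-zeroʳ P)
    (coefwise λ j → ≡⇒≈ (sym (coef-• 0ℤ (D P ⊗ const 1ℤ) j))))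
  power-ode P (suc k) = begin
    P ⊗ D (P ⊗ U)                                   ≈⟨ ⊗-congˡ P (D-⊗ P U) ⟩
    P ⊗ (D P ⊗ U ⊕ P ⊗ D U)                         ≈⟨ ⊗-congˡ P (⊕-cong (≋-refl {D P ⊗ U}) (power-ode P k)) ⟩
    P ⊗ (D P ⊗ U ⊕ + k • (D P ⊗ U))                 ≈⟨ ⊗-congˡ P (suc-• k (D P ⊗ U)) ⟩
    P ⊗ (+ suc k • (D P ⊗ U))                       ≈⟨ ⊗-• (+ suc k) P (D P ⊗ U) ⟩
    + suc k • (P ⊗ (D P ⊗ U))                       ≈⟨ •-congˡ (+ suc k) (solve 3 (λ x y z → x :* (y :* z) := y :* (x :* z)) ≋-refl P (D P) U) ⟩
    + suc k • (D P ⊗ (P ⊗ U))                       ∎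
    where
    open ≋-Reasoning
    open PolySolver using (solve; _:*_; _:=_)
    U = P ^ᵖ k

-- Stepanov's auxiliary polynomial.

module Stepanov
  (p : ℕ) (p-prime : Prime p) (k e : ℕ) (3≤k : 3 ≤ⁿ k)
  (k[k+1]≡4+e : suc k *ⁿ k ≡ 4 +ⁿ e) (N<p : k +ⁿ (4 +ⁿ e) <ⁿ p)
  (ws : List (ℤ × ℤ))
  (dd : Weights.IsDividedDifference p k ws)
  (|ws|≡k+1 : length (nodes ws) ≡ suc k)
  (distinct : AllPairs (Congruence._≉_ p) (nodes ws))
  (differences : ∀ {a b} → a ∈ nodes ws → b ∈ nodes ws →
                 Congruence._≈_ p a b ⊎ Congruence._≈_ p ((a - b) ^ (4 +ⁿ e)) 1ℤ)
  where
  open Congruence p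
  open Domain p-prime
  open PolynomialCongruence p
  open Expansion p
  open Roots p-prime
  open Weights p
  open IsDividedDifference dd
  open Monic p

  as : List ℤ
  as = nodes ws

  -- With `d` in the form `4 + e`, the exponents d - 1, d - 2, d - 3 need no subtraction. The bound
  -- N < p makes all factorials up to N! invertible.
  d N : ℕ
  d = 4 +ⁿ e
  N = k +ⁿ d

  k>0 : 0 <ⁿ k
  k>0 = ℕₚ.≤-trans (s≤s z≤n) 3≤k

  rising-≉0 : ∀ e j → e +ⁿ j <ⁿ p → + rising e j ≉ 0ℤ
  rising-≉0 e zero    _ = 1≉0
  rising-≉0 e (suc j) e+j<p z = *-≉0
    (0<m<p⇒≉0 (s≤s z≤n) (ℕₚ.≤-<-trans (subst (suc e ≤ⁿ_) (sym (ℕₚ.+-suc e j)) (s≤s (ℕₚ.m≤m+n e j))) e+j<p))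
    (rising-≉0 (suc e) j (subst (_<ⁿ p) (ℕₚ.+-suc e j) e+j<p))
    (≈-trans (≡⇒≈ (sym (ℤₚ.pos-* (suc e) (rising (suc e) j)))) z)

  f F : Poly
  f = fromRoots as
  F = powerSum ws N ⊖ const 1ℤ

  Ds-F : ∀ l i → 0 <ⁿ l → l +ⁿ i ≡ N → Ds l F ≋ + rising i l • powerSum ws i
  Ds-F (suc l) i _ eq = begin
    Ds (suc l) F                                                          ≈⟨ Ds-⊕ (suc l) (powerSum ws N) (- 1ℤ • const 1ℤ) ⟩
    Ds (suc l) (powerSum ws N) ⊕ Ds (suc l) (- 1ℤ • const 1ℤ)             ≈⟨ ⊕-cong (≋-refl {Ds (suc l) (powerSum ws N)}) (Ds-const l (- 1ℤ)) ⟩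
    Ds (suc l) (powerSum ws N) ⊕ []                                       ≈⟨ ⊕-comm (Ds (suc l) (powerSum ws N)) [] ⟩
    Ds (suc l) (powerSum ws N)                                            ≡⟨ cong (λ j → Ds (suc l) (powerSum ws j)) eq ⟨
    Ds (suc l) (powerSum ws (suc l +ⁿ i))                                 ≈⟨ Ds-powerSum ws (suc l) i ⟩
    + rising i (suc l) • powerSum ws i                                    ∎
    where open ≋-Reasoning

  -- In positive order the subtracted constant of `F` drops out, leaving a derivative of the power
  -- sum.
  F-digit : ∀ b l i → 0 <ⁿ l → l +ⁿ i ≡ N →
            + (l !) * digit b l F ≈ + rising i l * wsum ws (λ a → (a - b) ^ i)
  F-digit b l i 0<l eq = begin
    + (l !) * digit b l F                          ≈⟨ ev-Ds l b F ⟨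
    ev (Ds l F) (- b)                              ≈⟨ ev-cong (- b) (Ds-F l i 0<l eq) ⟩
    ev (+ rising i l • powerSum ws i) (- b)        ≡⟨ ev-• (+ rising i l) (powerSum ws i) (- b) ⟩
    + rising i l * ev (powerSum ws i) (- b)        ≡⟨ cong (λ z → + rising i l * z) (ev-powerSum ws i b) ⟩
    + rising i l * wsum ws (λ a → (a - b) ^ i)     ∎
    where open SetoidReasoning ≈-setoid

  F-coef : ∀ l i → 0 <ⁿ l → l +ⁿ i ≡ N → + (l !) * coef F l ≈ + rising i l * wsum ws (_^ i)
  F-coef l i 0<l eq = begin
    + (l !) * coef F l                             ≡⟨ coef₀-Ds l F ⟨
    coef (Ds l F) 0                                ≈⟨ at (Ds-F l i 0<l eq) 0 ⟩
    coef (+ rising i l • powerSum ws i) 0          ≡⟨ coef-• (+ rising i l) (powerSum ws i) 0 ⟩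
    + rising i l * coef (powerSum ws i) 0          ≡⟨ cong (λ z → + rising i l * z) (coef₀-powerSum ws i) ⟩
    + rising i l * wsum ws (_^ i)                  ∎
    where open SetoidReasoning ≈-setoid

  ≈0^ : ∀ {x} i → x ≈ 0ℤ → x ^ suc i ≈ 0ℤ
  ≈0^ {x} i x≈0 = ≈-trans (^-cong (suc i) x≈0) (≡⇒≈ refl)

  -- The remaining exponent is positive because for `a ≈ b` both powers have to be 0.
  reduce-exponent : ∀ {a b} j → a ∈ as → b ∈ as → (a - b) ^ (suc j +ⁿ d) ≈ (a - b) ^ suc j
  reduce-exponent {a} {b} j a∈ b∈ with differences a∈ b∈
  ... | inj₁ a≈b = ≈-trans (≈0^ (j +ⁿ d) (≈⇒-≈0 a≈b)) (≈-sym (≈0^ j (≈⇒-≈0 a≈b)))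
  ... | inj₂ unit = begin
    (a - b) ^ (suc j +ⁿ d)          ≡⟨ ℤₚ.^-distribˡ-+-* (a - b) (suc j) d ⟩
    (a - b) ^ suc j * (a - b) ^ d   ≈⟨ *-congˡ ((a - b) ^ suc j) unit ⟩
    (a - b) ^ suc j * 1ℤ            ≡⟨ ℤₚ.*-identityʳ ((a - b) ^ suc j) ⟩
    (a - b) ^ suc j                 ∎
    where open SetoidReasoning ≈-setoid

  wsum-reduce : ∀ {b} j → 0 <ⁿ j → b ∈ as → wsum ws (λ a → (a - b) ^ (j +ⁿ d)) ≈ wsum ws (λ a → (a - b) ^ j)
  wsum-reduce (suc j) _ b∈ = wsum-cong ws (All.tabulate λ a∈ → reduce-exponent j a∈ b∈)

  -- For l < k the exponent N - l exceeds d and reduces to k - l, which lies between 1 and k. The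
  -- resulting moment is 0, except for l = 0, where it is 1 and cancels the constant.
  F-low-digits : ∀ {b} → b ∈ as → ∀ l → l <ⁿ k → digit b l F ≈ 0ℤ
  F-low-digits {b} b∈ zero l<k = begin
    ev F (- b)                                         ≡⟨ ev-⊖ (powerSum ws N) (const 1ℤ) (- b) ⟩
    ev (powerSum ws N) (- b) - ev (const 1ℤ) (- b)     ≡⟨ cong₂ _-_ (ev-powerSum ws N b) (cong (λ z → 1ℤ + z) (ℤₚ.*-zeroʳ (- b))) ⟩
    wsum ws (λ a → (a - b) ^ N) - 1ℤ                   ≈⟨ ≈⇒-≈0 (≈-trans (wsum-reduce k k>0 b∈) (top-shifted dd b)) ⟩
    0ℤ                                                 ∎
    where open SetoidReasoning ≈-setoid
  F-low-digits {b} b∈ (suc l) l<k = *-cancel-≈0 (+ (suc l !))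
    (!-≉0 (suc l) (ℕₚ.<-trans l<k (ℕₚ.≤-<-trans (ℕₚ.m≤m+n k d) N<p)))
    (≈-trans (F-digit b (suc l) (suc j +ⁿ d) (s≤s z≤n) eq)
      (*-zeroʳ′ (+ rising (suc j +ⁿ d) (suc l)) (≈-trans (wsum-reduce (suc j) (s≤s z≤n) b∈) (low-shifted dd b (suc j) j<k))))
    where
    j = k ∸ⁿ suc (suc l)
    k≡ : suc l +ⁿ suc j ≡ k
    k≡ = trans (ℕₚ.+-suc (suc l) j) (ℕₚ.m+[n∸m]≡n l<k)
    eq : suc l +ⁿ (suc j +ⁿ d) ≡ N
    eq = trans (sym (ℕₚ.+-assoc (suc l) (suc j) d)) (cong (_+ⁿ d) k≡)
    j<k : suc j <ⁿ k
    j<k = subst (suc j <ⁿ_) k≡ (s≤s (ℕₚ.m≤n+m (suc j) l))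

  C : ℤ
  C = coef F d

  -- So `C` is the binomial coefficient of N over d mod p, nonzero because N < p.
  C-formula : + (d !) * C ≈ + rising k d
  C-formula = ≈-trans (F-coef d k (s≤s z≤n) (ℕₚ.+-comm d k))
    (≈-trans (*-congˡ (+ rising k d) top) (≡⇒≈ (ℤₚ.*-identityʳ (+ rising k d))))

  C≉0 : C ≉ 0ℤ
  C≉0 C≈0 = rising-≉0 k d N<p (≈-trans (≈-sym C-formula) (*-zeroʳ′ (+ (d !)) C≈0))

  -- Beyond d the coefficients involve moments of order N - j < k, which vanish; beyond N the power
  -- sum has no terms.
  F-Deg< : Deg< F (suc d)
  F-Deg< (suc j) (s≤s d≤j) with suc j ℕₚ.≤? N
  ... | yes j≤N = *-cancel-≈0 (+ (suc j !)) (!-≉0 (suc j) (ℕₚ.≤-<-trans j≤N N<p))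
    (≈-trans (F-coef (suc j) (N ∸ⁿ suc j) (s≤s z≤n) (ℕₚ.m+[n∸m]≡n j≤N))
      (*-zeroʳ′ (+ rising (N ∸ⁿ suc j) (suc j)) (low (N ∸ⁿ suc j) small)))
    where
    small : N ∸ⁿ suc j <ⁿ k
    small = ℕₚ.+-cancelʳ-< d (N ∸ⁿ suc j) k (ℕₚ.<-≤-trans (ℕₚ.+-monoʳ-< (N ∸ⁿ suc j) (s≤s d≤j))
      (ℕₚ.≤-reflexive (ℕₚ.m∸n+n≡m j≤N)))
  ... | no j≰N = ≈-trans (≡⇒≈ (coef-⊖ (powerSum ws N) (const 1ℤ) (suc j)))
    (≈⇒-≈0 (powerSum-Deg< ws N (suc j) (ℕₚ.≰⇒> j≰N)))

  f-monic : IsMonic f (suc k)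
  f-monic = subst (IsMonic f) |ws|≡k+1 (fromRoots-monic as)

  f^k-monic : IsMonic (f ^ᵖ k) d
  f^k-monic = subst (IsMonic (f ^ᵖ k)) (trans (cong (k *ⁿ_) |ws|≡k+1) (trans (ℕₚ.*-comm k (suc k)) k[k+1]≡4+e))
    (fromRoots^-monic as k)

  f-root : ∀ {a} → a ∈ as → ev f (- a) ≈ 0ℤ
  f-root = All.lookup (fromRoots-roots as)

  module AtNode {b : ℤ} (b∈as : b ∈ as) where

    φ G : Poly
    φ = quo b f
    G = quos b k F

    f≋lin⊗φ : f ≋ lin b ⊗ φ
    f≋lin⊗φ = factor-theorem b f (f-root b∈as)

    F≋lin^⊗G : F ≋ lin b ^ᵖ k ⊗ G
    F≋lin^⊗G = digits≈0⇒factor b k F (F-low-digits b∈as)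

    f^k≋ : C • f ^ᵖ k ≋ lin b ^ᵖ k ⊗ (C • φ ^ᵖ k)
    f^k≋ = ≋-trans (•-congˡ C (≋-trans (^ᵖ-cong k f≋lin⊗φ) (⊗-^ᵖ (lin b) φ k)))
      (≋-sym (⊗-• C (lin b ^ᵖ k) (φ ^ᵖ k)))

  -- The choice of `C` cancels the terms of degree d, which brings the difference just below n k =
  -- d, the number of its zeros with multiplicity.
  F≋Cf^k : F ≋ C • f ^ᵖ k
  F≋Cf^k = ⊖≋[]⇒≋ (too-many-roots k (F ⊖ C • f ^ᵖ k) distinct (All.tabulate divides-difference)
    (subst (Deg< (F ⊖ C • f ^ᵖ k)) (sym (trans (cong (_*ⁿ k) |ws|≡k+1) k[k+1]≡4+e)) degree))
    where
    divides-difference : ∀ {b} → b ∈ as → b ^ k ∥ (F ⊖ C • f ^ᵖ k)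
    divides-difference {b} b∈ = G ⊖ C • φ ^ᵖ k ,
      ≋-trans (⊖-cong F≋lin^⊗G f^k≋) (≋-sym (⊗-⊖ (lin b ^ᵖ k) G (C • φ ^ᵖ k)))
      where open AtNode b∈
    degree : Deg< (F ⊖ C • f ^ᵖ k) d
    degree j d≤j with ℕₚ.m≤n⇒m<n∨m≡n d≤j
    ... | inj₁ d<j = ≈-trans (≡⇒≈ (coef-⊖ F (C • f ^ᵖ k) j))
      (≈⇒-≈0 (≈-trans (F-Deg< j d<j) (≈-sym (Deg<-• {f ^ᵖ k} C (bound f^k-monic) j d<j))))
    ... | inj₂ refl = ≈-trans (≡⇒≈ (coef-⊖ F (C • f ^ᵖ k) d)) (≈⇒-≈0 (≈-sym (begin
      coef (C • f ^ᵖ k) d    ≡⟨ coef-• C (f ^ᵖ k) d ⟩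
      C * coef (f ^ᵖ k) d    ≈⟨ *-congˡ C (leading f^k-monic) ⟩
      C * 1ℤ                 ≡⟨ ℤₚ.*-identityʳ C ⟩
      C                      ∎)))
      where open SetoidReasoning ≈-setoid

  small-≉0 : ∀ m → 0 <ⁿ m → m ≤ⁿ N → + m ≉ 0ℤ
  small-≉0 m 0<m m≤N = 0<m<p⇒≉0 0<m (ℕₚ.≤-<-trans m≤N N<p)

  k+4≤N : k +ⁿ 4 ≤ⁿ N
  k+4≤N = ℕₚ.+-monoʳ-≤ k (ℕₚ.m≤m+n 4 e)

  κ : ℤ
  κ = + k

  d≡[1+κ]κ : + d ≡ (1ℤ + κ) * κ
  d≡[1+κ]κ = trans (cong +_ (sym k[k+1]≡4+e)) (ℤₚ.pos-* (suc k) k)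

  2≉0 : + 2 ≉ 0ℤ
  2≉0 = small-≉0 2 (s≤s z≤n) (ℕₚ.≤-trans (s≤s (s≤s z≤n)) (ℕₚ.m≤n+m d k))

  κ≉0 : κ ≉ 0ℤ
  κ≉0 = small-≉0 k k>0 (ℕₚ.m≤m+n k d)

  1+κ≉0 : 1ℤ + κ ≉ 0ℤ
  1+κ≉0 = small-≉0 (suc k) (s≤s z≤n) (ℕₚ.≤-trans (subst (_≤ⁿ k +ⁿ 4) (ℕₚ.+-comm k 1) (ℕₚ.+-monoʳ-≤ k (s≤s z≤n))) k+4≤N)

  2+κ≉0 : + 2 + κ ≉ 0ℤ
  2+κ≉0 = small-≉0 (2 +ⁿ k) (s≤s z≤n) (ℕₚ.≤-trans (subst (_≤ⁿ k +ⁿ 4) (ℕₚ.+-comm k 2) (ℕₚ.+-monoʳ-≤ k (s≤s (s≤s z≤n)))) k+4≤N)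

  κ-2≉0 : κ - + 2 ≉ 0ℤ
  κ-2≉0 z = small-≉0 (k ∸ⁿ 2) (ℕₚ.m<n⇒0<n∸m 3≤k) (ℕₚ.≤-trans (ℕₚ.m∸n≤m k 2) (ℕₚ.m≤m+n k d))
    (≈-trans (≡⇒≈ (sym (trans (ℤₚ.m-n≡m⊖n k 2) (ℤₚ.⊖-≥ (ℕₚ.≤-trans (s≤s (s≤s z≤n)) 3≤k))))) z)

  -- Taylor coefficients at a root of f.

  module LocalExpansion {b : ℤ} (b∈as : b ∈ as) where
    open AtNode b∈as

    G≋Cφ^k : G ≋ C • φ ^ᵖ k
    G≋Cφ^k = lin^-cancel b k (≋-trans (≋-sym F≋lin^⊗G) (≋-trans F≋Cf^k f^k≋))

    φ-Deg< : Deg< φ (suc k)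
    φ-Deg< = Deg<-quo b {f} (bound f-monic)

    φ-root : ∀ {a} → a ∈ as → (b - a) * ev φ (- a) ≈ 0ℤ
    φ-root {a} a∈ = begin
      (b - a) * ev φ (- a)               ≡⟨ cong (λ z → z * ev φ (- a)) (ev-lin b (- a)) ⟨
      ev (lin b) (- a) * ev φ (- a)      ≡⟨ ev-⊗ (lin b) φ (- a) ⟨
      ev (lin b ⊗ φ) (- a)               ≈⟨ ev-cong (- a) f≋lin⊗φ ⟨
      ev f (- a)                         ≈⟨ f-root a∈ ⟩
      0ℤ                                 ∎
      where open SetoidReasoning ≈-setoid

    -- Otherwise `φ`, of degree at most k, would vanish at all k + 1 nodes.
    φ₀≉0 : digit b 0 φ ≉ 0ℤ
    φ₀≉0 φ₀≈0 = 1≉0 (≈-trans (≈-sym (leading f-monic)) (at f≋[] (suc k)))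
      where
      vanishes : ∀ {a} → a ∈ as → ev φ (- a) ≈ 0ℤ
      vanishes {a} a∈ = [ (λ b-a≈0 → ≈-trans (ev-congʳ φ (-‿cong {a} {b} (≈-sym (-≈0⇒≈ {b} {a} b-a≈0)))) φ₀≈0)
                        , (λ z → z) ]′ (*-≈0 (b - a) {ev φ (- a)} (φ-root a∈))
      φ≋[] : φ ≋ []
      φ≋[] = too-many-roots 1 φ distinct
        (All.tabulate λ {a} a∈ → quo a φ , digits≈0⇒factor a 1 φ λ { zero _ → vanishes a∈ ; (suc _) (s≤s ()) })
        (subst (Deg< φ) (sym (trans (ℕₚ.*-identityʳ (length as)) |ws|≡k+1)) φ-Deg<)
      f≋[] : f ≋ []
      f≋[] = ≋-trans f≋lin⊗φ (≋-trans (⊗-congˡ (lin b) φ≋[]) (⊗-zeroʳ (lin b)))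

    τ : ℕ → ℤ
    τ i = wsum ws (λ a → (a - b) ^ i)

    G-digit : ∀ m i → m +ⁿ i ≡ d → + ((m +ⁿ k) !) * digit b m G ≈ + rising i (m +ⁿ k) * τ i
    G-digit m i eq = subst (λ j → + (j !) * digit b m G ≈ + rising i j * τ i) (ℕₚ.+-comm k m)
      (≈-trans (≡⇒≈ (cong (λ P → + ((k +ⁿ m) !) * ev P (- b)) (sym (quos-+ b k m F))))
        (F-digit b (k +ⁿ m) i (ℕₚ.≤-trans k>0 (ℕₚ.m≤m+n k m))
          (trans (ℕₚ.+-assoc k m i) (cong (k +ⁿ_) eq))))

    ev-division : ∀ Q a → ev Q (- a) ≈ ev Q (- b) + (b - a) * ev (quo b Q) (- a)
    ev-division Q a = ≈-trans (ev-cong (- a) (≡⇒≋ {Q} {const (ev Q (- b)) ⊕ lin b ⊗ quo b Q} (division b Q)))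
      (≡⇒≈ (trans (ev-⊕ (const (ev Q (- b))) (lin b ⊗ quo b Q) (- a))
        (cong₂ _+_ (trans (cong (λ z → ev Q (- b) + z) (ℤₚ.*-zeroʳ (- a))) (ℤₚ.+-identityʳ (ev Q (- b))))
          (trans (ev-⊗ (lin b) (quo b Q) (- a)) (cong (λ z → z * ev (quo b Q) (- a)) (ev-lin b (- a)))))))

    -- This functional turns repeated division by `lin b` into a recursion for `τ`. On `φ`, which
    -- vanishes at all nodes except `b`, it is zero for positive exponents, and this starts the
    -- recursion.
    Λ : Poly → ℕ → ℤ
    Λ Q i = wsum ws (λ a → (a - b) ^ i * ev Q (- a))

    Λ-step : ∀ Q i → Λ Q i ≈ ev Q (- b) * τ i - Λ (quo b Q) (suc i)
    Λ-step Q i = begin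
      Λ Q i
        ≈⟨ wsum-cong ws (All.universal (λ a → *-congˡ ((a - b) ^ i) (ev-division Q a)) as) ⟩
      wsum ws (λ a → (a - b) ^ i * (ev Q (- b) + (b - a) * ev (quo b Q) (- a)))
        ≡⟨ wsum-ext ws (λ a → lemma a b ((a - b) ^ i) (ev Q (- b)) (ev (quo b Q) (- a))) ⟩
      wsum ws (λ a → ev Q (- b) * (a - b) ^ i + - 1ℤ * ((a - b) ^ suc i * ev (quo b Q) (- a)))
        ≡⟨ wsum-+ ws (λ a → ev Q (- b) * (a - b) ^ i) (λ a → - 1ℤ * ((a - b) ^ suc i * ev (quo b Q) (- a))) ⟩
      wsum ws (λ a → ev Q (- b) * (a - b) ^ i) + wsum ws (λ a → - 1ℤ * ((a - b) ^ suc i * ev (quo b Q) (- a)))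
        ≡⟨ cong₂ _+_ (wsum-* ws (ev Q (- b)) (λ a → (a - b) ^ i))
             (trans (wsum-* ws (- 1ℤ) (λ a → (a - b) ^ suc i * ev (quo b Q) (- a))) (ℤₚ.-1*i≡-i (Λ (quo b Q) (suc i)))) ⟩
      ev Q (- b) * τ i - Λ (quo b Q) (suc i) ∎
      where
      open SetoidReasoning ≈-setoid
      lemma : ∀ a b y c x → y * (c + (b - a) * x) ≡ c * y + - 1ℤ * ((a - b) * y * x)
      lemma = solve-∀

    -- On the nodes `(a - b) ^ d` is 1, except at `b`, where it is 0. So `Λ Q d` is the divided
    -- difference of `Q`, which is zero, minus the term at `b`; the weight of `b` is minus `τ d`,
    -- because all weights sum to zero.
    Λ-top : ∀ Q → Deg< Q k → Λ Q d ≈ ev Q (- b) * τ d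
    Λ-top Q δ = begin
      Λ Q d
        ≈⟨ wsum-cong ws (All.tabulate pointwise) ⟩
      wsum ws (λ a → ev Q (- a) + (c * (a - b) ^ d + - c * 1ℤ))
        ≡⟨ wsum-+ ws (λ a → ev Q (- a)) (λ a → c * (a - b) ^ d + - c * 1ℤ) ⟩
      wsum ws (λ a → ev Q (- a)) + wsum ws (λ a → c * (a - b) ^ d + - c * 1ℤ)
        ≡⟨ cong (λ z → wsum ws (λ a → ev Q (- a)) + z) (trans (wsum-+ ws (λ a → c * (a - b) ^ d) (λ _ → - c * 1ℤ))
             (cong₂ _+_ (wsum-* ws c (λ a → (a - b) ^ d)) (wsum-* ws (- c) (λ _ → 1ℤ)))) ⟩
      wsum ws (λ a → ev Q (- a)) + (c * τ d + - c * wsum ws (_^ 0))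
        ≈⟨ +-cong (kills-low-degree dd Q δ) (+-cong (≈-refl {c * τ d}) (*-zeroʳ′ (- c) (low 0 k>0))) ⟩
      0ℤ + (c * τ d + 0ℤ)
        ≡⟨ trans (ℤₚ.+-identityˡ (c * τ d + 0ℤ)) (ℤₚ.+-identityʳ (c * τ d)) ⟩
      c * τ d ∎
      where
      open SetoidReasoning ≈-setoid
      c = ev Q (- b)
      case₀ : ∀ x y c → x * y - (y + (c * x + - c * 1ℤ)) ≡ (y - c) * (x - 0ℤ) + - 1ℤ * (y - c)
      case₀ = solve-∀
      case₁ : ∀ x y c → x * y - (y + (c * x + - c * 1ℤ)) ≡ (y - c) * (x - 1ℤ)
      case₁ = solve-∀
      pointwise : ∀ {a} → a ∈ as → (a - b) ^ d * ev Q (- a) ≈ ev Q (- a) + (c * (a - b) ^ d + - c * 1ℤ)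
      pointwise {a} a∈ with differences a∈ b∈as
      ... | inj₁ a≈b  = combine₂ (ev Q (- a) - c) (- 1ℤ) (≈0^ (3 +ⁿ e) (≈⇒-≈0 a≈b)) (ev-congʳ Q (-‿cong a≈b))
                          (case₀ ((a - b) ^ d) (ev Q (- a)) c)
      ... | inj₂ unit = combine₁ (ev Q (- a) - c) unit (case₁ ((a - b) ^ d) (ev Q (- a)) c)

    Λ-φ : ∀ i → Λ φ (suc i) ≈ 0ℤ
    Λ-φ i = wsum-≈0 ws (All.tabulate λ {a} a∈ →
      combine₁ (- ((a - b) ^ i)) (φ-root a∈) (lemma a b ((a - b) ^ i) (ev φ (- a))))
      where
      lemma : ∀ a b y x → (a - b) * y * x - 0ℤ ≡ - y * ((b - a) * x - 0ℤ)
      lemma = solve-∀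

    φ₀ φ₁ φ₂ φ₃ γ₀ γ₁ γ₂ γ₃ τ₀ τ₁ τ₂ τ₃ : ℤ
    φ₀ = digit b 0 φ
    φ₁ = digit b 1 φ
    φ₂ = digit b 2 φ
    φ₃ = digit b 3 φ
    γ₀ = digit b 0 G
    γ₁ = digit b 1 G
    γ₂ = digit b 2 G
    γ₃ = digit b 3 G
    -- Indices run against exponents, to match the digits of `G`: digit i involves the power sum
    -- with exponent d - i.
    τ₀ = τ (4 +ⁿ e)
    τ₁ = τ (3 +ⁿ e)
    τ₂ = τ (2 +ⁿ e)
    τ₃ = τ (1 +ⁿ e)

    quo-Deg< : ∀ {P} → Deg< P k → Deg< (quo b P) k
    quo-Deg< {P} δ = Deg<-quo b {P} (Deg<-mono {P} (ℕₚ.n≤1+n k) δ)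

    Λ₁ : Λ (quos b 1 φ) d ≈ φ₁ * τ₀
    Λ₁ = Λ-top (quos b 1 φ) (Deg<-quo b {φ} φ-Deg<)

    Λ₂ : Λ (quos b 2 φ) d ≈ φ₂ * τ₀
    Λ₂ = Λ-top (quos b 2 φ) (quo-Deg< {quos b 1 φ} (Deg<-quo b {φ} φ-Deg<))

    Λ₃ : Λ (quos b 3 φ) d ≈ φ₃ * τ₀
    Λ₃ = Λ-top (quos b 3 φ) (quo-Deg< {quos b 2 φ} (quo-Deg< {quos b 1 φ} (Deg<-quo b {φ} φ-Deg<)))

    -- In each of `t₁`, `t₂`, `t₃`, `Λ-step` raises the exponent until it reaches d, where `Λ-top`
    -- ends the recursion.
    t₁ : φ₀ * τ₁ ≈ φ₁ * τ₀
    t₁ = combine₃ (- 1ℤ) 1ℤ 1ℤ (Λ-step φ (3 +ⁿ e)) (Λ-φ (2 +ⁿ e)) Λ₁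
      (lemma (φ₀ * τ₁) (φ₁ * τ₀) (Λ φ (3 +ⁿ e)) (Λ (quos b 1 φ) d))
      where
      lemma : ∀ x y u v → x - y ≡ - 1ℤ * (u - (x - v)) + 1ℤ * (u - 0ℤ) + 1ℤ * (v - y)
      lemma = solve-∀

    t₂ : φ₀ * τ₂ ≈ φ₁ * τ₁ - φ₂ * τ₀
    t₂ = combine₄ (- 1ℤ) 1ℤ 1ℤ (- 1ℤ) (Λ-step φ (2 +ⁿ e)) (Λ-φ (1 +ⁿ e)) (Λ-step (quos b 1 φ) (3 +ⁿ e)) Λ₂
      (lemma (φ₀ * τ₂) (φ₁ * τ₁) (φ₂ * τ₀) (Λ φ (2 +ⁿ e)) (Λ (quos b 1 φ) (3 +ⁿ e)) (Λ (quos b 2 φ) d))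
      where
      lemma : ∀ x y z u v w → x - (y - z) ≡
        - 1ℤ * (u - (x - v)) + 1ℤ * (u - 0ℤ) + 1ℤ * (v - (y - w)) + - 1ℤ * (w - z)
      lemma = solve-∀

    t₃ : φ₀ * τ₃ ≈ φ₁ * τ₂ - φ₂ * τ₁ + φ₃ * τ₀
    t₃ = ≈-trans
      (combine₃ (- 1ℤ) 1ℤ 1ℤ (Λ-step φ (1 +ⁿ e)) (Λ-φ e) (Λ-step (quos b 1 φ) (2 +ⁿ e))
        (lemma₁ (φ₀ * τ₃) (φ₁ * τ₂) (Λ φ (1 +ⁿ e)) (Λ (quos b 1 φ) (2 +ⁿ e)) (Λ (quos b 2 φ) (3 +ⁿ e))))
      (combine₂ (- 1ℤ) 1ℤ (Λ-step (quos b 2 φ) (3 +ⁿ e)) Λ₃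
        (lemma₂ (φ₁ * τ₂) (φ₂ * τ₁) (φ₃ * τ₀) (Λ (quos b 2 φ) (3 +ⁿ e)) (Λ (quos b 3 φ) d)))
      where
      lemma₁ : ∀ x y u v w → x - (y - w) ≡ - 1ℤ * (u - (x - v)) + 1ℤ * (u - 0ℤ) + 1ℤ * (v - (y - w))
      lemma₁ = solve-∀
      lemma₂ : ∀ y z t w s → y - w - (y - z + t) ≡ - 1ℤ * (w - (z - s)) + 1ℤ * (s - t)
      lemma₂ = solve-∀

    K₁ K₂ : ℤ
    K₁ = + (k !)
    K₂ = + rising d k

    h₀ : K₁ * γ₀ ≈ K₂ * τ₀
    h₀ = G-digit 0 d refl

    -- The factors d and d - 1 are written through d = (1 + κ) κ, so that the elimination sees
    -- polynomials in κ alone.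
    h₂ : (+ 2 + κ) * ((1ℤ + κ) * K₁) * γ₂ ≈ ((1ℤ + κ) * κ - 1ℤ) * ((1ℤ + κ) * κ * K₂) * τ₂
    h₂ = via
      (cong (_* γ₂) (sym (trans (ℤₚ.pos-* (2 +ⁿ k) (suc k !)) (cong (λ z → + (2 +ⁿ k) * z) (ℤₚ.pos-* (suc k) (k !))))))
      (cong (_* τ₂) (sym (trans (ℤₚ.pos-* (3 +ⁿ e) (d *ⁿ rising d k))
        (cong₂ _*_ (cong (_- 1ℤ) d≡[1+κ]κ) (trans (ℤₚ.pos-* d (rising d k)) (cong (_* K₂) d≡[1+κ]κ))))))
      (G-digit 2 (2 +ⁿ e) refl)

    h₃ : (+ 3 + κ) * ((+ 2 + κ) * ((1ℤ + κ) * K₁)) * γ₃ ≈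
         ((1ℤ + κ) * κ - + 2) * (((1ℤ + κ) * κ - 1ℤ) * ((1ℤ + κ) * κ * K₂)) * τ₃
    h₃ = via
      (cong (_* γ₃) (sym (trans (ℤₚ.pos-* (3 +ⁿ k) ((2 +ⁿ k) !)) (cong (λ z → + (3 +ⁿ k) * z)
        (trans (ℤₚ.pos-* (2 +ⁿ k) (suc k !)) (cong (λ z → + (2 +ⁿ k) * z) (ℤₚ.pos-* (suc k) (k !))))))))
      (cong (_* τ₃) (sym (trans (ℤₚ.pos-* (2 +ⁿ e) ((3 +ⁿ e) *ⁿ (d *ⁿ rising d k)))
        (cong₂ _*_ (cong (_- + 2) d≡[1+κ]κ) (trans (ℤₚ.pos-* (3 +ⁿ e) (d *ⁿ rising d k))
          (cong₂ _*_ (cong (_- 1ℤ) d≡[1+κ]κ) (trans (ℤₚ.pos-* d (rising d k)) (cong (_* K₂) d≡[1+κ]κ))))))))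
      (G-digit 3 (1 +ⁿ e) refl)

    r : ℤ
    r = - b

    ev-D¹ : ∀ P → ev (D P) r ≈ digit b 1 P
    ev-D¹ P = ≈-trans (ev-Ds 1 b P) (≡⇒≈ (ℤₚ.*-identityˡ (digit b 1 P)))

    -- Its value at the root and those of its first two derivatives are `o₁`, `o₂` and `o₃`; their
    -- numerical constants are the factorials in `ev-Ds` times Leibniz coefficients.
    ode : φ ⊗ D G ≋ κ • (D φ ⊗ G)
    ode = begin
      φ ⊗ D G                        ≈⟨ ⊗-congˡ φ (≋-trans (D-cong G≋Cφ^k) (D-• C (φ ^ᵖ k))) ⟩
      φ ⊗ (C • D (φ ^ᵖ k))           ≈⟨ ⊗-• C φ (D (φ ^ᵖ k)) ⟩
      C • (φ ⊗ D (φ ^ᵖ k))           ≈⟨ •-congˡ C (power-ode φ k) ⟩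
      C • κ • (D φ ⊗ φ ^ᵖ k)         ≈⟨ •-• C κ (D φ ⊗ φ ^ᵖ k) ⟩
      (C * κ) • (D φ ⊗ φ ^ᵖ k)       ≈⟨ •-cong (≡⇒≈ (ℤₚ.*-comm C κ)) (≋-refl {D φ ⊗ φ ^ᵖ k}) ⟩
      (κ * C) • (D φ ⊗ φ ^ᵖ k)       ≈⟨ •-• κ C (D φ ⊗ φ ^ᵖ k) ⟨
      κ • C • (D φ ⊗ φ ^ᵖ k)         ≈⟨ •-congˡ κ (⊗-• C (D φ) (φ ^ᵖ k)) ⟨
      κ • (D φ ⊗ (C • φ ^ᵖ k))       ≈⟨ •-congˡ κ (⊗-congˡ (D φ) G≋Cφ^k) ⟨
      κ • (D φ ⊗ G)                  ∎
      where open ≋-Reasoning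

    o₁ : φ₀ * γ₁ ≈ κ * (φ₁ * γ₀)
    o₁ = begin
      φ₀ * γ₁                        ≈⟨ *-congˡ φ₀ (ev-D¹ G) ⟨
      ev φ r * ev (D G) r            ≡⟨ ev-⊗ φ (D G) r ⟨
      ev (φ ⊗ D G) r                 ≈⟨ ev-cong r ode ⟩
      ev (κ • (D φ ⊗ G)) r           ≡⟨ ev-• κ (D φ ⊗ G) r ⟩
      κ * ev (D φ ⊗ G) r             ≡⟨ cong (λ z → κ * z) (ev-⊗ (D φ) G r) ⟩
      κ * (ev (D φ) r * ev G r)      ≈⟨ *-congˡ κ (*-cong (ev-D¹ φ) (≈-refl {γ₀})) ⟩
      κ * (φ₁ * γ₀)                  ∎
      where open SetoidReasoning ≈-setoid

    o₂ : + 2 * (φ₀ * γ₂) + φ₁ * γ₁ ≈ κ * (+ 2 * (φ₂ * γ₀) + φ₁ * γ₁)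
    o₂ = begin
      + 2 * (φ₀ * γ₂) + φ₁ * γ₁
        ≡⟨ swap φ₀ γ₂ (φ₁ * γ₁) ⟩
      φ₁ * γ₁ + φ₀ * (+ 2 * γ₂)
        ≈⟨ +-cong (*-cong (ev-D¹ φ) (ev-D¹ G)) (*-congˡ φ₀ (ev-Ds 2 b G)) ⟨
      ev (D φ) r * ev (D G) r + ev φ r * ev (D (D G)) r
        ≈⟨ ev-D-⊗ φ (D G) r ⟨
      ev (D (φ ⊗ D G)) r
        ≈⟨ ev-cong r (≋-trans (D-cong ode) (D-• κ (D φ ⊗ G))) ⟩
      ev (κ • D (D φ ⊗ G)) r
        ≡⟨ ev-• κ (D (D φ ⊗ G)) r ⟩
      κ * ev (D (D φ ⊗ G)) r
        ≈⟨ *-congˡ κ (ev-D-⊗ (D φ) G r) ⟩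
      κ * (ev (D (D φ)) r * ev G r + ev (D φ) r * ev (D G) r)
        ≈⟨ *-congˡ κ (+-cong (*-cong (ev-Ds 2 b φ) (≈-refl {γ₀})) (*-cong (ev-D¹ φ) (ev-D¹ G))) ⟩
      κ * (+ 2 * φ₂ * γ₀ + φ₁ * γ₁)
        ≡⟨ cong (λ z → κ * (z + φ₁ * γ₁)) (ℤₚ.*-assoc (+ 2) φ₂ γ₀) ⟩
      κ * (+ 2 * (φ₂ * γ₀) + φ₁ * γ₁) ∎
      where
      open SetoidReasoning ≈-setoid
      swap : ∀ x y z → + 2 * (x * y) + z ≡ z + x * (+ 2 * y)
      swap = solve-∀

    o₃ : + 6 * (φ₀ * γ₃) + + 4 * (φ₁ * γ₂) + + 2 * (φ₂ * γ₁) ≈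
         κ * (+ 6 * (φ₃ * γ₀) + + 4 * (φ₂ * γ₁) + + 2 * (φ₁ * γ₂))
    o₃ = begin
      + 6 * (φ₀ * γ₃) + + 4 * (φ₁ * γ₂) + + 2 * (φ₂ * γ₁)
        ≡⟨ left φ₀ φ₁ φ₂ γ₁ γ₂ γ₃ ⟩
      + 2 * φ₂ * γ₁ + + 2 * (φ₁ * (+ 2 * γ₂)) + φ₀ * (+ 6 * γ₃)
        ≈⟨ +-cong (+-cong (*-cong (ev-Ds 2 b φ) (ev-D¹ G)) (*-congˡ (+ 2) (*-cong (ev-D¹ φ) (ev-Ds 2 b G)))) (*-congˡ φ₀ (ev-Ds 3 b G)) ⟨
      ev (D (D φ)) r * ev (D G) r + + 2 * (ev (D φ) r * ev (D (D G)) r) + ev φ r * ev (D (D (D G))) r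
        ≈⟨ ev-D²-⊗ φ (D G) r ⟨
      ev (D (D (φ ⊗ D G))) r
        ≈⟨ ev-cong r (≋-trans (D-cong (D-cong ode)) (Ds-• 2 κ (D φ ⊗ G))) ⟩
      ev (κ • D (D (D φ ⊗ G))) r
        ≡⟨ ev-• κ (D (D (D φ ⊗ G))) r ⟩
      κ * ev (D (D (D φ ⊗ G))) r
        ≈⟨ *-congˡ κ (ev-D²-⊗ (D φ) G r) ⟩
      κ * (ev (D (D (D φ))) r * ev G r + + 2 * (ev (D (D φ)) r * ev (D G) r) + ev (D φ) r * ev (D (D G)) r)
        ≈⟨ *-congˡ κ (+-cong (+-cong (*-cong (ev-Ds 3 b φ) (≈-refl {γ₀})) (*-congˡ (+ 2) (*-cong (ev-Ds 2 b φ) (ev-D¹ G)))) (*-cong (ev-D¹ φ) (ev-Ds 2 b G))) ⟩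
      κ * (+ 6 * φ₃ * γ₀ + + 2 * (+ 2 * φ₂ * γ₁) + φ₁ * (+ 2 * γ₂))
        ≡⟨ right κ φ₁ φ₂ φ₃ γ₀ γ₁ γ₂ ⟩
      κ * (+ 6 * (φ₃ * γ₀) + + 4 * (φ₂ * γ₁) + + 2 * (φ₁ * γ₂)) ∎
      where
      open SetoidReasoning ≈-setoid
      left : ∀ φ₀ φ₁ φ₂ γ₁ γ₂ γ₃ → + 6 * (φ₀ * γ₃) + + 4 * (φ₁ * γ₂) + + 2 * (φ₂ * γ₁) ≡
        + 2 * φ₂ * γ₁ + + 2 * (φ₁ * (+ 2 * γ₂)) + φ₀ * (+ 6 * γ₃)
      left = solve-∀
      right : ∀ κ φ₁ φ₂ φ₃ γ₀ γ₁ γ₂ → κ * (+ 6 * φ₃ * γ₀ + + 2 * (+ 2 * φ₂ * γ₁) + φ₁ * (+ 2 * γ₂)) ≡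
        κ * (+ 6 * (φ₃ * γ₀) + + 4 * (φ₂ * γ₁) + + 2 * (φ₁ * γ₂))
      right = solve-∀

    K₁γ₀≉0 : K₁ * γ₀ ≉ 0ℤ
    K₁γ₀≉0 = *-≉0 (!-≉0 k (ℕₚ.≤-<-trans (ℕₚ.m≤m+n k d) N<p)) λ γ₀≈0 →
      *-≉0 C≉0 (^-≉0 k φ₀≉0) (≈-trans (≈-sym γ₀≈) γ₀≈0)
      where
      γ₀≈ : γ₀ ≈ C * φ₀ ^ k
      γ₀≈ = ≈-trans (ev-cong r G≋Cφ^k)
        (≡⇒≈ (trans (ev-• C (φ ^ᵖ k) r) (cong (λ z → C * z) (ev-^ᵖ φ k r))))

    private
      module E = LocalElimination p p-prime κ K₁ K₂ φ₀ φ₁ φ₂ φ₃ γ₀ γ₁ γ₂ γ₃ τ₀ τ₁ τ₂ τ₃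

    second-order : + 2 * (1ℤ + κ) * (φ₀ * φ₂) ≈ κ * (φ₁ * φ₁)
    second-order = E.second-order h₀ o₁ t₁ h₂ o₂ t₂ φ₀≉0 K₁γ₀≉0 κ≉0 1+κ≉0

    third-order : + 3 * (1ℤ + κ) * (φ₀ * φ₃) ≈ (κ - 1ℤ) * (φ₁ * φ₂)
    third-order = E.third-order h₀ o₁ t₁ h₂ o₂ t₂ φ₀≉0 K₁γ₀≉0 κ≉0 1+κ≉0 h₃ o₃ t₃ 2≉0 2+κ≉0 κ-2≉0

  -- The fourth transvectant.

  c₁ c₂ c₃ : ℤ
  c₁ = (1ℤ + κ) * (+ 2 + κ)
  c₂ = - (+ 4 * ((1ℤ + κ) * (κ - 1ℤ)))
  c₃ = + 3 * (κ * (κ - 1ℤ))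

  -- The fourth transvectant of f, regarded as a binary form of degree k + 2 with one more root at
  -- infinity.
  T : Poly
  T = c₁ • (f ⊗ Ds 4 f) ⊕ (c₂ • (Ds 1 f ⊗ Ds 3 f) ⊕ c₃ • (Ds 2 f ⊗ Ds 2 f))

  -- At the root, T and its derivative are multiples of the second-order and the third-order
  -- relation. The factor f removes the fourth derivative from the former and the fifth from the
  -- latter, so nothing beyond φ₃ enters.
  T-double-root : ∀ {b} → b ∈ as → b ^ 2 ∥ T
  T-double-root {b} b∈ = quos b 2 T , digits≈0⇒factor b 2 T λ
    { zero _ → T₀ ; (suc zero) _ → T₁ ; (suc (suc _)) (s≤s (s≤s ())) }
    where
    open LocalExpansion b∈
    x : ℕ → ℤ
    x j = ev (Ds j f) r
    -- Digit j + 1 of `f` is digit j of `φ` by definition of `quos`, so the j-th derivative of `f`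
    -- is j! times φ with index j - 1.
    x₁≈ : x 1 ≈ φ₀
    x₁≈ = ev-D¹ f
    x₂≈ : x 2 ≈ + 2 * φ₁
    x₂≈ = ev-Ds 2 b f
    x₃≈ : x 3 ≈ + 6 * φ₂
    x₃≈ = ev-Ds 3 b f
    x₄≈ : x 4 ≈ + 24 * φ₃
    x₄≈ = ev-Ds 4 b f
    ev-scaled : ∀ c P Q → ev (c • (P ⊗ Q)) r ≡ c * (ev P r * ev Q r)
    ev-scaled c P Q = trans (ev-• c (P ⊗ Q) r) (cong (λ z → c * z) (ev-⊗ P Q r))
    ev-scaled-D : ∀ c P Q → ev (D (c • (P ⊗ Q))) r ≈ c * (ev (D P) r * ev Q r + ev P r * ev (D Q) r)
    ev-scaled-D c P Q = ≈-trans (ev-cong r (D-• c (P ⊗ Q)))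
      (≈-trans (≡⇒≈ (ev-• c (D (P ⊗ Q)) r)) (*-congˡ c (ev-D-⊗ P Q r)))
    U₁ U₂ U₃ : Poly
    U₁ = c₁ • (f ⊗ Ds 4 f)
    U₂ = c₂ • (Ds 1 f ⊗ Ds 3 f)
    U₃ = c₃ • (Ds 2 f ⊗ Ds 2 f)
    identity₀ : ∀ κ φ₀ φ₁ φ₂ y →
      (1ℤ + κ) * (+ 2 + κ) * (0ℤ * y) + (- (+ 4 * ((1ℤ + κ) * (κ - 1ℤ))) * (φ₀ * (+ 6 * φ₂))
        + + 3 * (κ * (κ - 1ℤ)) * (+ 2 * φ₁ * (+ 2 * φ₁))) - 0ℤ ≡
      - (+ 12 * (κ - 1ℤ)) * (+ 2 * (1ℤ + κ) * (φ₀ * φ₂) - κ * (φ₁ * φ₁))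
    identity₀ = solve-∀
    T₀ : ev T r ≈ 0ℤ
    T₀ = begin
      ev T r
        ≡⟨ trans (ev-⊕ U₁ (U₂ ⊕ U₃) r) (cong (λ z → ev U₁ r + z) (ev-⊕ U₂ U₃ r)) ⟩
      ev U₁ r + (ev U₂ r + ev U₃ r)
        ≡⟨ cong₂ _+_ (ev-scaled c₁ f (Ds 4 f)) (cong₂ _+_ (ev-scaled c₂ (Ds 1 f) (Ds 3 f)) (ev-scaled c₃ (Ds 2 f) (Ds 2 f))) ⟩
      c₁ * (x 0 * x 4) + (c₂ * (x 1 * x 3) + c₃ * (x 2 * x 2))
        ≈⟨ +-cong (*-congˡ c₁ (*-cong (f-root b∈) (≈-refl {x 4})))
             (+-cong (*-congˡ c₂ (*-cong x₁≈ x₃≈)) (*-congˡ c₃ (*-cong x₂≈ x₂≈))) ⟩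
      c₁ * (0ℤ * x 4) + (c₂ * (φ₀ * (+ 6 * φ₂)) + c₃ * (+ 2 * φ₁ * (+ 2 * φ₁)))
        ≈⟨ combine₁ (- (+ 12 * (κ - 1ℤ))) second-order (identity₀ κ φ₀ φ₁ φ₂ (x 4)) ⟩
      0ℤ ∎
      where open SetoidReasoning ≈-setoid
    identity₁ : ∀ κ φ₀ φ₁ φ₂ φ₃ y →
      (1ℤ + κ) * (+ 2 + κ) * (φ₀ * (+ 24 * φ₃) + 0ℤ * y)
        + (- (+ 4 * ((1ℤ + κ) * (κ - 1ℤ))) * (+ 2 * φ₁ * (+ 6 * φ₂) + φ₀ * (+ 24 * φ₃))
        + + 3 * (κ * (κ - 1ℤ)) * (+ 6 * φ₂ * (+ 2 * φ₁) + + 2 * φ₁ * (+ 6 * φ₂))) - 0ℤ ≡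
      - (+ 24 * (κ - + 2)) * (+ 3 * (1ℤ + κ) * (φ₀ * φ₃) - (κ - 1ℤ) * (φ₁ * φ₂))
    identity₁ = solve-∀
    T₁ : digit b 1 T ≈ 0ℤ
    T₁ = begin
      digit b 1 T
        ≈⟨ ev-D¹ T ⟨
      ev (D T) r
        ≈⟨ ev-cong r (≋-trans (D-⊕ U₁ (U₂ ⊕ U₃)) (⊕-cong (≋-refl {D U₁}) (D-⊕ U₂ U₃))) ⟩
      ev (D U₁ ⊕ (D U₂ ⊕ D U₃)) r
        ≡⟨ trans (ev-⊕ (D U₁) (D U₂ ⊕ D U₃) r) (cong (λ z → ev (D U₁) r + z) (ev-⊕ (D U₂) (D U₃) r)) ⟩
      ev (D U₁) r + (ev (D U₂) r + ev (D U₃) r)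
        ≈⟨ +-cong (ev-scaled-D c₁ f (Ds 4 f)) (+-cong (ev-scaled-D c₂ (Ds 1 f) (Ds 3 f)) (ev-scaled-D c₃ (Ds 2 f) (Ds 2 f))) ⟩
      c₁ * (x 1 * x 4 + x 0 * x 5) + (c₂ * (x 2 * x 3 + x 1 * x 4) + c₃ * (x 3 * x 2 + x 2 * x 3))
        ≈⟨ +-cong (*-congˡ c₁ (+-cong (*-cong x₁≈ x₄≈) (*-cong (f-root b∈) (≈-refl {x 5}))))
             (+-cong (*-congˡ c₂ (+-cong (*-cong x₂≈ x₃≈) (*-cong x₁≈ x₄≈)))
                     (*-congˡ c₃ (+-cong (*-cong x₃≈ x₂≈) (*-cong x₂≈ x₃≈)))) ⟩
      c₁ * (φ₀ * (+ 24 * φ₃) + 0ℤ * x 5) + (c₂ * (+ 2 * φ₁ * (+ 6 * φ₂) + φ₀ * (+ 24 * φ₃))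
        + c₃ * (+ 6 * φ₂ * (+ 2 * φ₁) + + 2 * φ₁ * (+ 6 * φ₂)))
        ≈⟨ combine₁ (- (+ 24 * (κ - + 2))) third-order (identity₁ κ φ₀ φ₁ φ₂ φ₃ (x 5)) ⟩
      0ℤ ∎
      where open SetoidReasoning ≈-setoid

  Ds-f-Deg< : ∀ j → Deg< (Ds (suc j) f) (suc k)
  Ds-f-Deg< zero    = Deg<-D {f} (bound f-monic)
  Ds-f-Deg< (suc j) = Deg<-D {Ds (suc j) f} (Deg<-mono {Ds (suc j) f} (ℕₚ.n≤1+n (suc k)) (Ds-f-Deg< j))

  T≋[] : T ≋ []
  T≋[] = too-many-roots 2 T distinct (All.tabulate T-double-root)
    (subst (Deg< T) (sym (trans (cong (_*ⁿ 2) |ws|≡k+1) (double (suc k)))) degree)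
    where
    double : ∀ n → n *ⁿ 2 ≡ n +ⁿ n
    double = ℕ-solve-∀
    below : suc k +ⁿ k ≤ⁿ suc k +ⁿ suc k
    below = ℕₚ.+-monoʳ-≤ (suc k) (ℕₚ.n≤1+n k)
    product : ∀ i j → Deg< (Ds (suc i) f ⊗ Ds (suc j) f) (suc k +ⁿ suc k)
    product i j = Deg<-mono {Ds (suc i) f ⊗ Ds (suc j) f} below
      (Deg<-⊗ {Ds (suc i) f} {Ds (suc j) f} (Ds-f-Deg< i) (Ds-f-Deg< j))
    degree : Deg< T (suc k +ⁿ suc k)
    degree = Deg<-⊕ {c₁ • (f ⊗ Ds 4 f)}
      (Deg<-• {f ⊗ Ds 4 f} c₁ (Deg<-resp (⊗-comm (Ds 4 f) f)
        (Deg<-⊗ {Ds 4 f} {f} (Ds-f-Deg< 3) (bound f-monic))))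
      (Deg<-⊕ {c₂ • (Ds 1 f ⊗ Ds 3 f)} (Deg<-• {Ds 1 f ⊗ Ds 3 f} c₂ (product 0 2))
        (Deg<-• {Ds 2 f ⊗ Ds 2 f} c₃ (product 1 1)))

  -- The first nonzero coefficient below the top of f.

  open TopCoefficients p
  open ExceptionalSizes p p-prime

  -- The fourth power of x multiplying T is shared between the two factors of each term, so that
  -- every factor is a diagonal operator applied to `f` and inherits its gap.
  Θ : ℕ → Poly
  Θ j = raise j (Ds j f)

  raise-[] : ∀ a → raise a [] ≋ []
  raise-[] zero    = ≋-refl
  raise-[] (suc a) = coefwise λ { zero → ≈-refl ; (suc i) → at (raise-[] a) i }

  homogeneous : c₁ • (Θ 0 ⊗ Θ 4) ⊕ (c₂ • (Θ 1 ⊗ Θ 3) ⊕ c₃ • (Θ 2 ⊗ Θ 2)) ≋ []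
  homogeneous = begin
    c₁ • (Θ 0 ⊗ Θ 4) ⊕ (c₂ • (Θ 1 ⊗ Θ 3) ⊕ c₃ • (Θ 2 ⊗ Θ 2))
      ≈⟨ ⊕-cong (scaled c₁ 0 4) (⊕-cong (scaled c₂ 1 3) (scaled c₃ 2 2)) ⟩
    raise 4 (c₁ • (f ⊗ Ds 4 f)) ⊕ (raise 4 (c₂ • (Ds 1 f ⊗ Ds 3 f)) ⊕ raise 4 (c₃ • (Ds 2 f ⊗ Ds 2 f)))
      ≈⟨ raise-⊕ 4 (c₁ • (f ⊗ Ds 4 f)) (c₂ • (Ds 1 f ⊗ Ds 3 f) ⊕ c₃ • (Ds 2 f ⊗ Ds 2 f)) ⟨
    raise 4 T
      ≈⟨ raise-cong 4 T≋[] ⟩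
    raise 4 []
      ≈⟨ raise-[] 4 ⟩
    [] ∎
    where
    open ≋-Reasoning
    scaled : ∀ c i j → c • (Θ i ⊗ Θ j) ≋ raise i (raise j (c • (Ds i f ⊗ Ds j f)))
    scaled c i j = ≋-trans
      (•-congˡ c (≋-trans (raise-⊗ i (Ds i f) (Θ j)) (raise-cong i (⊗-raise j (Ds i f) (Ds j f)))))
      (≋-sym (≋-trans (raise-cong i (raise-• j c (Ds i f ⊗ Ds j f))) (raise-• i c (raise j (Ds i f ⊗ Ds j f)))))

  -- `ε` stands `suc m` places below the top; this `m` is thus one less than the m of the formula
  -- for the leading term.
  module FirstCoefficient (m s : ℕ) (m+s≡k : m +ⁿ s ≡ k) (gap : Gap f (suc m) s) where

    n : ℕ
    n = suc m +ⁿ s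

    ε : ℤ
    ε = coef f s

    f-top : coef f n ≈ 1ℤ
    f-top = subst (λ i → coef f i ≈ 1ℤ) (cong suc (sym m+s≡k)) (leading f-monic)

    Θ-gap : ∀ j → Gap (Θ j) (suc m) s
    Θ-gap j i s<i i≢ = ≈-trans (≡⇒≈ (coef-raise-Ds j f i)) (*-zeroʳ′ (falling j (+ i)) (gap i s<i i≢))

    Θ-top : ∀ j → coef (Θ j) n ≈ falling j (+ n)
    Θ-top j = ≈-trans (≡⇒≈ (coef-raise-Ds j f n))
      (≈-trans (*-congˡ (falling j (+ n)) f-top) (≡⇒≈ (ℤₚ.*-identityʳ (falling j (+ n)))))

    pairing : ∀ i j → coef (Θ i ⊗ Θ j) (n +ⁿ s) ≈
              falling i (+ n) * (falling j (+ s) * ε) + falling j (+ n) * (falling i (+ s) * ε)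
    pairing i j = ≈-trans (product-next (Θ i) (Θ j) m s s (Θ-gap i) (Θ-gap j))
      (+-cong (*-cong (Θ-top i) (≡⇒≈ (coef-raise-Ds j f s))) (*-cong (Θ-top j) (≡⇒≈ (coef-raise-Ds i f s))))

    -- The factor `+ m` is unavoidable: the equation T = 0 is invariant under translations of x,
    -- which change the coefficient of degree k freely. That coefficient is normalised by centring
    -- the nodes.
    indicial : ℤ
    indicial = (1ℤ + κ) * ((1ℤ + + m) * (+ m * ((+ 2 + + m) * ((+ 2 + κ) * (1ℤ + + m) - + 6 * κ))))

    indicial-equation : indicial * ε ≈ 0ℤ
    indicial-equation = begin
      indicial * ε
        ≡⟨ identity (+ m) (+ s) κ ε (cong +_ (sym m+s≡k)) ⟨
      c₁ * (pair 0 4) + (c₂ * (pair 1 3) + c₃ * (pair 2 2))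
        ≈⟨ +-cong (*-congˡ c₁ (pairing 0 4)) (+-cong (*-congˡ c₂ (pairing 1 3)) (*-congˡ c₃ (pairing 2 2))) ⟨
      c₁ * coef (Θ 0 ⊗ Θ 4) i + (c₂ * coef (Θ 1 ⊗ Θ 3) i + c₃ * coef (Θ 2 ⊗ Θ 2) i)
        ≡⟨ cong₂ _+_ (coef-• c₁ (Θ 0 ⊗ Θ 4) i) (trans (coef-⊕ (c₂ • (Θ 1 ⊗ Θ 3)) (c₃ • (Θ 2 ⊗ Θ 2)) i)
             (cong₂ _+_ (coef-• c₂ (Θ 1 ⊗ Θ 3) i) (coef-• c₃ (Θ 2 ⊗ Θ 2) i))) ⟨
      coef (c₁ • (Θ 0 ⊗ Θ 4)) i + coef (c₂ • (Θ 1 ⊗ Θ 3) ⊕ c₃ • (Θ 2 ⊗ Θ 2)) i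
        ≡⟨ coef-⊕ (c₁ • (Θ 0 ⊗ Θ 4)) (c₂ • (Θ 1 ⊗ Θ 3) ⊕ c₃ • (Θ 2 ⊗ Θ 2)) i ⟨
      coef (c₁ • (Θ 0 ⊗ Θ 4) ⊕ (c₂ • (Θ 1 ⊗ Θ 3) ⊕ c₃ • (Θ 2 ⊗ Θ 2))) i
        ≈⟨ at homogeneous i ⟩
      0ℤ ∎
      where
      open SetoidReasoning ≈-setoid
      i = n +ⁿ s
      pair : ℕ → ℕ → ℤ
      pair i j = falling i (+ n) * (falling j (+ s) * ε) + falling j (+ n) * (falling i (+ s) * ε)
      polynomial : ∀ μ σ ε → let κ = μ + σ ; ν = 1ℤ + μ + σ in
        (1ℤ + κ) * (+ 2 + κ) * (1ℤ * ((σ - + 3) * ((σ - + 2) * ((σ - + 1) * ((σ - + 0) * 1ℤ))) * ε)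
          + (ν - + 3) * ((ν - + 2) * ((ν - + 1) * ((ν - + 0) * 1ℤ))) * (1ℤ * ε))
        + (- (+ 4 * ((1ℤ + κ) * (κ - 1ℤ))) * ((ν - + 0) * 1ℤ * ((σ - + 2) * ((σ - + 1) * ((σ - + 0) * 1ℤ)) * ε)
          + (ν - + 2) * ((ν - + 1) * ((ν - + 0) * 1ℤ)) * ((σ - + 0) * 1ℤ * ε))
        + + 3 * (κ * (κ - 1ℤ)) * ((ν - + 1) * ((ν - + 0) * 1ℤ) * ((σ - + 1) * ((σ - + 0) * 1ℤ) * ε)
          + (ν - + 1) * ((ν - + 0) * 1ℤ) * ((σ - + 1) * ((σ - + 0) * 1ℤ) * ε)))
        ≡ (1ℤ + κ) * ((1ℤ + μ) * (μ * ((+ 2 + μ) * ((+ 2 + κ) * (1ℤ + μ) - + 6 * κ)))) * ε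
      polynomial = solve-∀
      identity : ∀ μ σ κ ε → κ ≡ μ + σ → let ν = 1ℤ + μ + σ in
        (1ℤ + κ) * (+ 2 + κ) * (falling 0 ν * (falling 4 σ * ε) + falling 4 ν * (falling 0 σ * ε))
        + (- (+ 4 * ((1ℤ + κ) * (κ - 1ℤ))) * (falling 1 ν * (falling 3 σ * ε) + falling 3 ν * (falling 1 σ * ε))
        + + 3 * (κ * (κ - 1ℤ)) * (falling 2 ν * (falling 2 σ * ε) + falling 2 ν * (falling 2 σ * ε)))
        ≡ (1ℤ + κ) * ((1ℤ + μ) * (μ * ((+ 2 + μ) * ((+ 2 + κ) * (1ℤ + μ) - + 6 * κ)))) * ε
      identity μ σ κ ε refl = polynomial μ σ ε

    power-top : ∀ j → coef (f ^ᵖ suc j) (suc m +ⁿ (j *ⁿ n +ⁿ s)) ≈ 1ℤ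
    power-top j = subst (λ i → coef (f ^ᵖ suc j) i ≈ 1ℤ)
      (trans (cong (suc j *ⁿ_) (trans |ws|≡k+1 (cong suc (sym m+s≡k)))) (lemma (suc m) s (j *ⁿ n)))
      (leading (fromRoots^-monic as (suc j)))
      where
      lemma : ∀ x y z → x +ⁿ y +ⁿ z ≡ x +ⁿ (z +ⁿ y)
      lemma = ℕ-solve-∀

    -- Powers keep the gap, and as the leading coefficients are 1 the next coefficients add up, as
    -- in a first-order binomial expansion.
    power-next : ∀ j → Gap (f ^ᵖ suc j) (suc m) (j *ⁿ n +ⁿ s) × coef (f ^ᵖ suc j) (j *ⁿ n +ⁿ s) ≈ + suc j * ε
    power-next zero = Gap-resp {f} {f ^ᵖ 1} f≋f¹ gap ,
      ≈-trans (≈-sym (at f≋f¹ s)) (≡⇒≈ (sym (ℤₚ.*-identityˡ ε)))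
      where
      f≋f¹ : f ≋ f ⊗ const 1ℤ
      f≋f¹ = ≋-sym (≋-trans (⊗-comm f (const 1ℤ)) (≋-trans (const-⊗ 1ℤ f) (1•P≋P f)))
    power-next (suc j) with power-next j
    ... | gap′ , next = subst (Gap (f ^ᵖ suc (suc j)) (suc m)) index (product-gap f (f ^ᵖ suc j) m s t gap gap′) ,
      subst (λ i → coef (f ^ᵖ suc (suc j)) i ≈ + suc (suc j) * ε) index (begin
        coef (f ⊗ f ^ᵖ suc j) (n +ⁿ t)                                              ≈⟨ product-next f (f ^ᵖ suc j) m s t gap gap′ ⟩
        coef f n * coef (f ^ᵖ suc j) t + coef (f ^ᵖ suc j) (suc m +ⁿ t) * ε         ≈⟨ +-cong (*-cong f-top next) (*-cong (power-top j) (≈-refl {ε})) ⟩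
        1ℤ * (+ suc j * ε) + 1ℤ * ε                                                 ≡⟨ lemma (+ suc j) ε ⟩
        + suc (suc j) * ε                                                           ∎)
      where
      open SetoidReasoning ≈-setoid
      t = j *ⁿ n +ⁿ s
      index : n +ⁿ t ≡ suc j *ⁿ n +ⁿ s
      index = sym (ℕₚ.+-assoc n (j *ⁿ n) s)
      lemma : ∀ x y → 1ℤ * (x * y) + 1ℤ * y ≡ (1ℤ + x) * y
      lemma = solve-∀

    W : ℤ
    W = wsum ws (_^ (k +ⁿ suc m))

    -- Compares the coefficients of degree t in F = C f^k: on the left a moment of order N - t = k +
    -- m + 1, on the right C k ε. With the formula for `C` both sides acquire the factor N! / (k + m
    -- + 1)!, which is `R` and cancels.
    expansion : ∀ t → 0 <ⁿ t → suc m +ⁿ t ≡ d → coef (f ^ᵖ k) t ≈ κ * ε →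
                + rising k (suc m) * (κ * ε) ≈ + rising t (suc m) * W
    expansion t 0<t m+t≡d next = *-cancel (+ R) (rising-≉0 (k +ⁿ suc m) t (subst (_<ⁿ p) N≡ N<p)) (begin
      + R * (+ rising k (suc m) * (κ * ε))
        ≡⟨ regroup₁ (+ R) (+ rising k (suc m)) (κ * ε) ⟩
      + rising k (suc m) * + R * (κ * ε)
        ≡⟨ cong (λ z → z * (κ * ε)) (trans (cong (λ i → + rising k i) (sym m+t≡d)) (trans (cong +_ (rising-+ k (suc m) t)) (ℤₚ.pos-* (rising k (suc m)) R))) ⟨
      + rising k d * (κ * ε)
        ≈⟨ *-cong C-formula (≈-refl {κ * ε}) ⟨
      + (d !) * C * (κ * ε)
        ≡⟨ cong (λ z → z * C * (κ * ε)) (trans (cong (λ i → + (i !)) (trans (sym m+t≡d) (ℕₚ.+-comm (suc m) t))) (trans (cong +_ (!-rising t (suc m))) (ℤₚ.pos-* (t !) (rising t (suc m))))) ⟩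
      + (t !) * + rising t (suc m) * C * (κ * ε)
        ≡⟨ regroup₂ (+ (t !)) (+ rising t (suc m)) C (κ * ε) ⟩
      + rising t (suc m) * (+ (t !) * (C * (κ * ε)))
        ≈⟨ *-congˡ (+ rising t (suc m)) (*-congˡ (+ (t !)) F-t) ⟨
      + rising t (suc m) * (+ (t !) * coef F t)
        ≈⟨ *-congˡ (+ rising t (suc m)) (F-coef t (k +ⁿ suc m) 0<t (trans (ℕₚ.+-comm t (k +ⁿ suc m)) (sym N≡))) ⟩
      + rising t (suc m) * (+ R * W)
        ≡⟨ regroup₃ (+ rising t (suc m)) (+ R) W ⟩
      + R * (+ rising t (suc m) * W) ∎)
      where
      open SetoidReasoning ≈-setoid
      R : ℕ
      R = rising (k +ⁿ suc m) t
      N≡ : N ≡ k +ⁿ suc m +ⁿ t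
      N≡ = trans (cong (k +ⁿ_) (sym m+t≡d)) (sym (ℕₚ.+-assoc k (suc m) t))
      F-t : coef F t ≈ C * (κ * ε)
      F-t = ≈-trans (at F≋Cf^k t) (≈-trans (≡⇒≈ (coef-• C (f ^ᵖ k) t)) (*-congˡ C next))
      regroup₁ : ∀ x y z → x * (y * z) ≡ y * x * z
      regroup₁ = solve-∀
      regroup₂ : ∀ x y z w → x * y * z * w ≡ y * (x * (z * w))
      regroup₂ = solve-∀
      regroup₃ : ∀ x y z → x * (y * z) ≡ y * (x * z)
      regroup₃ = solve-∀

    wsum-neg : ∀ j → wsum ws (λ a → (- a) ^ j) ≡ (- 1ℤ) ^ j * wsum ws (_^ j)
    wsum-neg j = trans (wsum-ext ws (λ a → ^-neg a j)) (wsum-* ws ((- 1ℤ) ^ j) (_^ j))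

    -- The divided difference of xᵐ f(x) = xᵏ⁺ᵐ⁺¹ + ε xᵏ + (lower terms), which vanishes at every node.
    moment : (- 1ℤ) ^ (k +ⁿ suc m) * W + ε * (- 1ℤ) ^ k ≈ 0ℤ
    moment = ≈-trans (≈-sym (begin
      wsum ws (λ a → ev (raise m f) (- a))
        ≈⟨ wsum-cong ws (All.universal (λ a → ev-cong (- a) decompose) as) ⟩
      wsum ws (λ a → ev (raise (m +ⁿ n) (const 1ℤ) ⊕ (ε • raise k (const 1ℤ) ⊕ R)) (- a))
        ≡⟨ wsum-ext ws evaluate ⟩
      wsum ws (λ a → (- a) ^ (m +ⁿ n) + (ε * (- a) ^ k + ev R (- a)))
        ≡⟨ trans (wsum-+ ws (λ a → (- a) ^ (m +ⁿ n)) (λ a → ε * (- a) ^ k + ev R (- a)))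
             (cong (λ z → wsum ws (λ a → (- a) ^ (m +ⁿ n)) + z) (wsum-+ ws (λ a → ε * (- a) ^ k) (λ a → ev R (- a)))) ⟩
      wsum ws (λ a → (- a) ^ (m +ⁿ n)) + (wsum ws (λ a → ε * (- a) ^ k) + wsum ws (λ a → ev R (- a)))
        ≈⟨ +-cong (≡⇒≈ (trans (cong (λ i → wsum ws (λ a → (- a) ^ i)) m+n≡) (wsum-neg (k +ⁿ suc m))))
             (+-cong (≡⇒≈ (trans (wsum-* ws ε (λ a → (- a) ^ k)) (cong (λ z → ε * z) (wsum-neg k)))) (kills-low-degree dd R R-Deg<)) ⟩
      (- 1ℤ) ^ (k +ⁿ suc m) * W + (ε * ((- 1ℤ) ^ k * wsum ws (_^ k)) + 0ℤ)
        ≈⟨ +-cong (≈-refl {(- 1ℤ) ^ (k +ⁿ suc m) * W}) (+-cong (*-congˡ ε (*-congˡ ((- 1ℤ) ^ k) top)) (≈-refl {0ℤ})) ⟩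
      (- 1ℤ) ^ (k +ⁿ suc m) * W + (ε * ((- 1ℤ) ^ k * 1ℤ) + 0ℤ)
        ≡⟨ tidy ((- 1ℤ) ^ (k +ⁿ suc m) * W) ε ((- 1ℤ) ^ k) ⟩
      (- 1ℤ) ^ (k +ⁿ suc m) * W + ε * (- 1ℤ) ^ k ∎))
      (wsum-≈0 ws (All.tabulate λ {a} a∈ → ≈-trans (≡⇒≈ (ev-raise m f (- a))) (*-zeroʳ′ ((- a) ^ m) (f-root a∈))))
      where
      open SetoidReasoning ≈-setoid
      tidy : ∀ x y z → x + (y * (z * 1ℤ) + 0ℤ) ≡ x + y * z
      tidy = solve-∀
      A R : Poly
      A = remainder f n
      R = remainder (raise m A) k
      m+n≡ : m +ⁿ n ≡ k +ⁿ suc m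
      m+n≡ = trans (lemma m s) (cong (_+ⁿ suc m) m+s≡k)
        where
        lemma : ∀ m s → m +ⁿ (suc m +ⁿ s) ≡ m +ⁿ s +ⁿ suc m
        lemma = ℕ-solve-∀
      coef-k : coef (raise m A) k ≡ ε
      coef-k = trans (cong (coef (raise m A)) (sym m+s≡k))
        (trans (coef-raise m A s) (coef-remainder f n (ℕₚ.<⇒≢ (s≤s (ℕₚ.m≤n+m s m)))))
      raise-raise : ∀ a b P → raise a (raise b P) ≡ raise (a +ⁿ b) P
      raise-raise zero    b P = refl
      raise-raise (suc a) b P = cong (0ℤ ∷_) (raise-raise a b P)
      decompose : raise m f ≋ raise (m +ⁿ n) (const 1ℤ) ⊕ (ε • raise k (const 1ℤ) ⊕ R)
      decompose = ≋-trans (raise-cong m (≋-trans (split-top f n)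
          (⊕-cong (≋-trans (•-cong f-top (≋-refl {raise n (const 1ℤ)})) (1•P≋P (raise n (const 1ℤ)))) (≋-refl {A}))))
        (≋-trans (raise-⊕ m (raise n (const 1ℤ)) A)
          (⊕-cong {raise m (raise n (const 1ℤ))} {raise (m +ⁿ n) (const 1ℤ)} (≡⇒≋ λ i → cong (λ P → coef P i) (raise-raise m n (const 1ℤ)))
            (≋-trans (split-top (raise m A) k)
              (⊕-cong (•-cong (≡⇒≈ coef-k) (≋-refl {raise k (const 1ℤ)})) (≋-refl {R})))))
      ev-monomial : ∀ i r → ev (raise i (const 1ℤ)) r ≡ r ^ i
      ev-monomial i r = trans (ev-raise i (const 1ℤ) r)
        (trans (cong (λ z → r ^ i * z) (cong (λ z → 1ℤ + z) (ℤₚ.*-zeroʳ r))) (ℤₚ.*-identityʳ (r ^ i)))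
      evaluate : ∀ a → ev (raise (m +ⁿ n) (const 1ℤ) ⊕ (ε • raise k (const 1ℤ) ⊕ R)) (- a) ≡
                 (- a) ^ (m +ⁿ n) + (ε * (- a) ^ k + ev R (- a))
      evaluate a = trans (ev-⊕ (raise (m +ⁿ n) (const 1ℤ)) (ε • raise k (const 1ℤ) ⊕ R) (- a))
        (cong₂ _+_ (ev-monomial (m +ⁿ n) (- a)) (trans (ev-⊕ (ε • raise k (const 1ℤ)) R (- a))
          (cong (λ z → z + ev R (- a)) (trans (ev-• ε (raise k (const 1ℤ)) (- a)) (cong (λ z → ε * z) (ev-monomial k (- a)))))))
      R-Deg< : Deg< R k
      R-Deg< i k≤i with i ℕₚ.≟ k
      ... | yes refl = ≡⇒≈ (coef-remainder-top (raise m A) k)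
      ... | no  i≢k  = ≈-trans (≡⇒≈ (coef-remainder (raise m A) k i≢k))
        (subst (λ j → coef (raise m A) j ≈ 0ℤ) i≡ (≈-trans (≡⇒≈ (coef-raise m A (i ∸ⁿ m)))
          (remainder-Deg< f (suc m) s gap (i ∸ⁿ m) (ℕₚ.+-cancelˡ-< m s (i ∸ⁿ m)
            (ℕₚ.≤-trans (s≤s (ℕₚ.≤-reflexive m+s≡k)) (ℕₚ.≤-trans (ℕₚ.≤∧≢⇒< k≤i (λ k≡i → i≢k (sym k≡i))) (ℕₚ.≤-reflexive (sym i≡))))))))
        where
        i≡ : m +ⁿ (i ∸ⁿ m) ≡ i
        i≡ = ℕₚ.m+[n∸m]≡n (ℕₚ.≤-trans (ℕₚ.m≤m+n m s) (ℕₚ.≤-trans (ℕₚ.≤-reflexive m+s≡k) k≤i))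

    topRelations : Σ ℕ λ t → suc m +ⁿ t ≡ suc k *ⁿ k × TopRelations k (suc m) t ε W
    topRelations = t , trans m+t≡d (sym k[k+1]≡4+e) , record
      { moment    = moment
      ; expansion = expansion t (s≤s z≤n) m+t≡d (subst (λ i → coef (f ^ᵖ i) t ≈ + i * ε) k≡ (proj₂ (power-next (suc j))))
      }
      where
      j t : ℕ
      j = k ∸ⁿ 2
      -- Taking k = j + 2 makes `t` a visible successor; positivity keeps clear of the constant term
      -- of `F`.
      t = suc j *ⁿ n +ⁿ s
      k≡ : suc (suc j) ≡ k
      k≡ = ℕₚ.m+[n∸m]≡n (ℕₚ.≤-trans (s≤s (s≤s z≤n)) 3≤k)
      m+t≡d : suc m +ⁿ t ≡ d
      m+t≡d = trans (lemma (suc m) s (suc j *ⁿ n)) (trans (cong₂ _*ⁿ_ k≡ (cong suc m+s≡k)) (trans (ℕₚ.*-comm k (suc k)) k[k+1]≡4+e))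
        where
        lemma : ∀ x y z → x +ⁿ (z +ⁿ y) ≡ x +ⁿ y +ⁿ z
        lemma = ℕ-solve-∀

    module _ (2d<p : d +ⁿ d <ⁿ p) (p≢41 : k ≡ 4 → p ≢ 41) (1≤m : 1 ≤ⁿ m) where

      m≤k : m ≤ⁿ k
      m≤k = subst (m ≤ⁿ_) m+s≡k (ℕₚ.m≤m+n m s)

      x y : ℕ
      x = (2 +ⁿ k) *ⁿ suc m
      y = 6 *ⁿ k

      2[k+1]k<p : suc k *ⁿ k +ⁿ suc k *ⁿ k <ⁿ p
      2[k+1]k<p = subst (λ i → i +ⁿ i <ⁿ p) (sym k[k+1]≡4+e) 2d<p

      x<p : x <ⁿ p
      x<p = ℕₚ.≤-<-trans ([k+2][m+1]≤2[k+1]k k m 3≤k m≤k) 2[k+1]k<p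

      y<p : y <ⁿ p
      y<p = ℕₚ.≤-<-trans (6k≤2[k+1]k k 3≤k) 2[k+1]k<p

      m+2≤N : 2 +ⁿ m ≤ⁿ N
      m+2≤N = ℕₚ.≤-trans (ℕₚ.≤-trans (s≤s (s≤s m≤k)) (ℕₚ.≤-trans (ℕₚ.≤-reflexive (ℕₚ.+-comm 2 k)) (ℕₚ.+-monoʳ-≤ k (s≤s (s≤s z≤n))))) k+4≤N

      ε≈0 : ε ≈ 0ℤ
      ε≈0 = decide (x ℕₚ.≟ y)
        where
        regular : x ≢ y → indicial ≉ 0ℤ
        regular x≢y = *-≉0 1+κ≉0 (*-≉0 (small-≉0 (suc m) (s≤s z≤n) (ℕₚ.≤-trans (ℕₚ.n≤1+n (suc m)) m+2≤N))
          (*-≉0 (small-≉0 m 1≤m (ℕₚ.≤-trans (ℕₚ.m≤n+m m 2) m+2≤N))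
            (*-≉0 (small-≉0 (2 +ⁿ m) (s≤s z≤n) m+2≤N) λ z → x≢y (+-injective-≈ x<p y<p
              (via (ℤₚ.pos-* (2 +ⁿ k) (suc m)) (ℤₚ.pos-* 6 k) (-≈0⇒≈ {(+ 2 + κ) * (1ℤ + + m)} {+ 6 * κ} z))))))
        decide : Dec (x ≡ y) → ε ≈ 0ℤ
        decide (no x≢y)  = *-cancel-≈0 indicial (regular x≢y) indicial-equation
        decide (yes x≡y) = first-coefficient≈0 (exceptional-sizes k m 3≤k 1≤m x≡y) (proj₁ (proj₂ topRelations))
          2[k+1]k<p p≢41 (proj₂ (proj₂ topRelations))

  -- Collapse of f to a monomial.

  module _ (2d<p : d +ⁿ d <ⁿ p) (p≢41 : k ≡ 4 → p ≢ 41) (sum≈0 : coef f k ≈ 0ℤ) where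

    -- Descends through the degrees: the coefficients already killed form the gap that makes
    -- `coef f s` the next candidate. The start, in degree k, is the centring condition.
    lower-coefficients : ∀ m s → m +ⁿ s ≡ k → ∀ i → s ≤ⁿ i → i ≢ suc k → coef f i ≈ 0ℤ
    lower-coefficients zero    s refl  i s≤i i≢ with ℕₚ.m≤n⇒m<n∨m≡n s≤i
    ... | inj₁ s<i  = bound f-monic i (ℕₚ.≤∧≢⇒< s<i (λ eq → i≢ (sym eq)))
    ... | inj₂ refl = sum≈0
    lower-coefficients (suc m) s m+s≡k i s≤i i≢ with ℕₚ.m≤n⇒m<n∨m≡n s≤i
    ... | inj₁ s<i  = lower-coefficients m (suc s) (trans (ℕₚ.+-suc m s) m+s≡k) i s<i i≢
    ... | inj₂ refl = FirstCoefficient.ε≈0 (suc m) s m+s≡k gap 2d<p p≢41 (s≤s z≤n)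
      where
      gap : Gap f (suc (suc m)) s
      gap j s<j j≢ = lower-coefficients m (suc s) (trans (ℕₚ.+-suc m s) m+s≡k) j s<j
        (λ j≡ → j≢ (trans j≡ (cong suc (sym m+s≡k))))

    f≋monomial : f ≋ raise (suc k) (const 1ℤ)
    f≋monomial = coefwise λ i → go i
      where
      go : ∀ i → coef f i ≈ coef (raise (suc k) (const 1ℤ)) i
      go i with i ℕₚ.≟ suc k
      ... | yes refl = ≈-trans (leading f-monic) (≡⇒≈ (sym (coef-raise-1-top (suc k))))
      ... | no  i≢   = ≈-trans (lower-coefficients k 0 (ℕₚ.+-identityʳ k) i z≤n i≢) (≡⇒≈ (sym (coef-raise-1 (suc k) i≢)))

    node-power≈0 : ∀ {a} → a ∈ as → (- a) ^ suc k ≈ 0ℤ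
    node-power≈0 {a} a∈ = begin
      (- a) ^ suc k                              ≡⟨ ℤₚ.*-identityʳ ((- a) ^ suc k) ⟨
      (- a) ^ suc k * 1ℤ                         ≡⟨ cong (λ z → (- a) ^ suc k * (1ℤ + z)) (ℤₚ.*-zeroʳ (- a)) ⟨
      (- a) ^ suc k * ev (const 1ℤ) (- a)        ≡⟨ ev-raise (suc k) (const 1ℤ) (- a) ⟨
      ev (raise (suc k) (const 1ℤ)) (- a)        ≈⟨ ev-cong (- a) f≋monomial ⟨
      ev f (- a)                                 ≈⟨ f-root a∈ ⟩
      0ℤ                                         ∎
      where open SetoidReasoning ≈-setoid

    -- Double negation suffices, as it is only used to derive `⊥`, and it follows at once from
    -- `^-≉0`.
    nodes-¬≉0 : ∀ {a} → a ∈ as → ¬ (a ≉ 0ℤ)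
    nodes-¬≉0 {a} a∈ a≉0 = ^-≉0 (suc k) (λ -a≈0 → a≉0 (≈-trans (≡⇒≈ (sym (ℤₚ.neg-involutive a))) (-‿cong -a≈0)))
      (node-power≈0 a∈)

    no-such-nodes : ⊥
    no-such-nodes = go as refl distinct
      where
      go : ∀ xs → xs ≡ as → AllPairs _≉_ xs → ⊥
      go []           eq _ = contradiction (trans (cong length eq) |ws|≡k+1) λ ()
      go (x ∷ [])     eq _ = ℕₚ.<⇒≢ k>0 (ℕₚ.suc-injective (trans (cong length eq) |ws|≡k+1))
      go (x ∷ y ∷ xs) eq ((x≉y ∷ _) ∷ _) = nodes-¬≉0 (subst (x ∈_) eq (here refl)) λ x≈0 →
        nodes-¬≉0 (subst (y ∈_) eq (there (here refl))) λ y≈0 → x≉y (≈-trans x≈0 (≈-sym y≈0))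

-- Translation to centred nodes.

sumᶻ : List ℤ → ℤ
sumᶻ []       = 0ℤ
sumᶻ (a ∷ as) = a + sumᶻ as

module DifferenceSets (p : ℕ) (p-prime : Prime p) where
  open Congruence p
  open Domain p-prime
  open Monic p
  open Weights p using (dividedDifference)

  second-coefficient : ∀ a as → coef (fromRoots (a ∷ as)) (length as) ≈ sumᶻ (a ∷ as)
  second-coefficient a [] = ≡⇒≈ (trans (coef-lin-zero a (const 1ℤ)) (lemma a))
    where
    lemma : ∀ a → a * 1ℤ ≡ a + 0ℤ
    lemma = solve-∀
  second-coefficient a (b ∷ bs) = ≈-trans (≡⇒≈ (coef-lin-suc a (fromRoots (b ∷ bs)) (length bs)))
    (+-cong (≈-trans (*-congˡ a (leading (fromRoots-monic (b ∷ bs)))) (≡⇒≈ (ℤₚ.*-identityʳ a)))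
      (second-coefficient b bs))

  strengthen : ∀ {R S : ℤ → ℤ → Set} {as} → (∀ {a b} → a ∈ as → b ∈ as → R a b → S a b) → AllPairs R as → AllPairs S as
  strengthen h []       = []
  strengthen h (r ∷ rs) = All.tabulate (λ b∈ → h (here refl) (there b∈) (All.lookup r b∈))
    ∷ strengthen (λ a∈ b∈ → h (there a∈) (there b∈)) rs

  no-centred-difference-set : ∀ k as → 3 ≤ⁿ k → length as ≡ suc k → AllPairs _≉_ as →
    (∀ {a b} → a ∈ as → b ∈ as → a ≈ b ⊎ (a - b) ^ (suc k *ⁿ k) ≈ 1ℤ) →
    suc k *ⁿ k +ⁿ suc k *ⁿ k <ⁿ p → (k ≡ 4 → p ≢ 41) → sumᶻ as ≈ 0ℤ → ⊥
  no-centred-difference-set k (a ∷ as) 3≤k |as| distinct differences 2d<p p≢41 centred =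
    go (proj₁ weights) (proj₁ (proj₂ weights))
      (subst (λ i → Weights.IsDividedDifference p i (proj₁ weights)) (ℕₚ.suc-injective |as|) (proj₂ (proj₂ weights)))
    where
    e : ℕ
    e = suc k *ⁿ k ∸ⁿ 4
    d≡4+e : suc k *ⁿ k ≡ 4 +ⁿ e
    d≡4+e = sym (ℕₚ.m+[n∸m]≡n (ℕₚ.≤-trans (ℕₚ.≤-trans (s≤s 3≤k) (ℕₚ.≤-reflexive (sym (ℕₚ.*-identityʳ (suc k)))))
      (ℕₚ.*-monoʳ-≤ (suc k) (ℕₚ.≤-trans (s≤s z≤n) 3≤k))))
    differences′ : ∀ {x y} → x ∈ a ∷ as → y ∈ a ∷ as → x ≈ y ⊎ (x - y) ^ (4 +ⁿ e) ≈ 1ℤ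
    differences′ {x} {y} x∈ y∈ = subst (λ i → x ≈ y ⊎ (x - y) ^ i ≈ 1ℤ) d≡4+e (differences x∈ y∈)
    2d<p′ : 4 +ⁿ e +ⁿ (4 +ⁿ e) <ⁿ p
    2d<p′ = subst (λ i → i +ⁿ i <ⁿ p) d≡4+e 2d<p
    weights : Σ (List (ℤ × ℤ)) λ ws → nodes ws ≡ a ∷ as × Weights.IsDividedDifference p (length as) ws
    -- The exponent d - 1 = 3 + e is the one whose power inverts a difference of nodes.
    weights = dividedDifference (3 +ⁿ e) a as (strengthen
      (λ x∈ y∈ x≉y → [ (λ y≈x → contradiction (≈-sym y≈x) x≉y) , (λ unit → unit) ]′ (differences′ y∈ x∈)) distinct)
    go : ∀ ws → nodes ws ≡ a ∷ as → Weights.IsDividedDifference p k ws → ⊥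
    go ws eq dd = Stepanov.no-such-nodes p p-prime k e 3≤k d≡4+e
      (ℕₚ.≤-<-trans (ℕₚ.+-monoˡ-≤ (4 +ⁿ e) (ℕₚ.≤-trans (ℕₚ.m≤m+n k (k *ⁿ k)) (ℕₚ.≤-reflexive d≡4+e))) 2d<p′)
      ws dd (trans (cong length eq) |as|) (subst (AllPairs _≉_) (sym eq) distinct)
      (λ x∈ y∈ → differences′ (subst (_ ∈_) eq x∈) (subst (_ ∈_) eq y∈)) 2d<p′ p≢41
      (subst (λ xs → coef (fromRoots xs) k ≈ 0ℤ) (sym eq)
        (≈-trans (subst (λ i → coef (fromRoots (a ∷ as)) i ≈ sumᶻ (a ∷ as)) (ℕₚ.suc-injective |as|) (second-coefficient a as)) centred))

  translate : ℤ → List ℤ → List ℤ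
  translate c = map (_- c)

  sum-translate : ∀ c as → sumᶻ (translate c as) ≡ sumᶻ as - + length as * c
  sum-translate c []       = refl
  sum-translate c (a ∷ as) = trans (cong (λ z → a - c + z) (sum-translate c as)) (lemma a c (sumᶻ as) (+ length as))
    where
    lemma : ∀ a c s l → a - c + (s - l * c) ≡ a + s - (1ℤ + l) * c
    lemma = solve-∀

  difference-translate : ∀ a b c → a - c - (b - c) ≡ a - b
  difference-translate = solve-∀

  -- With `v` an inverse of n, subtracting the mean of the nodes keeps all differences and
  -- annihilates the coefficient of degree k in `f`.
  no-difference-set : ∀ k as → 3 ≤ⁿ k → length as ≡ suc k → AllPairs _≉_ as →
    (∀ {a b} → a ∈ as → b ∈ as → a ≈ b ⊎ (a - b) ^ (suc k *ⁿ k) ≈ 1ℤ) →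
    suc k *ⁿ k +ⁿ suc k *ⁿ k <ⁿ p → (k ≡ 4 → p ≢ 41) → (v : ℤ) → + suc k * v ≈ 1ℤ → ⊥
  no-difference-set k as 3≤k |as| distinct differences 2d<p p≢41 v inverse =
    no-centred-difference-set k (translate c as) 3≤k (trans (Listₚ.length-map (_- c) as) |as|)
      (AllPairsₚ.map⁺ (AllPairs.map (λ {a} {b} a≉b e → a≉b (combine₁ 1ℤ e (shift-back a b c))) distinct))
      differences′ 2d<p p≢41 centred
    where
    c : ℤ
    c = v * sumᶻ as
    shift-back : ∀ a b c → a - b ≡ 1ℤ * (a - c - (b - c))
    shift-back = solve-∀
    differences′ : ∀ {x y} → x ∈ translate c as → y ∈ translate c as → x ≈ y ⊎ (x - y) ^ (suc k *ⁿ k) ≈ 1ℤ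
    differences′ x∈ y∈ with ∈-map⁻ (_- c) x∈ | ∈-map⁻ (_- c) y∈
    ... | a , a∈ , refl | b , b∈ , refl =
      [ (λ a≈b → inj₁ (combine₁ 1ℤ a≈b (trans (difference-translate a b c) (sym (ℤₚ.*-identityˡ (a - b))))))
      , (λ unit → inj₂ (subst (λ z → z ^ (suc k *ⁿ k) ≈ 1ℤ) (sym (difference-translate a b c)) unit)) ]′ (differences a∈ b∈)
    centred : sumᶻ (translate c as) ≈ 0ℤ
    centred = ≈-trans (≡⇒≈ (trans (sum-translate c as) (cong (λ i → sumᶻ as - + i * c) |as|)))
      (combine₁ (- sumᶻ as) inverse (lemma (sumᶻ as) (+ suc k) v))
      where
      lemma : ∀ s l v → s - l * (v * s) - 0ℤ ≡ - s * (l * v - 1ℤ)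
      lemma = solve-∀

-- Subsets of the prime field as lists of integers.

elements : ∀ {n} → Subset n → List (Fin n)
elements []          = []
elements (true ∷ s)  = zero ∷ map suc (elements s)
elements (false ∷ s) = map suc (elements s)

length-elements : ∀ {n} (s : Subset n) → length (elements s) ≡ ∣ s ∣ˢ
length-elements []          = refl
length-elements (true ∷ s)  = cong suc (trans (Listₚ.length-map suc (elements s)) (length-elements s))
length-elements (false ∷ s) = trans (Listₚ.length-map suc (elements s)) (length-elements s)

elements-distinct : ∀ {n} (s : Subset n) → AllPairs _≢_ (elements s)
elements-distinct []          = []
elements-distinct (true ∷ s)  = Allₚ.map⁺ (All.universal (λ _ ()) (elements s))
  ∷ AllPairsₚ.map⁺ (AllPairs.map (λ x≢y eq → x≢y (Finₚ.suc-injective eq)) (elements-distinct s))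
elements-distinct (false ∷ s) =
  AllPairsₚ.map⁺ (AllPairs.map (λ x≢y eq → x≢y (Finₚ.suc-injective eq)) (elements-distinct s))

∈-elements : ∀ {n} (s : Subset n) {x} → x ∈ elements s → x ∈ˢ s
∈-elements (true ∷ s) (here refl) = here
∈-elements (true ∷ s) (there x∈) with ∈-map⁻ suc x∈
... | y , y∈ , refl = there (∈-elements s y∈)
∈-elements (false ∷ s) x∈ with ∈-map⁻ suc x∈
... | y , y∈ , refl = there (∈-elements s y∈)

∣tabulate∣ : ∀ {n} (g : Fin n → _) → ∣ tabulate g ∣ˢ ≡ sum (λ i → if g i then 1 else 0)
∣tabulate∣ {zero}  g = refl
∣tabulate∣ {suc n} g with g zero
... | true  = cong suc (∣tabulate∣ (λ i → g (suc i)))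
... | false = ∣tabulate∣ (λ i → g (suc i))

pos-^ : ∀ x j → + (x ^ⁿ j) ≡ (+ x) ^ j
pos-^ x zero    = refl
pos-^ x (suc j) = trans (ℤₚ.pos-* x (x ^ⁿ j)) (cong (λ z → + x * z) (pos-^ x j))

module PrimeField (p : ℕ) .{{_ : NonZero p}} (p-prime : Prime p) where
  open Congruence p
  open ExceptionalSizes p p-prime using (+-injective-≈)

  p≈0 : + p ≈ 0ℤ
  p≈0 = ∣⇒≈0 (divides 1 (sym (ℕₚ.+-identityʳ p)))

  %-≈ : ∀ m → + (m % p) ≈ + m
  %-≈ m = ≈-sym (≈-trans (≡⇒≈ (trans (cong +_ (m≡m%n+[m/n]*n m p)) (cong (λ z → + (m % p) + z) (ℤₚ.pos-* (m / p) p))))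
    (≈-trans (+-cong (≈-refl {+ (m % p)}) (*-zeroʳ′ (+ (m / p)) p≈0)) (≡⇒≈ (ℤₚ.+-identityʳ (+ (m % p))))))

  value : Fin p → ℤ
  value x = + toℕ x

  value-injective : ∀ {x y} → value x ≈ value y → x ≡ y
  value-injective {x} {y} e = Finₚ.toℕ-injective (+-injective-≈ (Finₚ.toℕ<n x) (Finₚ.toℕ<n y) e)

  value-addF : ∀ x y → value (addF p x y) ≈ value x + value y
  value-addF x y = ≈-trans (≡⇒≈ (cong +_ (Finₚ.toℕ-fromℕ< (m%n<n (toℕ x +ⁿ toℕ y) p)))) (%-≈ (toℕ x +ⁿ toℕ y))

  value-negF : ∀ x → value (negF p x) ≈ - value x
  value-negF x = begin
    value (negF p x)            ≡⟨ cong +_ (Finₚ.toℕ-fromℕ< (m%n<n (p ∸ⁿ toℕ x) p)) ⟩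
    + ((p ∸ⁿ toℕ x) % p)        ≈⟨ %-≈ (p ∸ⁿ toℕ x) ⟩
    + (p ∸ⁿ toℕ x)              ≡⟨ trans (ℤₚ.m-n≡m⊖n p (toℕ x)) (ℤₚ.⊖-≥ (ℕₚ.<⇒≤ (Finₚ.toℕ<n x))) ⟨
    + p - value x               ≈⟨ +-cong p≈0 (≈-refl { - value x}) ⟩
    0ℤ - value x                ≡⟨ ℤₚ.+-identityˡ (- value x) ⟩
    - value x                   ∎
    where open SetoidReasoning ≈-setoid

  negF-involutive : ∀ x → negF p (negF p x) ≡ x
  negF-involutive x = value-injective (≈-trans (value-negF (negF p x))
    (≈-trans (-‿cong (value-negF x)) (≡⇒≈ (ℤₚ.neg-involutive (value x)))))

  -- Cardinality is a sum of indicator values, which negation, being an involution, only permutes.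
  ∣negSet∣ : ∀ A → ∣ negSet p A ∣ˢ ≡ ∣ A ∣ˢ
  ∣negSet∣ A = begin
    ∣ negSet p A ∣ˢ                                       ≡⟨ ∣tabulate∣ (λ x → lookup A (negF p x)) ⟩
    sum (λ x → if lookup A (negF p x) then 1 else 0)      ≡⟨ sum-permute (λ x → if lookup A x then 1 else 0) negation ⟨
    sum (λ x → if lookup A x then 1 else 0)               ≡⟨ ∣tabulate∣ (lookup A) ⟨
    ∣ tabulate (lookup A) ∣ˢ                              ≡⟨ cong ∣_∣ˢ (tabulate∘lookup A) ⟩
    ∣ A ∣ˢ                                                ∎
    where
    open ≡-Reasoning
    negation : Permutation p p
    negation = permutation (negF p) (negF p) negF-involutive negF-involutive

  negF-∈ : ∀ {A x} → x ∈ˢ A → negF p x ∈ˢ negSet p A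
  negF-∈ {A} {x} x∈ = lookup⇒[]= (negF p x) (negSet p A) (trans (lookup∘tabulate (λ y → lookup A (negF p y)) (negF p x))
    (trans (cong (lookup A) (negF-involutive x)) ([]=⇒lookup x∈)))

  difference-∈ : ∀ {d A x y} → SumsetInMu0 p d A (negSet p A) → x ∈ˢ A → y ∈ˢ A →
                 value x ≈ value y ⊎ (value x - value y) ^ d ≈ 1ℤ
  difference-∈ {d} {A} {x} {y} sums x∈ y∈ =
    [ (λ unit → inj₂ (≈-trans (^-cong d (≈-sym v≈)) (power unit)))
    , (λ v≡0 → inj₁ (-≈0⇒≈ {value x} {value y} (≈-trans (≈-sym v≈) (≡⇒≈ (cong +_ v≡0))))) ]′ (sums x (negF p y) x∈ (negF-∈ y∈))
    where
    v : Fin p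
    v = addF p x (negF p y)
    v≈ : value v ≈ value x - value y
    v≈ = ≈-trans (value-addF x (negF p y)) (+-cong (≈-refl {value x}) (value-negF y))
    power : InMu p d v → value v ^ d ≈ 1ℤ
    power unit = ≈-trans (≡⇒≈ (sym (pos-^ (toℕ v) d))) (≈-trans (≈-sym (%-≈ (toℕ v ^ⁿ d)))
      (≈-trans (≡⇒≈ (cong +_ unit)) (%-≈ 1)))

theorem4 : (p d : ℕ) .{{_ : NonZero p}} → Prime p → d ∣ p ∸ 1 → 1 < d → d < p ∸ 1
    → d ≢ 2 → d ≢ 6 → ¬ (p ≡ 41 × d ≡ 20)
    → (A : Subset p) → ¬ Critical p d A (negSet p A)
theorem4 p d p-prime (divides q p-1≡qd) 1<d d<p-1 d≢2 d≢6 exception A (1<∣A∣ , _ , sums , card) =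
  go ∣ A ∣ˢ refl 1<∣A∣ n²≡d+n
  where
  open Congruence p
  open PrimeField p p-prime
  open DifferenceSets p p-prime

  -- With B = - A the intersection in the definition of criticality is - A itself.
  n²≡d+n : ∣ A ∣ˢ *ⁿ ∣ A ∣ˢ ≡ d +ⁿ ∣ A ∣ˢ
  n²≡d+n = trans (cong (∣ A ∣ˢ *ⁿ_) (sym (∣negSet∣ A))) (trans card (cong (d +ⁿ_)
    (trans (cong ∣_∣ˢ (Subsetₚ.∩-idem (negSet p A))) (∣negSet∣ A))))

  -- A proper divisor of p - 1 has a cofactor of at least 2.
  2d≤p-1 : ∀ q → p ∸ 1 ≡ q *ⁿ d → d +ⁿ d ≤ⁿ p ∸ 1
  2d≤p-1 zero          eq = contradiction (subst (d <_) eq d<p-1) λ ()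
  2d≤p-1 (suc zero)    eq = contradiction (trans eq (ℕₚ.+-identityʳ d)) (λ p-1≡d → ℕₚ.<⇒≢ d<p-1 (sym p-1≡d))
  2d≤p-1 (suc (suc q)) eq = subst (d +ⁿ d ≤ⁿ_) (sym eq) (ℕₚ.+-monoʳ-≤ d (ℕₚ.m≤m+n d (q *ⁿ d)))

  1≤p : 1 ≤ⁿ p
  1≤p = ℕₚ.<⇒≤ (nonTrivial⇒n>1 p {{prime⇒nonTrivial p-prime}})

  2d<p : d +ⁿ d <ⁿ p
  2d<p = ℕₚ.≤-trans (s≤s (2d≤p-1 q p-1≡qd)) (ℕₚ.≤-reflexive (ℕₚ.m+[n∸m]≡n 1≤p))

  qd≈-1 : + (q *ⁿ d) ≈ - 1ℤ
  qd≈-1 = combine₁ 1ℤ p≈0 (trans (lemma (+ (q *ⁿ d))) (cong (λ z → 1ℤ * (z - 0ℤ)) (cong +_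
    (trans (cong suc (sym p-1≡qd)) (ℕₚ.m+[n∸m]≡n 1≤p)))))
    where
    lemma : ∀ x → x - - 1ℤ ≡ 1ℤ * (1ℤ + x - 0ℤ)
    lemma = solve-∀

  go : ∀ n → ∣ A ∣ˢ ≡ n → 1 <ⁿ n → n *ⁿ n ≡ d +ⁿ n → ⊥
  go (suc zero) _ (s≤s ()) _
  go (suc (suc zero)) _ _ eq = d≢2 (ℕₚ.+-cancelʳ-≡ 2 d 2 (sym eq))
  go (suc (suc (suc zero))) _ _ eq = d≢6 (ℕₚ.+-cancelʳ-≡ 3 d 6 (sym eq))
  go n@(suc k@(suc (suc (suc _)))) ∣A∣≡n _ eq = no-difference-set k as (s≤s (s≤s (s≤s z≤n)))
    (trans (Listₚ.length-map value (elements A)) (trans (length-elements A) ∣A∣≡n))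
    (AllPairsₚ.map⁺ (AllPairs.map (λ x≢y e → x≢y (value-injective e)) (elements-distinct A)))
    differences (subst (λ i → i +ⁿ i <ⁿ p) d≡ 2d<p)
    (λ { refl p≡41 → exception (p≡41 , d≡) })
    -- As n k q = q d = p - 1 is congruent to - 1, this is an inverse of n.
    (- (+ k * + q)) inverse
    where
    as : List ℤ
    as = map value (elements A)
    d≡ : d ≡ n *ⁿ k
    d≡ = sym (ℕₚ.+-cancelʳ-≡ n (n *ⁿ k) d (trans (lemma k) eq))
      where
      lemma : ∀ k → suc k *ⁿ k +ⁿ suc k ≡ suc k *ⁿ suc k
      lemma = ℕ-solve-∀
    differences : ∀ {a b} → a ∈ as → b ∈ as → a ≈ b ⊎ (a - b) ^ (n *ⁿ k) ≈ 1ℤ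
    differences a∈ b∈ with ∈-map⁻ value a∈ | ∈-map⁻ value b∈
    ... | x , x∈ , refl | y , y∈ , refl = subst (λ i → value x ≈ value y ⊎ (value x - value y) ^ i ≈ 1ℤ) d≡
      (difference-∈ {d} sums (∈-elements A x∈) (∈-elements A y∈))
    inverse : + n * - (+ k * + q) ≈ 1ℤ
    inverse = combine₁ (- 1ℤ) qd≈-1 (trans (lemma (+ n) (+ k) (+ q))
      (cong (λ z → - 1ℤ * (z - - 1ℤ)) (sym (trans (ℤₚ.pos-* q d) (cong (λ z → + q * z) (trans (cong +_ d≡) (ℤₚ.pos-* n k)))))))
      where
      lemma : ∀ n k q → n * - (k * q) - 1ℤ ≡ - 1ℤ * (q * (n * k) - - 1ℤ)
      lemma = solve-∀
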